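{- Let $M$ be a moon polyomino and $\mathbf r$ a vector of non-negative integers. Let $\mathcal F_{01}^{ne}(M,l,\mathbf r)$ be the set of $0$-$1$-fillings of $M$ in which the length of the longest ne-chain equals $l$ and row $i$ contains exactly $\mathbf r_i$ non-zero entries (for every $i$). Then for every permutation $\sigma$ of the column indices of $M$ such that $\sigma M$ is again a moon polyomino, $$|\mathcal F_{01}^{ne}(M,l,\mathbf r)|=|\mathcal F_{01}^{ne}(\sigma M,l,\mathbf r)|.$$ Furthermore, the number of $0$-$1$-fillings of a moon polyomino $M$ with a given number of non-zero entries and a given length of the longest ne-chain depends only on the content of $M$ (and on these two numbers).
   Context: A polyomino is a finite subset of $\mathbb Z^2$, whose elements are called cells; a column (row) is the set of its cells on a vertical (horizontal) line. It is convex if for any two cells in the same column (row) all elements of $\mathbb Z^2$ between them are cells. It is intersection-free if for any two columns, the set of row coordinates of one is contained in that of the other. A moon polyomino is a convex, intersection-free polyomino. For a permutation $\sigma$ of the column indices, $\sigma M=\{(\sigma i,j):(i,j)\in M\}$ (columns are translated horizontally, keeping their vertical positions). The content of $M$ is the multiset of column heights (listed in decreasing order). A $0$-$1$-filling assigns $0$ or $1$ to each cell. A chain is a sequence of cells with non-zero entries such that the smallest rectangle containing all of them is contained in $M$; an ne-chain of length $k$ is such a chain of $k$ cells, each strictly to the right of and strictly above the preceding one. -}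

module Defs where

open import Data.Nat using (ℕ; zero; suc; _+_; _≤?_)
open import Data.Bool using (Bool; true; false; if_then_else_)
open import Data.Fin using (Fin) renaming (_≤_ to _≤ᶠ_; _<_ to _<ᶠ_)
open import Data.Fin.Permutation using (Permutation′; _⟨$⟩ˡ_)
open import Data.Vec using (Vec; lookup; allFin)
open import Data.List using (List; filter)
import Data.Vec as V
open import Data.Product using (Σ; ∃; ∃-syntax; _×_; _,_; proj₁; proj₂)
open import Data.Sum using (_⊎_)
open import Data.Nat using (_≤_)
open import Relation.Binary.PropositionalEquality using (_≡_)

-- A polyomino inside the w × h box: cell (i , j) has column (x-coordinate) i
-- and row (y-coordinate) j; M i j ≡ true means (i , j) is a cell.
Poly : ℕ → ℕ → Set
Poly w h = Fin w → Fin h → Bool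

Cell : ∀ {w h} → Poly w h → Fin w → Fin h → Set
Cell M i j = M i j ≡ true

IsConvex : ∀ {w h} → Poly w h → Set
IsConvex {w} {h} M =
  (∀ (i : Fin w) (j₁ j j₂ : Fin h) → Cell M i j₁ → Cell M i j₂ →
     j₁ ≤ᶠ j → j ≤ᶠ j₂ → Cell M i j)
  × (∀ (j : Fin h) (i₁ i i₂ : Fin w) → Cell M i₁ j → Cell M i₂ j →
     i₁ ≤ᶠ i → i ≤ᶠ i₂ → Cell M i j)

IsIntersectionFree : ∀ {w h} → Poly w h → Set
IsIntersectionFree {w} {h} M = ∀ (i i′ : Fin w) →
  (∀ (j : Fin h) → Cell M i j → Cell M i′ j) ⊎ (∀ (j : Fin h) → Cell M i′ j → Cell M i j)

IsMoon : ∀ {w h} → Poly w h → Set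
IsMoon M = IsConvex M × IsIntersectionFree M

-- σ M = { (σ i , j) : (i , j) ∈ M }
permuteCols : ∀ {w h} → Permutation′ w → Poly w h → Poly w h
permuteCols σ M i j = M (σ ⟨$⟩ˡ i) j

-- 0-1 fillings are represented as Boolean matrices (column-major)
Matrix : ℕ → ℕ → Set
Matrix w h = Vec (Vec Bool h) w

entry : ∀ {w h} → Matrix w h → Fin w → Fin h → Bool
entry F i j = lookup (lookup F i) j

IsFilling : ∀ {w h} → Poly w h → Matrix w h → Set
IsFilling M F = ∀ i j → entry F i j ≡ true → Cell M i j

b2n : Bool → ℕ
b2n true = 1
b2n false = 0

rowCount : ∀ {w h} → Matrix w h → Fin h → ℕ
rowCount F j = V.sum (V.map (λ col → b2n (lookup col j)) F)

totalCount : ∀ {w h} → Matrix w h → ℕ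
totalCount F = V.sum (V.map (λ col → V.sum (V.map b2n col)) F)

-- a chain (in M, w.r.t. filling F): cells with non-zero entries such that the
-- smallest rectangle containing all of them is contained in M
IsChain : ∀ {w h} → Poly w h → Matrix w h → ∀ {k} → Vec (Fin w × Fin h) k → Set
IsChain {w} {h} M F {k} cs =
  (∀ (p : Fin k) → entry F (proj₁ (lookup cs p)) (proj₂ (lookup cs p)) ≡ true)
  × (∀ (a : Fin w) (b : Fin h) →
       (∃[ p ] ∃[ q ] (proj₁ (lookup cs p) ≤ᶠ a × a ≤ᶠ proj₁ (lookup cs q))) →
       (∃[ p ] ∃[ q ] (proj₂ (lookup cs p) ≤ᶠ b × b ≤ᶠ proj₂ (lookup cs q))) →
       Cell M a b)

IsNE : ∀ {w h k} → Vec (Fin w × Fin h) k → Set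
IsNE {w} {h} {k} cs = ∀ (p q : Fin k) → Data.Fin.toℕ p Data.Nat.< Data.Fin.toℕ q →
  (proj₁ (lookup cs p) <ᶠ proj₁ (lookup cs q)) × (proj₂ (lookup cs p) <ᶠ proj₂ (lookup cs q))
  where import Data.Fin; import Data.Nat

NEChain : ∀ {w h} → Poly w h → Matrix w h → ℕ → Set
NEChain {w} {h} M F k = Σ (Vec (Fin w × Fin h) k) λ cs → IsChain M F cs × IsNE cs

LongestNE : ∀ {w h} → Poly w h → Matrix w h → ℕ → Set
LongestNE M F l = NEChain M F l × (∀ k → NEChain M F k → k ≤ l)

FneRows : ∀ {w h} → Poly w h → ℕ → (Fin h → ℕ) → Matrix w h → Set
FneRows M l r F = IsFilling M F × LongestNE M F l × (∀ j → rowCount F j ≡ r j)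

FneTotal : ∀ {w h} → Poly w h → ℕ → ℕ → Matrix w h → Set
FneTotal M l n F = IsFilling M F × LongestNE M F l × totalCount F ≡ n

SameSize : ∀ {A B : Set} → (A → Set) → (B → Set) → Set
SameSize {A} {B} P Q = Σ (A → B) λ f → Σ (B → A) λ g →
  (∀ x → P x → Q (f x)) × (∀ y → Q y → P (g y)) ×
  (∀ x → P x → g (f x) ≡ x) × (∀ y → Q y → f (g y) ≡ y)

colHeight : ∀ {w h} → Poly w h → Fin w → ℕ
colHeight {w} {h} M i = V.sum (V.map (λ j → b2n (M i j)) (allFin h))

content : ∀ {w h} → Poly w h → List ℕ
content {w} M = filter (λ n → 1 ≤? n) (V.toList (V.map (colHeight M) (allFin w)))

{-# OPTIONS --safe #-}

-- The length of the longest ne-chain of a filling with natural numbers depends only on its support, so the numbers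
-- of 0-1-fillings with prescribed row sums are determined recursively by those of ℕ-fillings: an ℕ-filling with
-- row sums r is a 0-1-filling with row counts s ≤ r together with compositions of the r j into s j parts.
--
-- For ℕ-fillings, suppose that the first column c is contained in the next columns B and contains all later ones;
-- then c can be moved across B. Let R be the rectangle formed by c and the rows of c in B. Apply RSK to R ∩ B,
-- multiply the tableau P by c from the left, and invert RSK with c as the last column and the recording tableau of
-- B unchanged. This preserves the plactic class of R, hence the row sums and the longest chains in every interval
-- of rows of R, which is all that matters for rectangles reaching beyond B. It also preserves the recording tableau
-- of R ∩ B, hence (RSK being symmetric) the longest chains in every interval of columns of B, which is all that
-- matters for rectangles reaching beyond the rows of c. Since a smallest column of a moon polyomino is its first or
-- last one, such moves sort the columns by size, and the result depends only on the row lengths of M.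
--
-- Sorting the columns, transposing and sorting again gives a Ferrers diagram that is determined by the content.

module Submission where

open import Data.Bool using (Bool; true; false)
import Data.Bool.Properties as B
open import Data.Empty using (⊥-elim)
open import Data.Fin using (Fin; zero; suc; toℕ; fromℕ; fromℕ<) renaming (_≤_ to _≤ᶠ_)
open import Data.Fin.Permutation using (Permutation′; _⟨$⟩ˡ_; flip)
open import Data.Fin.Properties as F using (toℕ<n; toℕ-fromℕ; toℕ-fromℕ<; fromℕ<-toℕ; toℕ-injective; all?; any?; injective⇒≤)
open import Data.List using (List; []; _∷_; [_]; _++_; length; filter; cartesianProductWith; upTo; deduplicate; replicate)
import Data.List as L
open import Data.List.Properties using (length-replicate)
open import Data.List.Membership.Propositional using (_∈_)
open import Data.List.Membership.Propositional.Properties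
  using (∈-lookup; ∈-filter⁺; ∈-filter⁻; ∈-upTo⁺; ∈-cartesianProductWith⁺; ∈-deduplicate⁺)
import Data.List.Membership.Setoid.Properties as MS
open import Data.List.Relation.Binary.Permutation.Propositional using (_↭_)
open import Data.List.Relation.Binary.Permutation.Propositional.Properties using (map⁺)
import Data.List.Relation.Unary.All as All
open import Data.List.Relation.Unary.AllPairs using (_∷_)
open import Data.List.Relation.Unary.Any using (here; there; index)
open import Data.List.Relation.Unary.Unique.Propositional using (Unique)
import Data.List.Relation.Unary.Unique.Propositional.Properties as U
import Data.List.Relation.Unary.Unique.DecPropositional.Properties as UD
open import Data.Nat
open import Data.Nat.ListAction using () renaming (sum to listSum)
open import Data.Nat.ListAction.Properties using (sum-↭)
open import Data.Nat.Properties
open import Data.Nat.Tactic.RingSolver using (solve-∀)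
open import Data.Product using (Σ; ∃; ∃-syntax; _×_; _,_; proj₁; proj₂)
open import Data.Sum using (_⊎_; inj₁; inj₂)
open import Data.Vec using (Vec; []; _∷_; lookup; tabulate; allFin)
import Data.Vec as V
import Data.Vec.Properties as VP
open import Relation.Binary.Definitions using (DecidableEquality; tri<; tri≈; tri>)
open import Relation.Binary.PropositionalEquality hiding ([_])
open import Relation.Nullary using (Dec; yes; no; ¬_)
open import Relation.Nullary.Decidable using (_×-dec_; _→-dec_; ¬?; map′)
open import Relation.Unary using (Decidable)
open import Algebra.Properties.CommutativeMonoid.Sum +-0-commutativeMonoid using (sum; sum-permute; ∑-comm; sum-cong-≗)
open import Defs

-- Fillings with natural numbers come first because inverse RSK can turn a 0-1-array into one with
-- larger entries, whereas over ℕ every pair of tableaux of equal shape is attained. Tableaux are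
-- never handled as diagrams with entries: a tableau is a sequence of shapes growing by horizontal
-- strips, and RSK is a grid of shapes in which every cell obeys one rule. The rule is symmetric in
-- its two directions and can be solved from either of two opposite corners, so symmetry and
-- invertibility of RSK are read off from it. Once an array is turned upside down, a north-east
-- chain is a strictly decreasing subsequence of a word. No theorem that measures such subsequences
-- by shapes is invoked: a single bumping step, seen as a queue, is shown to preserve the decreasing
-- subsequences in every interval of letters, and everything else follows by concatenating words.
-- Bijections are obtained from relations that determine either side from the other, so composites
-- of the constructed maps never have to be computed.

Shape : Set
Shape = ℕ → ℕ

infix 4 _≺_

-- For partitions: `x / z` is a horizontal strip, the set of boxes that equal letters may occupy in
-- a tableau.
_≺_ : Shape → Shape → Set
z ≺ x = ∀ k → z k ≤ x k × x (suc k) ≤ z k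

≺-resp : ∀ {z z′ x x′} → z ≗ z′ → x ≗ x′ → z ≺ x → z′ ≺ x′
≺-resp z≗ x≗ s k =
  subst₂ _≤_ (z≗ k) (x≗ k) (proj₁ (s k)) , subst₂ _≤_ (x≗ (suc k)) (z≗ k) (proj₂ (s k))

zero-≺ : ∀ {z x} → (∀ k → z k ≡ 0) → (∀ k → x k ≡ 0) → z ≺ x
zero-≺ z≡0 x≡0 k = ≤-reflexive (trans (z≡0 k) (sym (x≡0 k))) , ≤-reflexive (trans (x≡0 (suc k)) (sym (z≡0 k)))

-- RSK

-- The tropical form of Fomin's local rule for RSK.
record RCell (z x y : Shape) (c : ℕ) (w : Shape) : Set where
  field
    top  : w 0 ≡ x 0 ⊔ y 0 + c
    step : ∀ k → w (suc k) + z k ≡ (x (suc k) ⊔ y (suc k)) + (x k ⊓ y k)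

open RCell

RCell-sym : ∀ {z x y c w} → RCell z x y c w → RCell z y x c w
RCell-sym {x = x} {y} {c} C .top = trans (top C) (cong (_+ c) (⊔-comm (x 0) (y 0)))
RCell-sym {x = x} {y} C .step k =
  trans (step C k) (cong₂ _+_ (⊔-comm (x (suc k)) (y (suc k))) (⊓-comm (x k) (y k)))

-- By interlacing, `z k` lies between the maximum and the minimum on the right of `step`; hence so
-- does `w (suc k)`, which has the same sum with it. The converse below exchanges the roles of the
-- two.
cell-≺ : ∀ {z x y c w} → z ≺ x → z ≺ y → RCell z x y c w → x ≺ w × y ≺ w
cell-≺ {z} {x} {y} {c} {w} zx zy C =
    (λ k → ≤-trans (m≤m⊔n (x k) (y k)) (lower k) , ≤-trans (upper k) (m⊓n≤m (x k) (y k)))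
  , (λ k → ≤-trans (m≤n⊔m (x k) (y k)) (lower k) , ≤-trans (upper k) (m⊓n≤n (x k) (y k)))
  where
  upper : ∀ k → w (suc k) ≤ x k ⊓ y k
  upper k = +-cancelʳ-≤ (z k) _ _ (begin
    w (suc k) + z k                            ≡⟨ step C k ⟩
    (x (suc k) ⊔ y (suc k)) + (x k ⊓ y k)      ≤⟨ +-monoˡ-≤ _ (⊔-lub (proj₂ (zx k)) (proj₂ (zy k))) ⟩
    z k + (x k ⊓ y k)                          ≡⟨ +-comm (z k) _ ⟩
    (x k ⊓ y k) + z k                          ∎)
    where open ≤-Reasoning
  lower : ∀ k → x k ⊔ y k ≤ w k
  lower zero = subst (x 0 ⊔ y 0 ≤_) (sym (top C)) (m≤m+n _ c)
  lower (suc k) = +-cancelʳ-≤ (z k) _ _ (begin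
    (x (suc k) ⊔ y (suc k)) + z k              ≤⟨ +-monoʳ-≤ (x (suc k) ⊔ y (suc k)) (⊓-glb (proj₁ (zx k)) (proj₁ (zy k))) ⟩
    (x (suc k) ⊔ y (suc k)) + (x k ⊓ y k)      ≡⟨ step C k ⟨
    w (suc k) + z k                            ∎)
    where open ≤-Reasoning

cell-≺⁻ : ∀ {z x y c w} → x ≺ w → y ≺ w → RCell z x y c w → z ≺ x × z ≺ y
cell-≺⁻ {z} {x} {y} {c} {w} xw yw C =
    (λ k → ≤-trans (upper k) (m⊓n≤m (x k) (y k)) , ≤-trans (m≤m⊔n (x (suc k)) (y (suc k))) (lower k))
  , (λ k → ≤-trans (upper k) (m⊓n≤n (x k) (y k)) , ≤-trans (m≤n⊔m (x (suc k)) (y (suc k))) (lower k))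
  where
  upper : ∀ k → z k ≤ x k ⊓ y k
  upper k = +-cancelˡ-≤ (w (suc k)) _ _ (begin
    w (suc k) + z k                            ≡⟨ step C k ⟩
    (x (suc k) ⊔ y (suc k)) + (x k ⊓ y k)      ≤⟨ +-monoˡ-≤ _ (⊔-lub (proj₁ (xw (suc k))) (proj₁ (yw (suc k)))) ⟩
    w (suc k) + (x k ⊓ y k)                    ∎)
    where open ≤-Reasoning
  lower : ∀ k → x (suc k) ⊔ y (suc k) ≤ z k
  lower k = +-cancelˡ-≤ (w (suc k)) _ _ (begin
    w (suc k) + (x (suc k) ⊔ y (suc k))        ≤⟨ +-monoˡ-≤ _ (⊓-glb (proj₂ (xw k)) (proj₂ (yw k))) ⟩
    (x k ⊓ y k) + (x (suc k) ⊔ y (suc k))      ≡⟨ +-comm (x k ⊓ y k) _ ⟩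
    (x (suc k) ⊔ y (suc k)) + (x k ⊓ y k)      ≡⟨ step C k ⟨
    w (suc k) + z k                            ∎)
    where open ≤-Reasoning

cellOut : Shape → Shape → Shape → ℕ → Shape
cellOut z x y c zero    = x 0 ⊔ y 0 + c
cellOut z x y c (suc k) = ((x (suc k) ⊔ y (suc k)) + (x k ⊓ y k)) ∸ z k

cellOut-RCell : ∀ {z x y} c → z ≺ x → z ≺ y → RCell z x y c (cellOut z x y c)
cellOut-RCell c zx zy .top = refl
cellOut-RCell {z} {x} {y} c zx zy .step k =
  m∸n+n≡m (≤-trans (⊓-glb (proj₁ (zx k)) (proj₁ (zy k))) (m≤n+m (x k ⊓ y k) (x (suc k) ⊔ y (suc k))))

cellIn : Shape → Shape → Shape → Shape
cellIn w x y k = ((x (suc k) ⊔ y (suc k)) + (x k ⊓ y k)) ∸ w (suc k)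

cellIn-RCell : ∀ {w x y} → x ≺ w → y ≺ w → RCell (cellIn w x y) x y (w 0 ∸ (x 0 ⊔ y 0)) w
cellIn-RCell {w} {x} {y} xw yw .top = sym (m+[n∸m]≡n (⊔-lub (proj₁ (xw 0)) (proj₁ (yw 0))))
cellIn-RCell {w} {x} {y} xw yw .step k =
  m+[n∸m]≡n (≤-trans (⊓-glb (proj₂ (xw k)) (proj₂ (yw k))) (m≤n+m (x k ⊓ y k) (x (suc k) ⊔ y (suc k))))

RCell-unique : ∀ {z x y c w z′ x′ y′ c′ w′} → z ≗ z′ → x ≗ x′ → y ≗ y′ → c ≡ c′ →
  RCell z x y c w → RCell z′ x′ y′ c′ w′ → w ≗ w′
RCell-unique z≗ x≗ y≗ c≡ C C′ zero =
  trans (top C) (trans (cong₂ _+_ (cong₂ _⊔_ (x≗ 0) (y≗ 0)) c≡) (sym (top C′)))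
RCell-unique {z = z} {w = w} {w′ = w′} z≗ x≗ y≗ c≡ C C′ (suc k) = +-cancelʳ-≡ (z k) _ _ (begin
  w (suc k) + z k   ≡⟨ step C k ⟩
  _                 ≡⟨ cong₂ _+_ (cong₂ _⊔_ (x≗ (suc k)) (y≗ (suc k))) (cong₂ _⊓_ (x≗ k) (y≗ k)) ⟩
  _                 ≡⟨ step C′ k ⟨
  w′ (suc k) + _    ≡⟨ cong (w′ (suc k) +_) (z≗ k) ⟨
  w′ (suc k) + z k  ∎)
  where open ≡-Reasoning

RCell-unique⁻ : ∀ {z x y c w z′ x′ y′ c′ w′} → w ≗ w′ → x ≗ x′ → y ≗ y′ →
  RCell z x y c w → RCell z′ x′ y′ c′ w′ → z ≗ z′ × c ≡ c′
RCell-unique⁻ {z} {x} {y} {c} {w} {z′} {c′ = c′} w≗ x≗ y≗ C C′ =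
    (λ k → +-cancelˡ-≡ (w (suc k)) _ _ (begin
       w (suc k) + z k   ≡⟨ step C k ⟩
       _                 ≡⟨ cong₂ _+_ (cong₂ _⊔_ (x≗ (suc k)) (y≗ (suc k))) (cong₂ _⊓_ (x≗ k) (y≗ k)) ⟩
       _                 ≡⟨ step C′ k ⟨
       _ + z′ k          ≡⟨ cong (_+ z′ k) (w≗ (suc k)) ⟨
       w (suc k) + z′ k  ∎))
  , +-cancelˡ-≡ (x 0 ⊔ y 0) _ _ (begin
      x 0 ⊔ y 0 + c      ≡⟨ top C ⟨
      w 0                ≡⟨ w≗ 0 ⟩
      _                  ≡⟨ top C′ ⟩
      _ + c′             ≡⟨ cong (_+ c′) (cong₂ _⊔_ (x≗ 0) (y≗ 0)) ⟨
      x 0 ⊔ y 0 + c′     ∎)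
  where open ≡-Reasoning

Array : Set
Array = ℕ → ℕ → ℕ

Growth : Set
Growth = ℕ → ℕ → Shape

-- G i j is the RSK shape of the columns < i and the rows < j of A.
record RSK (m h : ℕ) (A : Array) (G : Growth) : Set where
  field
    left : ∀ j → j ≤ h → ∀ k → G 0 j k ≡ 0
    bot  : ∀ i → i ≤ m → ∀ k → G i 0 k ≡ 0
    cell : ∀ i j → i < m → j < h →
      RCell (G i j) (G i (suc j)) (G (suc i) j) (A i j) (G (suc i) (suc j))

open RSK

-- The symmetry of the local rule is the symmetry of RSK: transposing the array exchanges the
-- insertion and the recording tableau.
RSK-transpose : ∀ {m h A G} → RSK m h A G → RSK h m (λ j i → A i j) (λ j i → G i j)
RSK-transpose R .left = bot R
RSK-transpose R .bot  = left R
RSK-transpose R .cell j i j<h i<m = RCell-sym (cell R i j i<m j<h)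

RSK-restrict : ∀ {m m′ h A G} → m′ ≤ m → RSK m h A G → RSK m′ h A G
RSK-restrict m′≤m R .left = left R
RSK-restrict m′≤m R .bot i i≤ = bot R i (≤-trans i≤ m′≤m)
RSK-restrict m′≤m R .cell i j i< = cell R i j (≤-trans i< m′≤m)

module _ {m h A G} (R : RSK m h A G) where

  rowStrip : ∀ i j → i ≤ m → j < h → G i j ≺ G i (suc j)
  colStrip : ∀ i j → i < m → j ≤ h → G i j ≺ G (suc i) j
  rowStrip zero j i≤m j<h = zero-≺ (left R j (<⇒≤ j<h)) (left R (suc j) j<h)
  rowStrip (suc i) j i<m j<h =
    proj₂ (cell-≺ (rowStrip i j (<⇒≤ i<m) j<h) (colStrip i j i<m (<⇒≤ j<h)) (cell R i j i<m j<h))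
  colStrip i zero i<m j≤h = zero-≺ (bot R i (<⇒≤ i<m)) (bot R (suc i) i<m)
  colStrip i (suc j) i<m j<h =
    proj₁ (cell-≺ (rowStrip i j (<⇒≤ i<m) j<h) (colStrip i j i<m (<⇒≤ j<h)) (cell R i j i<m j<h))

growth : Array → Growth
growth A zero    j       = λ _ → 0
growth A (suc i) zero    = λ _ → 0
growth A (suc i) (suc j) = cellOut (growth A i j) (growth A i (suc j)) (growth A (suc i) j) (A i j)

module _ (A : Array) where
  private
    rowS : ∀ i j → growth A i j ≺ growth A i (suc j)
    colS : ∀ i j → growth A i j ≺ growth A (suc i) j
    rowS zero j = zero-≺ (λ _ → refl) (λ _ → refl)
    rowS (suc i) j = proj₂ (cell-≺ (rowS i j) (colS i j) (cellOut-RCell (A i j) (rowS i j) (colS i j)))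
    colS zero zero = zero-≺ (λ _ → refl) (λ _ → refl)
    colS (suc i) zero = zero-≺ (λ _ → refl) (λ _ → refl)
    colS i (suc j) = proj₁ (cell-≺ (rowS i j) (colS i j) (cellOut-RCell (A i j) (rowS i j) (colS i j)))

  growth-RSK : ∀ m h → RSK m h A (growth A)
  growth-RSK m h .left j _ k = refl
  growth-RSK m h .bot zero _ k = refl
  growth-RSK m h .bot (suc i) _ k = refl
  growth-RSK m h .cell i j _ _ = cellOut-RCell (A i j) (rowS i j) (colS i j)

RSK-unique : ∀ {m h A A′ G G′} → RSK m h A G → RSK m h A′ G′ →
  (∀ i j → i < m → j < h → A i j ≡ A′ i j) → ∀ i j → i ≤ m → j ≤ h → G i j ≗ G′ i j
RSK-unique R R′ A≗ zero j i≤ j≤ k = trans (left R j j≤ k) (sym (left R′ j j≤ k))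
RSK-unique R R′ A≗ (suc i) zero i≤ j≤ k = trans (bot R (suc i) i≤ k) (sym (bot R′ (suc i) i≤ k))
RSK-unique R R′ A≗ (suc i) (suc j) i< j< =
  RCell-unique (RSK-unique R R′ A≗ i j (<⇒≤ i<) (<⇒≤ j<)) (RSK-unique R R′ A≗ i (suc j) (<⇒≤ i<) j<)
    (RSK-unique R R′ A≗ (suc i) j i< (<⇒≤ j<)) (A≗ i j i< j<) (cell R i j i< j<) (cell R′ i j i< j<)

module _ {m h A A′ G G′} (R : RSK m h A G) (R′ : RSK m h A′ G′)
  (right≗ : ∀ j → j ≤ h → G m j ≗ G′ m j) (top≗ : ∀ i → i ≤ m → G i h ≗ G′ i h) where
  private
    inside : ∀ {i i′ n} → i + suc i′ ≡ n → i < n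
    inside {i} {i′} refl = m<m+n i (s≤s z≤n)
    up : ∀ {i i′ n} → i + suc i′ ≡ n → suc i + i′ ≡ n
    up {i} {i′} e = trans (sym (+-suc i i′)) e
    G≗ : ∀ i′ j′ i j → i + i′ ≡ m → j + j′ ≡ h → G i j ≗ G′ i j
    G≗ zero j′ i j i≡ refl rewrite +-identityʳ i | i≡ = right≗ j (m≤m+n j j′)
    G≗ (suc i′) zero i j refl j≡ rewrite +-identityʳ j | j≡ = top≗ i (m≤m+n i (suc i′))
    G≗ (suc i′) (suc j′) i j i≡ j≡ = proj₁ (RCell-unique⁻
      (G≗ i′ j′ (suc i) (suc j) (up i≡) (up j≡)) (G≗ (suc i′) j′ i (suc j) i≡ (up j≡))
      (G≗ i′ (suc j′) (suc i) j (up i≡) j≡) (cell R i j (inside i≡) (inside j≡)) (cell R′ i j (inside i≡) (inside j≡)))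

  -- The right border is the insertion tableau and the top border the recording tableau; starting at
  -- their common corner, each cell is solved for its smallest shape.
  RSK-unique⁻-shapes : ∀ i j → i ≤ m → j ≤ h → G i j ≗ G′ i j
  RSK-unique⁻-shapes i j i≤ j≤ = G≗ (m ∸ i) (h ∸ j) i j (m+[n∸m]≡n i≤) (m+[n∸m]≡n j≤)

  RSK-unique⁻ : ∀ i j → i < m → j < h → A i j ≡ A′ i j
  RSK-unique⁻ i j i< j< = proj₂ (RCell-unique⁻ (S (suc i) (suc j) i< j<) (S i (suc j) (<⇒≤ i<) j<)
    (S (suc i) j i< (<⇒≤ j<)) (cell R i j i< j<) (cell R′ i j i< j<))
    where S = RSK-unique⁻-shapes

∸-suc : ∀ {i m} → i < m → m ∸ i ≡ suc (m ∸ suc i)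
∸-suc {zero}  {suc m} _       = refl
∸-suc {suc i} {suc m} (s≤s l) = ∸-suc l

-- Inverse RSK: P and Q are the insertion and the recording tableau.
module Shrink (m h : ℕ) (P Q : ℕ → Shape)
  (P≺ : ∀ j → j < h → P j ≺ P (suc j)) (Q≺ : ∀ i → i < m → Q i ≺ Q (suc i))
  (P0 : ∀ k → P 0 k ≡ 0) (Q0 : ∀ k → Q 0 k ≡ 0) (corner : P h ≗ Q m) where

  private
    -- Indexed by the distances from the corner `(m , h)`, from which the grid is filled in.
    H : ℕ → ℕ → Shape
    H zero    j       = P (h ∸ j)
    H (suc i) zero    = Q (m ∸ suc i)
    H (suc i) (suc j) = cellIn (H i j) (H (suc i) j) (H i (suc j))

    rowS : ∀ i j → i ≤ m → j < h → H i (suc j) ≺ H i j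
    colS : ∀ i j → i < m → j ≤ h → H (suc i) j ≺ H i j
    rowS zero j i≤ j< rewrite ∸-suc j< = P≺ (h ∸ suc j) (∸-monoʳ-< {h} (s≤s z≤n) j<)
    rowS (suc i) j i< j< = proj₁ (cell-≺⁻ (colS i j i< (<⇒≤ j<)) (rowS i j (<⇒≤ i<) j<)
      (cellIn-RCell (colS i j i< (<⇒≤ j<)) (rowS i j (<⇒≤ i<) j<)))
    colS zero zero i< j≤ = ≺-resp (λ _ → refl) (λ k → trans (cong (λ n → Q n k) (sym (∸-suc {0} i<))) (sym (corner k)))
      (Q≺ (m ∸ 1) (∸-monoʳ-< {m} (s≤s z≤n) i<))
    colS (suc i) zero i< j≤ rewrite ∸-suc i< = Q≺ (m ∸ suc (suc i)) (∸-monoʳ-< {m} (s≤s z≤n) i<)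
    colS i (suc j) i< j< = proj₂ (cell-≺⁻ (colS i j i< (<⇒≤ j<)) (rowS i j (<⇒≤ i<) j<)
      (cellIn-RCell (colS i j i< (<⇒≤ j<)) (rowS i j (<⇒≤ i<) j<)))

  G : Growth
  G i j = H (m ∸ i) (h ∸ j)

  A : Array
  A i j = G (suc i) (suc j) 0 ∸ (G i (suc j) 0 ⊔ G (suc i) j 0)

  right : ∀ j → j ≤ h → G m j ≗ P j
  right j j≤ k rewrite n∸n≡0 m | m∸[m∸n]≡n j≤ = refl

  ceil : ∀ i → i ≤ m → G i h ≗ Q i
  ceil i i≤ k rewrite n∸n≡0 h with m ∸ i in e
  -- At the corner itself `H` takes its value from `P`, and the hypothesis `corner` turns it into
  -- `Q m`.
  ... | zero   rewrite ≤-antisym i≤ (m∸n≡0⇒m≤n e) = corner k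
  ... | suc d  rewrite sym e | m∸[m∸n]≡n i≤ = refl

  private
    gRow : ∀ i j → i ≤ m → j < h → G i j ≺ G i (suc j)
    gRow i j i≤ j< rewrite ∸-suc j< = rowS (m ∸ i) (h ∸ suc j) (m∸n≤m m i) (∸-monoʳ-< {h} (s≤s z≤n) j<)
    gCol : ∀ i j → i < m → j ≤ h → G i j ≺ G (suc i) j
    gCol i j i< j≤ rewrite ∸-suc i< = colS (m ∸ suc i) (h ∸ j) (∸-monoʳ-< {m} (s≤s z≤n) i<) (m∸n≤m h j)

    -- The shapes on the left border increase up to `Q 0`, which is zero; the bottom border is
    -- squeezed by `P 0` in the same way.
    gLeft : ∀ j′ j → j + j′ ≡ h → ∀ k → G 0 j k ≡ 0
    gLeft zero j e k rewrite +-identityʳ j | e = trans (ceil 0 z≤n k) (Q0 k)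
    gLeft (suc j′) j e k = n≤0⇒n≡0 (subst (G 0 j k ≤_) (gLeft j′ (suc j) (trans (sym (+-suc j j′)) e) k)
      (proj₁ (gRow 0 j z≤n (subst (j <_) e (m<m+n j (s≤s z≤n))) k)))
    gBot : ∀ i′ i → i + i′ ≡ m → ∀ k → G i 0 k ≡ 0
    gBot zero i e k rewrite +-identityʳ i | e = trans (right 0 z≤n k) (P0 k)
    gBot (suc i′) i e k = n≤0⇒n≡0 (subst (G i 0 k ≤_) (gBot i′ (suc i) (trans (sym (+-suc i i′)) e) k)
      (proj₁ (gCol i 0 (subst (i <_) e (m<m+n i (s≤s z≤n))) z≤n k)))

  isRSK : RSK m h A G
  isRSK .left j j≤ = gLeft (h ∸ j) j (m+[n∸m]≡n j≤)
  isRSK .bot i i≤ = gBot (m ∸ i) i (m+[n∸m]≡n i≤)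
  isRSK .cell i j i< j< with gCol i (suc j) i< j< | gRow (suc i) j i< j<
  ... | xw | yw = subst (λ z → RCell z (G i (suc j)) (G (suc i) j) (A i j) (G (suc i) (suc j))) eq (cellIn-RCell xw yw)
    where
    eq : cellIn (G (suc i) (suc j)) (G i (suc j)) (G (suc i) j) ≡ G i j
    eq rewrite ∸-suc i< | ∸-suc j< = refl

-- Multiplication of a tableau by a column from the left

-- The entries c enter at the last row and move towards row 0 as soon as w (suc k) has reached its maximum z k;
-- car k is the number of boxes that arrive at row k.
record LCell (K : ℕ) (z x y : Shape) (c : ℕ) (w : Shape) : Set where
  field
    car  : ℕ → ℕ
    top  : w 0 ≡ y 0 + car 0
    step : ∀ k → w (suc k) ≡ z k ⊓ (y (suc k) + car (suc k))
    -- Conservation of letters: `car (suc k)` and the `x k ∸ z k` letters in row `k` of the old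
    -- tableau become the `w (suc k) ∸ y (suc k)` letters in row `suc k` of the product and `car k`.
    flow : ∀ k → car k + w (suc k) + z k ≡ car (suc k) + y (suc k) + x k
    end  : ∀ k → K ≤ k → car k ≡ c

open LCell

Bounded : ℕ → Shape → Set
Bounded K x = ∀ k → K ≤ k → x k ≡ 0

module _ {K z x y c w} (C : LCell K z x y c w) where

  lcell-≺ : z ≺ x → z ≺ y → x ≺ w × y ≺ w
  lcell-≺ zx zy =
      (λ k → xw k , ≤-trans (wz k) (proj₁ (zx k)))
    , (λ k → yw k , ≤-trans (wz k) (proj₁ (zy k)))
    where
    wz : ∀ k → w (suc k) ≤ z k
    wz k = subst (_≤ z k) (sym (step C k)) (m⊓n≤m (z k) _)
    yw : ∀ k → y k ≤ w k
    yw zero = subst (y 0 ≤_) (sym (top C)) (m≤m+n (y 0) _)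
    yw (suc k) = subst (y (suc k) ≤_) (sym (step C k)) (⊓-glb (proj₂ (zy k)) (m≤m+n (y (suc k)) _))
    xy : ∀ k → x k ≤ y k + car C k
    xy k = +-cancelˡ-≤ (car C (suc k) + y (suc k)) _ _ (begin
      car C (suc k) + y (suc k) + x k                ≡⟨ flow C k ⟨
      car C k + w (suc k) + z k                      ≤⟨ +-mono-≤ (+-monoʳ-≤ (car C k) (subst (_≤ y (suc k) + car C (suc k)) (sym (step C k)) (m⊓n≤n (z k) _))) (proj₁ (zy k)) ⟩
      car C k + (y (suc k) + car C (suc k)) + y k    ≡⟨ re (car C k) (y (suc k)) (car C (suc k)) (y k) ⟩
      car C (suc k) + y (suc k) + (y k + car C k)    ∎)
      where
      open ≤-Reasoning
      re : ∀ a b c d → a + (b + c) + d ≡ c + b + (d + a)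
      re = solve-∀
    xw : ∀ k → x k ≤ w k
    xw zero = subst (x 0 ≤_) (sym (top C)) (xy 0)
    xw (suc k) = subst (x (suc k) ≤_) (sym (step C k)) (⊓-glb (proj₂ (zx k)) (xy (suc k)))

  private
    w≤ : ∀ k → w k ≤ y k + car C k
    w≤ zero = ≤-reflexive (top C)
    w≤ (suc k) = subst (_≤ _) (sym (step C k)) (m⊓n≤n (z k) _)

    -- Either row `suc k` is filled up to its bound `z k`, or everything carried finds room there
    -- and exactly the old letters of row `k` move on.
    cases : ∀ k → (w (suc k) ≡ z k × x k ≤ car C k + z k) ⊎ (w (suc k) ≤ z k × car C k + z k ≡ x k)
    cases k with ≤-total (z k) (y (suc k) + car C (suc k))
    ... | inj₁ z≤ = inj₁ (w≡ , +-cancelˡ-≤ (z k) _ _ (begin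
            z k + x k                          ≤⟨ +-monoˡ-≤ (x k) z≤ ⟩
            y (suc k) + car C (suc k) + x k    ≡⟨ cong (_+ x k) (+-comm (y (suc k)) _) ⟩
            car C (suc k) + y (suc k) + x k    ≡⟨ flow C k ⟨
            car C k + w (suc k) + z k          ≡⟨ cong (λ u → car C k + u + z k) w≡ ⟩
            car C k + z k + z k                ≡⟨ +-comm _ (z k) ⟩
            z k + (car C k + z k)              ∎))
      where
      open ≤-Reasoning
      w≡ : w (suc k) ≡ z k
      w≡ = trans (step C k) (m≤n⇒m⊓n≡m z≤)
    ... | inj₂ ≤z = inj₂ (subst (_≤ z k) (sym w≡) ≤z , +-cancelˡ-≡ (w (suc k)) _ _ (begin
            w (suc k) + (car C k + z k)        ≡⟨ re (w (suc k)) (car C k) (z k) ⟩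
            car C k + w (suc k) + z k          ≡⟨ flow C k ⟩
            car C (suc k) + y (suc k) + x k    ≡⟨ cong (_+ x k) (trans (+-comm (car C (suc k)) _) (sym w≡)) ⟩
            w (suc k) + x k                    ∎))
      where
      open ≡-Reasoning
      w≡ : w (suc k) ≡ y (suc k) + car C (suc k)
      w≡ = trans (step C k) (m≥n⇒m⊓n≡n ≤z)
      re : ∀ a b c → a + (b + c) ≡ b + a + c
      re = solve-∀

  lcell-≺⁻ : x ≺ w → y ≺ w → z ≺ x × z ≺ y
  lcell-≺⁻ xw yw =
      (λ k → zx k , ≤-trans (proj₁ (xw (suc k))) (wz k))
    , (λ k → zy k , ≤-trans (proj₁ (yw (suc k))) (wz k))
    where
    wz : ∀ k → w (suc k) ≤ z k
    wz k = subst (_≤ z k) (sym (step C k)) (m⊓n≤m (z k) _)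
    zx : ∀ k → z k ≤ x k
    zx k with cases k
    ... | inj₁ (w≡z , _) = subst (_≤ x k) w≡z (proj₂ (xw k))
    ... | inj₂ (_ , e) = subst (z k ≤_) e (m≤n+m (z k) _)
    zy : ∀ k → z k ≤ y k
    zy k with cases k
    ... | inj₁ (w≡z , _) = subst (_≤ y k) w≡z (proj₂ (yw k))
    ... | inj₂ (_ , e) = +-cancelʳ-≤ (car C k) _ _ (begin
            z k + car C k   ≡⟨ +-comm (z k) _ ⟩
            car C k + z k   ≡⟨ e ⟩
            x k             ≤⟨ proj₁ (xw k) ⟩
            w k             ≤⟨ w≤ k ⟩
            y k + car C k   ∎)
      where open ≤-Reasoning

  -- Solves the rule for the old shape. Since `top` reveals `car 0`, this formula and `flow` allow
  -- the rule to be undone from row 0 towards row `K`, against the direction in which it is applied.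
  lcell-z : ∀ k → z k ≡ w (suc k) ⊔ (x k ∸ car C k)
  lcell-z k with cases k
  ... | inj₁ (w≡z , x≤) = trans (sym w≡z) (sym (m≥n⇒m⊔n≡m (subst (x k ∸ car C k ≤_) (sym w≡z) (m≤n+o⇒m∸n≤o (x k) (car C k) x≤))))
  ... | inj₂ (w≤z , e) = trans (sym z≡) (sym (m≤n⇒m⊔n≡n (subst (w (suc k) ≤_) (sym z≡) w≤z)))
    where
    z≡ : x k ∸ car C k ≡ z k
    z≡ = trans (cong (_∸ car C k) (sym e)) (m+n∸m≡n (car C k) (z k))

module _ {K z x y c w z′ x′ y′ c′ w′} (C : LCell K z x y c w) (C′ : LCell K z′ x′ y′ c′ w′)
  (x≗ : x ≗ x′) (y≗ : y ≗ y′) where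

  LCell-unique : z ≗ z′ → c ≡ c′ → w ≗ w′
  LCell-unique z≗ c≡ = w≗
    where
    -- Downward induction on the row: `n` bounds its distance from `K`, where both carries are the
    -- given `c`.
    car≗ : ∀ n k → K ≤ n + k → car C k ≡ car C′ k
    car≗ zero k K≤ = trans (end C k K≤) (trans c≡ (sym (end C′ k K≤)))
    car≗ (suc n) k K≤ = +-cancelʳ-≡ (w (suc k) + z k) _ _ (begin
      car C k + (w (suc k) + z k)            ≡⟨ +-assoc (car C k) _ _ ⟨
      car C k + w (suc k) + z k              ≡⟨ flow C k ⟩
      car C (suc k) + y (suc k) + x k        ≡⟨ cong₂ _+_ (cong₂ _+_ next (y≗ (suc k))) (x≗ k) ⟩
      car C′ (suc k) + y′ (suc k) + x′ k     ≡⟨ flow C′ k ⟨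
      car C′ k + w′ (suc k) + z′ k           ≡⟨ cong₂ (λ u v → car C′ k + u + v) (sym w≡) (sym (z≗ k)) ⟩
      car C′ k + w (suc k) + z k             ≡⟨ +-assoc (car C′ k) _ _ ⟩
      car C′ k + (w (suc k) + z k)           ∎)
      where
      open ≡-Reasoning
      next = car≗ n (suc k) (subst (K ≤_) (sym (+-suc n k)) K≤)
      w≡ : w (suc k) ≡ w′ (suc k)
      w≡ = trans (step C k) (trans (cong₂ _⊓_ (z≗ k) (cong₂ _+_ (y≗ (suc k)) next)) (sym (step C′ k)))
    w≗ : w ≗ w′
    w≗ zero = trans (top C) (trans (cong₂ _+_ (y≗ 0) (car≗ K 0 (m≤m+n K 0))) (sym (top C′)))
    w≗ (suc k) = trans (step C k) (trans (cong₂ _⊓_ (z≗ k) (cong₂ _+_ (y≗ (suc k)) (car≗ K (suc k) (m≤m+n K _)))) (sym (step C′ k)))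

  LCell-unique⁻ : w ≗ w′ → z ≗ z′ × c ≡ c′
  LCell-unique⁻ w≗ = z≗ , trans (sym (end C K ≤-refl)) (trans (car≗ K) (end C′ K ≤-refl))
    where
    open ≡-Reasoning
    z≗′ : ∀ k → car C k ≡ car C′ k → z k ≡ z′ k
    z≗′ k e = trans (lcell-z C k) (trans (cong₂ _⊔_ (w≗ (suc k)) (cong₂ _∸_ (x≗ k) e)) (sym (lcell-z C′ k)))
    car≗ : ∀ k → car C k ≡ car C′ k
    car≗ zero = +-cancelˡ-≡ (y 0) _ _ (begin
      y 0 + car C 0      ≡⟨ top C ⟨
      w 0                ≡⟨ w≗ 0 ⟩
      w′ 0               ≡⟨ top C′ ⟩
      y′ 0 + car C′ 0    ≡⟨ cong (_+ car C′ 0) (y≗ 0) ⟨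
      y 0 + car C′ 0     ∎)
    car≗ (suc k) = +-cancelʳ-≡ (y (suc k) + x k) _ _ (begin
      car C (suc k) + (y (suc k) + x k)      ≡⟨ +-assoc (car C (suc k)) _ _ ⟨
      car C (suc k) + y (suc k) + x k        ≡⟨ flow C k ⟨
      car C k + w (suc k) + z k              ≡⟨ cong₂ _+_ (cong₂ _+_ (car≗ k) (w≗ (suc k))) (z≗′ k (car≗ k)) ⟩
      car C′ k + w′ (suc k) + z′ k           ≡⟨ flow C′ k ⟩
      car C′ (suc k) + y′ (suc k) + x′ k     ≡⟨ cong₂ (λ u v → car C′ (suc k) + u + v) (sym (y≗ (suc k))) (sym (x≗ k)) ⟩
      car C′ (suc k) + y (suc k) + x k       ≡⟨ +-assoc (car C′ (suc k)) _ _ ⟩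
      car C′ (suc k) + (y (suc k) + x k)     ∎)
    z≗ : z ≗ z′
    z≗ k = z≗′ k (car≗ k)

module LOut (K : ℕ) (z x y : Shape) (c : ℕ) where

  -- The first argument is the distance to row `K`, where `c` enters; the subtracted minimum is what
  -- row `suc k` absorbs.
  carry : ℕ → ℕ → ℕ
  carry zero    k = c
  carry (suc n) k = (carry n (suc k) ∸ ((z k ∸ y (suc k)) ⊓ carry n (suc k))) + (x k ∸ z k)

  out : Shape
  out zero    = y 0 + carry K 0
  out (suc k) = z k ⊓ (y (suc k) + carry (K ∸ suc k) (suc k))

  out-LCell : z ≺ x → z ≺ y → Bounded K x → LCell K z x y c out
  out-LCell zx zy b = record
    { car = λ k → carry (K ∸ k) k
    ; top = refl
    ; step = λ k → refl
    ; flow = fl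
    ; end = λ k K≤k → cong (λ n → carry n k) (m≤n⇒m∸n≡0 K≤k) }
    where
    open ≡-Reasoning
    re : ∀ p q y d z → (p + q) + (y + d) + z ≡ (p + d) + y + (q + z)
    re = solve-∀
    fl : ∀ k → carry (K ∸ k) k + out (suc k) + z k ≡ carry (K ∸ suc k) (suc k) + y (suc k) + x k
    fl k with ≤-<-connex K k
    ... | inj₁ K≤k rewrite m≤n⇒m∸n≡0 K≤k | m≤n⇒m∸n≡0 (m≤n⇒m≤1+n K≤k) | b k K≤k | n≤0⇒n≡0 (subst (z k ≤_) (b k K≤k) (proj₁ (zx k)))
            | n≤0⇒n≡0 (≤-trans (proj₂ (zy k)) (subst (z k ≤_) (b k K≤k) (proj₁ (zx k)))) = refl
    ... | inj₂ k<K rewrite ∸-suc k<K = begin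
        ((a ∸ d) + (x k ∸ z k)) + (z k ⊓ (y (suc k) + a)) + z k  ≡⟨ cong (λ u → ((a ∸ d) + (x k ∸ z k)) + u + z k) w≡ ⟩
        ((a ∸ d) + (x k ∸ z k)) + (y (suc k) + d) + z k          ≡⟨ re (a ∸ d) (x k ∸ z k) (y (suc k)) d (z k) ⟩
        ((a ∸ d) + d) + y (suc k) + ((x k ∸ z k) + z k)          ≡⟨ cong₂ (λ u v → u + y (suc k) + v) (m∸n+n≡m (m⊓n≤n (z k ∸ y (suc k)) a)) (m∸n+n≡m (proj₁ (zx k))) ⟩
        a + y (suc k) + x k                                      ∎
      where
      a = carry (K ∸ suc k) (suc k)
      d = (z k ∸ y (suc k)) ⊓ a
      w≡ : z k ⊓ (y (suc k) + a) ≡ y (suc k) + d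
      w≡ = trans (cong (_⊓ (y (suc k) + a)) (sym (m+[n∸m]≡n (proj₂ (zy k))))) (sym (+-distribˡ-⊓ (y (suc k)) _ a))

module LIn (K : ℕ) (w x y : Shape) where

  -- Undoes the rule from row 0 on. Beyond row `K` the shapes vanish and the carry becomes constant
  -- (`stable`), so `carry K` is the entry that had been multiplied in.
  carry : ℕ → ℕ
  carry zero    = w 0 ∸ y 0
  carry (suc k) = (carry k ∸ ((x k ∸ w (suc k)) ⊓ carry k)) + (w (suc k) ∸ y (suc k))

  inn : Shape
  inn k = x k ∸ ((x k ∸ w (suc k)) ⊓ carry k)

  inn-LCell : x ≺ w → y ≺ w → Bounded K w → LCell K inn x y (carry K) w
  inn-LCell xw yw b = record
    { car = carry
    ; top = sym (m+[n∸m]≡n (proj₁ (yw 0)))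
    ; step = st
    ; flow = fl
    ; end = λ k K≤k → trans (cong carry (sym (trans (+-comm (k ∸ K) K) (m+[n∸m]≡n K≤k)))) (stable (k ∸ K)) }
    where
    open ≡-Reasoning
    stable : ∀ n → carry (n + K) ≡ carry K
    stable zero = refl
    stable (suc n) rewrite b (suc n + K) (m≤n+m K (suc n)) | n≤0⇒n≡0 (subst (x (n + K) ≤_) (b (n + K) (m≤n+m K n)) (proj₁ (xw (n + K))))
      | 0∸n≡0 (y (suc n + K)) = trans (+-identityʳ _) (stable n)
    module _ (k : ℕ) where
      e = x k ∸ w (suc k)
      t = e ⊓ carry k
      x≡ : x k ≡ w (suc k) + e
      x≡ = sym (m+[n∸m]≡n (proj₂ (xw k)))
      z≡ : inn k ≡ w (suc k) + (e ∸ t)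
      z≡ = trans (cong (_∸ t) x≡) (+-∸-assoc (w (suc k)) (m⊓n≤m e (carry k)))
      re₁ : ∀ p w∸y y → y + (p + w∸y) ≡ (w∸y + y) + p
      re₁ = solve-∀
      yc : y (suc k) + carry (suc k) ≡ w (suc k) + (carry k ∸ t)
      yc = trans (re₁ (carry k ∸ t) (w (suc k) ∸ y (suc k)) (y (suc k))) (cong (_+ (carry k ∸ t)) (m∸n+n≡m (proj₁ (yw (suc k)))))
    st : ∀ k → w (suc k) ≡ inn k ⊓ (y (suc k) + carry (suc k))
    st k = sym (begin
      inn k ⊓ (y (suc k) + carry (suc k))                        ≡⟨ cong₂ _⊓_ (z≡ k) (yc k) ⟩
      (w (suc k) + (e k ∸ t k)) ⊓ (w (suc k) + (carry k ∸ t k))  ≡⟨ +-distribˡ-⊓ (w (suc k)) _ _ ⟨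
      w (suc k) + ((e k ∸ t k) ⊓ (carry k ∸ t k))                ≡⟨ cong (w (suc k) +_) (∸-distribʳ-⊓ (t k) (e k) (carry k)) ⟨
      w (suc k) + (t k ∸ t k)                                    ≡⟨ cong (w (suc k) +_) (n∸n≡0 (t k)) ⟩
      w (suc k) + 0                                              ≡⟨ +-identityʳ _ ⟩
      w (suc k)                                                  ∎)
    re₂ : ∀ p t w z → (p + t) + w + z ≡ (w + p) + (z + t)
    re₂ = solve-∀
    fl : ∀ k → carry k + w (suc k) + inn k ≡ carry (suc k) + y (suc k) + x k
    fl k = begin
      carry k + w (suc k) + inn k                                ≡⟨ cong (λ u → u + w (suc k) + inn k) (m∸n+n≡m (m⊓n≤n (e k) (carry k))) ⟨
      (carry k ∸ t k + t k) + w (suc k) + inn k                  ≡⟨ re₂ (carry k ∸ t k) (t k) (w (suc k)) (inn k) ⟩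
      (w (suc k) + (carry k ∸ t k)) + (inn k + t k)              ≡⟨ cong₂ _+_ (trans (sym (yc k)) (+-comm (y (suc k)) _)) (m∸n+n≡m (≤-trans (m⊓n≤m (e k) (carry k)) (m∸n≤m (x k) (w (suc k))))) ⟩
      carry (suc k) + y (suc k) + x k                            ∎

record Tableau (h : ℕ) (P : ℕ → Shape) : Set where
  field
    start : ∀ k → P 0 k ≡ 0
    strip : ∀ j → j < h → P j ≺ P (suc j)

open Tableau

-- A horizontal strip adds at most one new row, so letters below `j` occupy at most `j` rows.
tableau-Bounded : ∀ {h P} → Tableau h P → ∀ {j} → j ≤ h → Bounded j (P j)
tableau-Bounded T {zero} j≤ k _ = start T k
tableau-Bounded {P = P} T {suc j} j< (suc k) (s≤s j≤k) =
  n≤0⇒n≡0 (subst (P (suc j) (suc k) ≤_) (tableau-Bounded T (<⇒≤ j<) k j≤k) (proj₂ (strip T j j< k)))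

Bounded-mono : ∀ {K K′ x} → K ≤ K′ → Bounded K x → Bounded K′ x
Bounded-mono K≤ b k K′≤ = b k (≤-trans K≤ K′≤)

-- U is the tableau of the product of the column c with the tableau P.
record LMul (h : ℕ) (c : ℕ → ℕ) (P U : ℕ → Shape) : Set where
  field
    tabP : Tableau h P
    tabU : Tableau h U
    -- Pieri's rule: `c`, read as a weakly increasing word, is a tableau with one row, and
    -- multiplying by it adds a horizontal strip.
    grow : ∀ j → j ≤ h → P j ≺ U j
    lcel : ∀ j → j < h → LCell (suc h) (P j) (P (suc j)) (U j) (c j) (U (suc j))

open LMul

module _ (h : ℕ) (c : ℕ → ℕ) (P : ℕ → Shape) (T : Tableau h P) where
  lmul : ℕ → Shape
  lmul zero    k = 0
  lmul (suc j) = LOut.out (suc h) (P j) (P (suc j)) (lmul j) (c j)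

  private
    lc : ∀ j → j < h → P j ≺ lmul j → LCell (suc h) (P j) (P (suc j)) (lmul j) (c j) (lmul (suc j))
    lc j j< g = LOut.out-LCell _ _ _ _ _ (strip T j j<) g (Bounded-mono (m≤n⇒m≤1+n j<) (tableau-Bounded T j<))
    gr : ∀ j → j ≤ h → P j ≺ lmul j
    gr zero _ = zero-≺ (start T) (λ _ → refl)
    gr (suc j) j< = proj₁ (lcell-≺ (lc j j< (gr j (<⇒≤ j<))) (strip T j j<) (gr j (<⇒≤ j<)))

  lmul-LMul : LMul h c P lmul
  lmul-LMul .tabP = T
  lmul-LMul .tabU .start k = refl
  lmul-LMul .tabU .strip j j< = proj₂ (lcell-≺ (lc j j< (gr j (<⇒≤ j<))) (strip T j j<) (gr j (<⇒≤ j<)))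
  lmul-LMul .grow = gr
  lmul-LMul .lcel j j< = lc j j< (gr j (<⇒≤ j<))

-- Pieri's rule backwards: a tableau, together with a shape `σ` that is smaller by a horizontal
-- strip, determines the row to be split off on the left. The letters are removed from the largest
-- down, so `D` starts with `σ`.
module LDiv (h : ℕ) (U : ℕ → Shape) (T : Tableau h U) (σ : Shape) (σ≺ : σ ≺ U h) where
  private
    D : ℕ → Shape
    D zero    = σ
    D (suc j) = LIn.inn (suc h) (U (h ∸ j)) (D j) (U (h ∸ suc j))

    module _ (j : ℕ) (j< : j < h) where
      ds : U (h ∸ suc j) ≺ U (h ∸ j)
      ds rewrite ∸-suc j< = strip T (h ∸ suc j) (∸-monoʳ-< {h} (s≤s z≤n) j<)
      bd : Bounded (suc h) (U (h ∸ j))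
      bd = Bounded-mono (m≤n⇒m≤1+n (m∸n≤m h j)) (tableau-Bounded T (m∸n≤m h j))
    gr : ∀ j → j ≤ h → D j ≺ U (h ∸ j)
    dc : ∀ j → j < h → LCell (suc h) (D (suc j)) (D j) (U (h ∸ suc j)) (LIn.carry (suc h) (U (h ∸ j)) (D j) (U (h ∸ suc j)) (suc h)) (U (h ∸ j))
    gr zero _ = σ≺
    gr (suc j) j< = proj₂ (lcell-≺⁻ (dc j j<) (gr j (<⇒≤ j<)) (ds j j<))
    dc j j< = LIn.inn-LCell (suc h) _ _ _ (gr j (<⇒≤ j<)) (ds j j<) (bd j j<)
    dz : ∀ j → j < h → D (suc j) ≺ D j
    dz j j< = proj₁ (lcell-≺⁻ (dc j j<) (gr j (<⇒≤ j<)) (ds j j<))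

  P : ℕ → Shape
  P j = D (h ∸ j)

  c : ℕ → ℕ
  c j = LIn.carry (suc h) (U (suc j)) (P (suc j)) (U j) (suc h)

  P-end : P h ≗ σ
  P-end k rewrite n∸n≡0 h = refl

  isLMul : LMul h c P U
  isLMul .tabP .start k = n≤0⇒n≡0 (subst (D h k ≤_) (trans (cong (λ n → U n k) (n∸n≡0 h)) (start T k)) (proj₁ (gr h ≤-refl k)))
  isLMul .tabP .strip j j< = subst (λ n → D n ≺ D (h ∸ suc j)) (sym (∸-suc j<)) (dz (h ∸ suc j) (∸-monoʳ-< {h} (s≤s z≤n) j<))
  isLMul .tabU = T
  isLMul .grow j j≤ = subst (λ n → D (h ∸ j) ≺ U n) (m∸[m∸n]≡n j≤) (gr (h ∸ j) (m∸n≤m h j))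
  isLMul .lcel j j< = dc′ (∸-suc j<) (m∸[m∸n]≡n j<) (trans (cong (h ∸_) (sym (∸-suc j<))) (m∸[m∸n]≡n (<⇒≤ j<)))
    where
    dc′ : ∀ {p u v} → p ≡ suc (h ∸ suc j) → h ∸ (h ∸ suc j) ≡ v → h ∸ suc (h ∸ suc j) ≡ u →
      LCell (suc h) (D p) (D (h ∸ suc j)) (U u) (LIn.carry (suc h) (U v) (D (h ∸ suc j)) (U u) (suc h)) (U v)
    dc′ refl refl refl = dc (h ∸ suc j) (∸-monoʳ-< {h} (s≤s z≤n) j<)

LMul-unique : ∀ {h c c′ P P′ U U′} → LMul h c P U → LMul h c′ P′ U′ →
  (∀ j → j < h → c j ≡ c′ j) → (∀ j → j ≤ h → P j ≗ P′ j) → ∀ j → j ≤ h → U j ≗ U′ j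
LMul-unique L L′ c≗ P≗ zero _ k = trans (start (tabU L) k) (sym (start (tabU L′) k))
LMul-unique L L′ c≗ P≗ (suc j) j< = LCell-unique (lcel L j j<) (lcel L′ j j<) (P≗ (suc j) j<)
  (LMul-unique L L′ c≗ P≗ j (<⇒≤ j<)) (P≗ j (<⇒≤ j<)) (c≗ j j<)

module _ {h c c′ P P′ U U′} (L : LMul h c P U) (L′ : LMul h c′ P′ U′)
  (U≗ : ∀ j → j ≤ h → U j ≗ U′ j) (σ≗ : P h ≗ P′ h) where
  private
    back : ∀ j → j < h → P (suc j) ≗ P′ (suc j) → P j ≗ P′ j × c j ≡ c′ j
    back j j< P≗ = LCell-unique⁻ (lcel L j j<) (lcel L′ j j<) P≗ (U≗ j (<⇒≤ j<)) (U≗ (suc j) j<)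

    P≗′ : ∀ j′ j → j + j′ ≡ h → P j ≗ P′ j
    P≗′ zero j e rewrite +-identityʳ j | e = σ≗
    P≗′ (suc j′) j e = proj₁ (back j (subst (j <_) e (m<m+n j (s≤s z≤n))) (P≗′ j′ (suc j) (trans (sym (+-suc j j′)) e)))

  LMul-unique⁻-P : ∀ j → j ≤ h → P j ≗ P′ j
  LMul-unique⁻-P j j≤ = P≗′ (h ∸ j) j (m+[n∸m]≡n j≤)

  LMul-unique⁻-c : ∀ j → j < h → c j ≡ c′ j
  LMul-unique⁻-c j j< = proj₂ (back j j< (LMul-unique⁻-P (suc j) j<))

-- Each member `v` of the list stands for the weakly increasing word with `v j` copies of every
-- letter `j`. A strictly decreasing subsequence therefore uses at most one of its letters.
Word : Set
Word = List (ℕ → ℕ)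

-- Words and plactic equivalence

-- North-east chains of an array that has been turned upside down.
data Desc : Word → ℕ → ℕ → ℕ → Set where
  done : ∀ {W p q} → Desc W 0 p q
  skip : ∀ {v W k p q} → Desc W k p q → Desc (v ∷ W) k p q
  take : ∀ {v W k p q j} → p ≤ j → j < q → 0 < v j → Desc W k p j → Desc (v ∷ W) (suc k) p q

-- The threshold `t` is the last letter taken from `X`, or `q` if there is none; all letters taken
-- from `Y` are smaller.
desc-split : ∀ X {Y k p q} → p ≤ q → Desc (X ++ Y) k p q →
  ∃[ k₁ ] ∃[ k₂ ] ∃[ t ] (k ≡ k₁ + k₂ × p ≤ t × t ≤ q × Desc X k₁ t q × Desc Y k₂ p t)
desc-split [] {k = k} {q = q} p≤q D = 0 , k , q , refl , p≤q , ≤-refl , done , D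
desc-split (v ∷ X) p≤q done = 0 , 0 , _ , refl , p≤q , ≤-refl , done , done
desc-split (v ∷ X) p≤q (skip D) with desc-split X p≤q D
... | k₁ , k₂ , t , e , p≤t , t≤q , D₁ , D₂ = k₁ , k₂ , t , e , p≤t , t≤q , skip D₁ , D₂
desc-split (v ∷ X) p≤q (take p≤j j<q pos D) with desc-split X p≤j D
... | k₁ , k₂ , t , refl , p≤t , t≤j , D₁ , D₂ =
  suc k₁ , k₂ , t , refl , p≤t , ≤-trans t≤j (<⇒≤ j<q) , take t≤j j<q pos D₁ , D₂

desc-mono : ∀ {W k p p′ q q′} → p′ ≤ p → q ≤ q′ → Desc W k p q → Desc W k p′ q′
desc-mono p′≤ q≤ done = done
desc-mono p′≤ q≤ (skip D) = skip (desc-mono p′≤ q≤ D)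
desc-mono p′≤ q≤ (take p≤j j<q pos D) = take (≤-trans p′≤ p≤j) (≤-trans j<q q≤) pos (desc-mono p′≤ ≤-refl D)

desc-join : ∀ {X Y k₁ k₂ t p q} → p ≤ t → t ≤ q → Desc X k₁ t q → Desc Y k₂ p t → Desc (X ++ Y) (k₁ + k₂) p q
desc-join {[]} p≤t t≤q done D₂ = desc-mono ≤-refl t≤q D₂
desc-join {v ∷ X} p≤t t≤q done D₂ = skip (desc-join {X} p≤t t≤q done D₂)
desc-join p≤t t≤q (skip D₁) D₂ = skip (desc-join p≤t t≤q D₁ D₂)
desc-join p≤t t≤q (take t≤j j<q pos D₁) D₂ = take (≤-trans p≤t t≤j) j<q pos (desc-join p≤t t≤j D₁ D₂)

letters : Word → ℕ → ℕ
letters []      j = 0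
letters (v ∷ W) j = v j + letters W j

letters-++ : ∀ X Y j → letters (X ++ Y) j ≡ letters X j + letters Y j
letters-++ []      Y j = refl
letters-++ (v ∷ X) Y j = trans (cong (v j +_) (letters-++ X Y j)) (sym (+-assoc (v j) _ _))

infix 4 _⊢_⊑_ _⊢_≈_

_⊢_⊑_ : ℕ → Word → Word → Set
h ⊢ W ⊑ W′ = ∀ {k p q} → p ≤ q → q ≤ h → Desc W k p q → Desc W′ k p q

-- Only those consequences of plactic equivalence are kept that matter for fillings. Asking for them
-- in every interval of letters makes the relation a congruence for concatenation.
record _⊢_≈_ (h : ℕ) (W W′ : Word) : Set where
  constructor equiv
  field
    sameLetters  : ∀ j → j < h → letters W j ≡ letters W′ j
    to    : h ⊢ W ⊑ W′
    from  : h ⊢ W′ ⊑ W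

open _⊢_≈_

≈-refl : ∀ {h W} → h ⊢ W ≈ W
≈-refl = equiv (λ _ _ → refl) (λ _ _ D → D) (λ _ _ D → D)

≈-sym : ∀ {h W W′} → h ⊢ W ≈ W′ → h ⊢ W′ ≈ W
≈-sym E = equiv (λ j l → sym (sameLetters E j l)) (from E) (to E)

≈-trans : ∀ {h W W′ W″} → h ⊢ W ≈ W′ → h ⊢ W′ ≈ W″ → h ⊢ W ≈ W″
≈-trans E F = equiv (λ j l → trans (sameLetters E j l) (sameLetters F j l))
  (λ pq ql D → to F pq ql (to E pq ql D)) (λ pq ql D → from E pq ql (from F pq ql D))

-- A decreasing subsequence of a product stays at or above some threshold in the first factor and
-- below it in the second, so each part can be exchanged on its own.
⊑-++ : ∀ {h X X′ Y Y′} → h ⊢ X ⊑ X′ → h ⊢ Y ⊑ Y′ → h ⊢ X ++ Y ⊑ X′ ++ Y′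
⊑-++ {X = X} XX YY pq ql D with desc-split X pq D
... | k₁ , k₂ , t , refl , p≤t , t≤q , D₁ , D₂ =
  desc-join p≤t t≤q (XX t≤q ql D₁) (YY p≤t (≤-trans t≤q ql) D₂)

≈-++ : ∀ {h X X′ Y Y′} → h ⊢ X ≈ X′ → h ⊢ Y ≈ Y′ → h ⊢ X ++ Y ≈ X′ ++ Y′
≈-++ {X = X} {X′} {Y} {Y′} E F = equiv
  (λ j l → trans (letters-++ X Y j) (trans (cong₂ _+_ (sameLetters E j l) (sameLetters F j l)) (sym (letters-++ X′ Y′ j))))
  (⊑-++ (to E) (to F)) (⊑-++ (from E) (from F))

⊑-pointwise : ∀ {h v v′} → (∀ j → j < h → v j ≡ v′ j) → h ⊢ [ v ] ⊑ [ v′ ]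
⊑-pointwise v≗ pq ql done = done
⊑-pointwise v≗ pq ql (skip done) = done
⊑-pointwise v≗ pq ql (take p≤j j<q pos done) = take p≤j j<q (subst (0 <_) (v≗ _ (≤-trans j<q ql)) pos) done

≈-pointwise : ∀ {h v v′} → (∀ j → j < h → v j ≡ v′ j) → h ⊢ [ v ] ≈ [ v′ ]
≈-pointwise v≗ = equiv (λ j l → cong (_+ 0) (v≗ j l)) (⊑-pointwise v≗) (⊑-pointwise (λ j l → sym (v≗ j l)))

≈-zero : ∀ {h v} W → (∀ j → j < h → v j ≡ 0) → h ⊢ v ∷ W ≈ W
≈-zero {h} {v} W v≡0 = equiv (λ j l → cong (_+ letters W j) (v≡0 j l)) fwd (λ _ _ → skip)
  where
  fwd : h ⊢ v ∷ W ⊑ W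
  fwd pq ql done = done
  fwd pq ql (skip D) = D
  fwd pq ql (take p≤j j<q pos D) = ⊥-elim (<⇒≢ pos (sym (v≡0 _ (≤-trans j<q ql))))

-- A discrete-time queue with arrivals b, services a, departures d and queue length e.
-- One bumping step of row insertion replaces the columns a, b by d, a′.
record Queue (h : ℕ) (a b d a′ : ℕ → ℕ) : Set where
  field
    e      : ℕ → ℕ
    empty  : e 0 ≡ 0
    depart : ∀ j → j < h → d j ≡ e j ⊓ a j
    serve  : ∀ j → j < h → d j + a′ j ≡ a j + b j
    update : ∀ j → j < h → e (suc j) + d j ≡ e j + b j

open Queue

pos-+ : ∀ m {n} → 0 < m + n → 0 < m ⊎ 0 < n
pos-+ zero    p = inj₂ p
pos-+ (suc m) p = inj₁ (s≤s z≤n)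

module _ {h a b d a′} (Q : Queue h a b d a′) where
  private
    d≤e : ∀ j → j < h → d j ≤ e Q j
    d≤e j l = subst (_≤ e Q j) (sym (depart Q j l)) (m⊓n≤m (e Q j) (a j))
    d≤a : ∀ j → j < h → d j ≤ a j
    d≤a j l = subst (_≤ a j) (sym (depart Q j l)) (m⊓n≤n (e Q j) (a j))
    b≤a′ : ∀ j → j < h → b j ≤ a′ j
    b≤a′ j l = +-cancelˡ-≤ (a j) _ _ (≤-trans (≤-reflexive (sym (serve Q j l))) (+-monoˡ-≤ (a′ j) (d≤a j l)))
    b≤e : ∀ j → j < h → b j ≤ e Q (suc j)
    b≤e j l = +-cancelʳ-≤ (d j) _ _ (≤-trans (≤-trans (≤-reflexive (+-comm (b j) (d j))) (+-monoˡ-≤ (b j) (d≤e j l)))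
      (≤-reflexive (sym (update Q j l))))

    -- After an arrival the queue stays nonempty until the next service, which is then a departure.
    nextDeparture : ∀ n s → s + n < h → 0 < e Q s → 0 < a (s + n) → ∃[ j ] (s ≤ j × j ≤ s + n × 0 < d j)
    nextDeparture n s l pe pa with a s in eq
    ... | suc _ = s , ≤-refl , m≤m+n s n , subst (0 <_) (sym (depart Q s sl))
                    (⊓-glb pe (subst (0 <_) (sym eq) (s≤s z≤n)))
      where sl = ≤-<-trans (m≤m+n s n) l
    nextDeparture zero s l pe pa | zero rewrite +-identityʳ s | eq with () ← pa
    nextDeparture (suc n) s l pe pa | zero
      with nextDeparture n (suc s) (subst (_< h) (+-suc s n) l) pe′ (subst (λ i → 0 < a i) (+-suc s n) pa)
      where
      sl = ≤-<-trans (m≤m+n s (suc n)) l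
      d≡0 : d s ≡ 0
      d≡0 = n≤0⇒n≡0 (subst (d s ≤_) eq (d≤a s sl))
      pe′ : 0 < e Q (suc s)
      pe′ = ≤-trans pe (≤-trans (m≤m+n (e Q s) (b s)) (≤-reflexive (trans (sym (update Q s sl))
              (trans (cong (e Q (suc s) +_) d≡0) (+-identityʳ _)))))
    ... | j , s<j , j≤ , pd = j , <⇒≤ s<j , subst (j ≤_) (sym (+-suc s n)) j≤ , pd

    -- A departure from a queue that was empty needs an arrival in between.
    previousArrival : ∀ n s → s + n < h → e Q s ≡ 0 → 0 < d (s + n) → ∃[ j ] (s ≤ j × j < s + n × 0 < b j)
    previousArrival zero s l e≡0 pd rewrite +-identityʳ s =
      ⊥-elim (<⇒≱ pd (subst (d s ≤_) e≡0 (d≤e s l)))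
    previousArrival (suc n) s l e≡0 pd with b s in eq
    ... | suc _ = s , ≤-refl , m<m+n s (s≤s z≤n) , subst (0 <_) (sym eq) (s≤s z≤n)
    ... | zero with previousArrival n (suc s) (subst (_< h) (+-suc s n) l) e′ (subst (λ i → 0 < d i) (+-suc s n) pd)
      where
      sl = ≤-<-trans (m≤m+n s (suc n)) l
      e′ : e Q (suc s) ≡ 0
      e′ = m+n≡0⇒m≡0 (e Q (suc s)) (trans (update Q s sl) (cong₂ _+_ e≡0 eq))
    ...   | j , s<j , j< , pb = j , <⇒≤ s<j , subst (j <_) (sym (+-suc s n)) j< , pb

    -- The arrival at `j₂` keeps the queue nonempty until the next service, which comes at `j₁` at
    -- the latest; and every arrival reappears in `a′`.
    pair→ : ∀ {j₁ j₂} → j₁ < h → j₂ < j₁ → 0 < b j₂ → 0 < a j₁ →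
      ∃[ j ] (j₂ < j × j ≤ j₁ × 0 < d j × 0 < a′ j₂)
    pair→ {j₁} {j₂} l j₂<j₁ pb pa with nextDeparture (j₁ ∸ suc j₂) (suc j₂)
      (subst (_< h) (sym (m+[n∸m]≡n j₂<j₁)) l) (≤-trans pb (b≤e j₂ (<-trans j₂<j₁ l)))
      (subst (λ i → 0 < a i) (sym (m+[n∸m]≡n j₂<j₁)) pa)
    ... | j , j₂<j , j≤ , pd = j , j₂<j , subst (j ≤_) (m+[n∸m]≡n j₂<j₁) j≤ , pd , ≤-trans pb (b≤a′ j₂ (<-trans j₂<j₁ l))

    pair← : ∀ {j₁ j₂} → j₁ < h → j₂ < j₁ → 0 < a′ j₂ → 0 < d j₁ →
      ∃[ j ] (j₂ ≤ j × j < j₁ × 0 < b j × 0 < a j₁)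
    pair← {j₁} {j₂} l j₂<j₁ pa′ pd with b j₂ in eq
    ... | suc _ = j₂ , ≤-refl , j₂<j₁ , subst (0 <_) (sym eq) (s≤s z≤n) , ≤-trans pd (d≤a j₁ l)
    ... | zero with previousArrival (j₁ ∸ suc j₂) (suc j₂) (subst (_< h) (sym (m+[n∸m]≡n j₂<j₁)) l) e≡0
                      (subst (λ i → 0 < d i) (sym (m+[n∸m]≡n j₂<j₁)) pd)
      where
      jl = <-trans j₂<j₁ l
      a≡ : a j₂ ≡ d j₂ + a′ j₂
      a≡ = trans (sym (+-identityʳ _)) (trans (cong (a j₂ +_) (sym eq)) (sym (serve Q j₂ jl)))
      d<a : d j₂ < a j₂
      d<a = subst (d j₂ <_) (sym a≡) (m<m+n (d j₂) pa′)
      d≡e : d j₂ ≡ e Q j₂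
      d≡e with ≤-total (e Q j₂) (a j₂)
      ... | inj₁ e≤ = trans (depart Q j₂ jl) (m≤n⇒m⊓n≡m e≤)
      ... | inj₂ a≤ = ⊥-elim (<⇒≢ d<a (trans (depart Q j₂ jl) (m≥n⇒m⊓n≡n a≤)))
      e≡0 : e Q (suc j₂) ≡ 0
      e≡0 = +-cancelʳ-≡ (d j₂) _ _ (trans (update Q j₂ jl) (trans (cong (e Q j₂ +_) eq) (trans (+-identityʳ _) (sym d≡e))))
    ...   | j , j₂<j , j< , pb = j , <⇒≤ j₂<j , subst (j <_) (m+[n∸m]≡n j₂<j₁) j< , pb , ≤-trans pd (d≤a j₁ l)

    one : ∀ {u v p q j} → p ≤ j → j < q → 0 < u j ⊎ 0 < v j → Desc (u ∷ v ∷ []) 1 p q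
    one p≤j j<q (inj₁ pu) = take p≤j j<q pu done
    one p≤j j<q (inj₂ pv) = skip (take p≤j j<q pv done)

    fwd : h ⊢ a ∷ b ∷ [] ⊑ d ∷ a′ ∷ []
    fwd pq ql done = done
    fwd pq ql (skip done) = done
    fwd pq ql (skip (skip done)) = done
    fwd pq ql (skip (take {j = j} p≤j j<q pb done)) =
      one p≤j j<q (inj₂ (≤-trans pb (b≤a′ j (≤-trans j<q ql))))
    fwd pq ql (take p≤j j<q pa (skip done)) = fwd pq ql (take p≤j j<q pa done)
    fwd pq ql (take {j = j} p≤j j<q pa done) = one p≤j j<q (pos-+ (d j)
      (≤-trans pa (≤-trans (m≤m+n (a j) (b j)) (≤-reflexive (sym (serve Q j (≤-trans j<q ql)))))))
    fwd pq ql (take p≤j₁ j₁<q pa (take p≤j₂ j₂<j₁ pb done)) with pair→ (≤-trans j₁<q ql) j₂<j₁ pb pa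
    ... | j , j₂<j , j≤j₁ , pd , pa′ = take (≤-trans p≤j₂ (<⇒≤ j₂<j)) (≤-<-trans j≤j₁ j₁<q) pd (take p≤j₂ j₂<j pa′ done)

    bwd : h ⊢ d ∷ a′ ∷ [] ⊑ a ∷ b ∷ []
    bwd pq ql done = done
    bwd pq ql (skip done) = done
    bwd pq ql (skip (skip done)) = done
    bwd pq ql (skip (take {j = j} p≤j j<q pa′ done)) = one p≤j j<q (pos-+ (a j)
      (≤-trans pa′ (≤-trans (m≤n+m (a′ j) (d j)) (≤-reflexive (serve Q j (≤-trans j<q ql))))))
    bwd pq ql (take p≤j j<q pd (skip done)) = bwd pq ql (take p≤j j<q pd done)
    bwd pq ql (take {j = j} p≤j j<q pd done) = one p≤j j<q (inj₁ (≤-trans pd (d≤a j (≤-trans j<q ql))))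
    bwd pq ql (take p≤j₁ j₁<q pd (take p≤j₂ j₂<j₁ pa′ done)) with pair← (≤-trans j₁<q ql) j₂<j₁ pa′ pd
    ... | j , j₂≤j , j<j₁ , pb , pa = take p≤j₁ j₁<q pa (take (≤-trans p≤j₂ j₂≤j) j<j₁ pb done)

  -- Decreasing subsequences of two rows have length at most two. Length one is a matter of which
  -- letters occur, length two of the two lemmas on pairs.
  queue-≈ : h ⊢ a ∷ b ∷ [] ≈ d ∷ a′ ∷ []
  queue-≈ = equiv (λ j l → trans (cong (a j +_) (+-identityʳ (b j))) (trans (sym (serve Q j l))
    (cong (d j +_) (sym (+-identityʳ (a′ j)))))) fwd bwd

-- Row reading words of tableaux

rows : (ℕ → ℕ → ℕ) → ℕ → Word
rows t zero    = []
rows t (suc K) = t K ∷ rows t K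

-- Row insertion enters the reading word at its right end, in row 0. Each row exchanges itself and
-- the incoming letters `q k` for the bumped letters `q (suc k)` and the new row.
insert-≈ : ∀ {h} (t t′ q : ℕ → ℕ → ℕ) → (∀ k → Queue h (t k) (q k) (q (suc k)) (t′ k)) →
  ∀ K → h ⊢ rows t K ++ [ q 0 ] ≈ q K ∷ rows t′ K
insert-≈ t t′ q Q zero    = ≈-refl
insert-≈ t t′ q Q (suc K) = ≈-trans (≈-++ (≈-refl {W = [ t K ]}) (insert-≈ t t′ q Q K))
  (≈-++ (queue-≈ (Q K)) (≈-refl {W = rows t′ K}))

-- The carried letters `a (suc k)` act as a row into which row `k` of the tableau is inserted: the
-- bumped letters form row `suc k` of the product, and the resulting row is carried on.
multiply-≈ : ∀ {h} (t u a : ℕ → ℕ → ℕ) → (∀ k → Queue h (a (suc k)) (t k) (u (suc k)) (a k)) →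
  ∀ K → h ⊢ a K ∷ rows t K ≈ rows (λ k → u (suc k)) K ++ [ a 0 ]
multiply-≈ t u a Q zero    = ≈-refl
multiply-≈ t u a Q (suc K) = ≈-trans (≈-++ (queue-≈ (Q K)) (≈-refl {W = rows t K}))
  (≈-++ (≈-refl {W = [ u (suc K) ]}) (multiply-≈ t u a Q K))

rows-suc : ∀ u K → rows u (suc K) ≡ rows (λ k → u (suc k)) K ++ [ u 0 ]
rows-suc u zero    = refl
rows-suc u (suc K) = cong (u (suc K) ∷_) (rows-suc u K)

rows-zero : ∀ {h} t K → (∀ k j → j < h → t k j ≡ 0) → h ⊢ [] ≈ rows t K
rows-zero t zero    z = ≈-refl
rows-zero t (suc K) z = ≈-trans (rows-zero t K z) (≈-sym (≈-zero (rows t K) (z K)))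

-- The multiplicity of the letter `j` in row `k` of the tableau.
rowsOf : (ℕ → Shape) → ℕ → ℕ → ℕ
rowsOf P k j = P (suc j) k ∸ P j k

cols : Array → ℕ → Word
cols A zero    = []
cols A (suc m) = cols A m ++ [ A m ]

tableau-row : ∀ {h P} → Tableau h P → ∀ {k} → h ≤ k → ∀ j → j < h → rowsOf P k j ≡ 0
tableau-row {P = P} T {k} h≤k j l =
  n≤0⇒n≡0 (≤-trans (m∸n≤m (P (suc j) k) (P j k)) (≤-reflexive (tableau-Bounded T l k (≤-trans l h≤k))))

RSK-tableau : ∀ {m h A G} → RSK m h A G → ∀ i → i ≤ m → Tableau h (G i)
RSK-tableau R i i≤ .start = bot R i i≤
RSK-tableau R i i≤ .strip j = rowStrip R i j i≤

max+min : ∀ x y → x ⊔ y + x ⊓ y ≡ x + y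
max+min x y with ≤-total x y
... | inj₁ x≤y = trans (cong₂ _+_ (m≤n⇒m⊔n≡n x≤y) (m≤n⇒m⊓n≡m x≤y)) (+-comm y x)
... | inj₂ y≤x = cong₂ _+_ (m≥n⇒m⊔n≡m y≤x) (m≥n⇒m⊓n≡n y≤x)

module _ {m h A G} (R : RSK m h A G) where
  private
    -- The letters that the insertion of column `i` brings to row `k`: the column itself in row 0,
    -- bumped letters in the other rows.
    q : ℕ → ℕ → ℕ → ℕ
    q i zero    j = A i j
    q i (suc k) j = (G i (suc j) k ⊓ G (suc i) j k) ∸ G i j k

    module _ (i : ℕ) (i< : i < m) where
      w≡ : ∀ k j → j < h → G (suc i) (suc j) k ≡ (G i (suc j) k ⊔ G (suc i) j k) + q i k j
      w≡ zero j l = top (cell R i j i< l)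
      w≡ (suc k) j l = +-cancelʳ-≡ (G i j k) _ _ (trans (step (cell R i j i< l) k) (trans
        (cong ((G i (suc j) (suc k) ⊔ G (suc i) j (suc k)) +_) (sym (m∸n+n≡m (⊓-glb (proj₁ (rowStrip R i j (<⇒≤ i<) l k)) (proj₁ (colStrip R i j i< (<⇒≤ l) k))))))
        (sym (+-assoc (G i (suc j) (suc k) ⊔ G (suc i) j (suc k)) _ _))))

      Q : ∀ k → Queue h (rowsOf (G i) k) (q i k) (q i (suc k)) (rowsOf (G (suc i)) k)
      -- The growth of row `k` in the letters below `j` counts the inserted letters that have not
      -- bumped anything so far: they are the queue.
      Q k .e j = G (suc i) j k ∸ G i j k
      Q k .empty = trans (cong (_∸ G i 0 k) (bot R (suc i) i< k)) (0∸n≡0 (G i 0 k))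
      Q k .depart j l = trans (∸-distribʳ-⊓ (G i j k) (G i (suc j) k) (G (suc i) j k)) (⊓-comm (G i (suc j) k ∸ G i j k) _)
      Q k .serve j l = +-cancelʳ-≡ (z + y) _ _ (begin
        (d + (w ∸ y)) + (z + y)              ≡⟨ re d (w ∸ y) z y ⟩
        (d + z) + ((w ∸ y) + y)              ≡⟨ cong₂ _+_ (m∸n+n≡m z≤) (trans (m∸n+n≡m y≤w) (w≡ k j l)) ⟩
        (x ⊓ y) + ((x ⊔ y) + b)              ≡⟨ trans (sym (+-assoc (x ⊓ y) _ _)) (cong (_+ b) (trans (+-comm (x ⊓ y) _) (max+min x y))) ⟩
        (x + y) + b                          ≡⟨ cong (λ u → (u + y) + b) (m∸n+n≡m z≤x) ⟨
        ((x ∸ z) + z + y) + b                ≡⟨ re′ (x ∸ z) z y b ⟩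
        ((x ∸ z) + b) + (z + y)              ∎)
        where
        open ≡-Reasoning
        x = G i (suc j) k
        y = G (suc i) j k
        z = G i j k
        w = G (suc i) (suc j) k
        d = q i (suc k) j
        b = q i k j
        z≤x = proj₁ (rowStrip R i j (<⇒≤ i<) l k)
        z≤ = ⊓-glb z≤x (proj₁ (colStrip R i j i< (<⇒≤ l) k))
        y≤w = proj₁ (rowStrip R (suc i) j i< l k)
        re : ∀ d w z y → (d + w) + (z + y) ≡ (d + z) + (w + y)
        re = solve-∀
        re′ : ∀ x z y b → (x + z + y) + b ≡ (x + b) + (z + y)
        re′ = solve-∀
      Q k .update j l = +-cancelʳ-≡ (x + z) _ _ (begin
        ((w ∸ x) + d) + (x + z)              ≡⟨ re (w ∸ x) d x z ⟩
        (d + z) + ((w ∸ x) + x)              ≡⟨ cong₂ _+_ (m∸n+n≡m z≤) (trans (m∸n+n≡m x≤w) (w≡ k j l)) ⟩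
        (x ⊓ y) + ((x ⊔ y) + b)              ≡⟨ trans (sym (+-assoc (x ⊓ y) _ _)) (cong (_+ b) (trans (+-comm (x ⊓ y) _) (max+min x y))) ⟩
        (x + y) + b                          ≡⟨ cong (λ u → (x + u) + b) (m∸n+n≡m z≤y) ⟨
        (x + ((y ∸ z) + z)) + b              ≡⟨ re′ x (y ∸ z) z b ⟩
        ((y ∸ z) + b) + (x + z)              ∎)
        where
        open ≡-Reasoning
        x = G i (suc j) k
        y = G (suc i) j k
        z = G i j k
        w = G (suc i) (suc j) k
        d = q i (suc k) j
        b = q i k j
        z≤y = proj₁ (colStrip R i j i< (<⇒≤ l) k)
        z≤ = ⊓-glb (proj₁ (rowStrip R i j (<⇒≤ i<) l k)) z≤y
        x≤w = proj₁ (colStrip R i (suc j) i< l k)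
        re : ∀ w d x z → (w + d) + (x + z) ≡ (d + z) + (w + x)
        re = solve-∀
        re′ : ∀ x y z b → (x + (y + z)) + b ≡ (y + b) + (x + z)
        re′ = solve-∀

      -- Row `h` is empty before the insertion, so nothing is bumped out of it.
      overflow : ∀ j → j < h → q i (suc h) j ≡ 0
      overflow j l = n≤0⇒n≡0 (≤-trans (m∸n≤m _ (G i j h)) (≤-trans (m⊓n≤m _ (G (suc i) j h))
        (≤-reflexive (tableau-Bounded (RSK-tableau R i (<⇒≤ i<)) l h l))))

  RSK-≈ : ∀ i → i ≤ m → h ⊢ cols A i ≈ rows (rowsOf (G i)) (suc h)
  RSK-≈ zero _ = rows-zero _ (suc h) (λ k j l → trans (cong (_∸ G 0 j k) (left R (suc j) l k)) (0∸n≡0 (G 0 j k)))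
  RSK-≈ (suc i) i< = ≈-trans (≈-++ (RSK-≈ i (<⇒≤ i<)) (≈-refl {W = [ A i ]}))
    (≈-trans (insert-≈ _ _ (q i) (Q i i<) (suc h)) (≈-zero _ (overflow i i<)))

module _ {h c P U} (L : LMul h c P U) where
  private
    a : ℕ → ℕ → ℕ
    -- Carries exist for letters below `h` only; the equivalence does not see the value 0 at other
    -- letters.
    a k j with j <? h
    ... | yes l = car (lcel L j l) k
    ... | no  _ = 0

    a≡ : ∀ k j (l : j < h) → a k j ≡ car (lcel L j l) k
    a≡ k j l with j <? h
    ... | yes l′ = cong (λ l → car (lcel L j l) k) (≤-irrelevant l′ l)
    ... | no ¬l = ⊥-elim (¬l l)

    u = rowsOf U
    t = rowsOf P

    Q : ∀ k → Queue h (a (suc k)) (t k) (u (suc k)) (a k)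
    -- The letters below `j` in row `k` of `P` that are not yet balanced by row `suc k` of the
    -- product; by `grow` nothing is truncated here.
    Q k .e j = P j k ∸ U j (suc k)
    Q k .empty = trans (cong (_∸ U 0 (suc k)) (start (tabP L) k)) (0∸n≡0 (U 0 (suc k)))
    Q k .depart j l rewrite a≡ (suc k) j l = trans (cong (_∸ U j (suc k)) (step (lcel L j l) k))
      (trans (∸-distribʳ-⊓ (U j (suc k)) (P j k) _) (cong ((P j k ∸ U j (suc k)) ⊓_) (m+n∸m≡n (U j (suc k)) _)))
    Q k .serve j l rewrite a≡ (suc k) j l | a≡ k j l = +-cancelʳ-≡ (y + z) _ _ (begin
      ((w ∸ y) + κ) + (y + z)     ≡⟨ re (w ∸ y) κ y z ⟩
      κ + ((w ∸ y) + y) + z       ≡⟨ cong (λ v → κ + v + z) (m∸n+n≡m (proj₁ (strip (tabU L) j l (suc k)))) ⟩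
      κ + w + z                   ≡⟨ flow (lcel L j l) k ⟩
      κ′ + y + x                  ≡⟨ cong (κ′ + y +_) (m∸n+n≡m (proj₁ (strip (tabP L) j l k))) ⟨
      κ′ + y + ((x ∸ z) + z)      ≡⟨ re′ κ′ y (x ∸ z) z ⟩
      (κ′ + (x ∸ z)) + (y + z)    ∎)
      where
      open ≡-Reasoning
      x = P (suc j) k
      z = P j k
      y = U j (suc k)
      w = U (suc j) (suc k)
      κ = car (lcel L j l) k
      κ′ = car (lcel L j l) (suc k)
      re : ∀ w κ y z → (w + κ) + (y + z) ≡ κ + (w + y) + z
      re = solve-∀
      re′ : ∀ κ y x z → κ + y + (x + z) ≡ (κ + x) + (y + z)
      re′ = solve-∀
    Q k .update j l = +-cancelʳ-≡ (y + z) _ _ (begin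
      ((x ∸ w) + (w ∸ y)) + (y + z)     ≡⟨ re (x ∸ w) (w ∸ y) y z ⟩
      ((x ∸ w) + ((w ∸ y) + y)) + z     ≡⟨ cong (λ v → ((x ∸ w) + v) + z) (m∸n+n≡m (proj₁ (strip (tabU L) j l (suc k)))) ⟩
      ((x ∸ w) + w) + z                 ≡⟨ cong (_+ z) (m∸n+n≡m (proj₂ (grow L (suc j) l k))) ⟩
      x + z                             ≡⟨ cong₂ _+_ (m∸n+n≡m (proj₁ (strip (tabP L) j l k))) (m∸n+n≡m (proj₂ (grow L j (<⇒≤ l) k))) ⟨
      ((x ∸ z) + z) + ((z ∸ y) + y)     ≡⟨ re′ (x ∸ z) z (z ∸ y) y ⟩
      ((z ∸ y) + (x ∸ z)) + (y + z)     ∎)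
      where
      open ≡-Reasoning
      x = P (suc j) k
      z = P j k
      y = U j (suc k)
      w = U (suc j) (suc k)
      re : ∀ p q y z → (p + q) + (y + z) ≡ (p + (q + y)) + z
      re = solve-∀
      re′ : ∀ x z p y → (x + z) + (p + y) ≡ (p + x) + (y + z)
      re′ = solve-∀

    a-end : ∀ j → j < h → c j ≡ a (suc h) j
    a-end j l = sym (trans (a≡ (suc h) j l) (end (lcel L j l) (suc h) ≤-refl))
    a-0 : ∀ j → j < h → a 0 j ≡ u 0 j
    a-0 j l = trans (a≡ 0 j l) (sym (trans (cong (_∸ U j 0) (top (lcel L j l))) (m+n∸m≡n (U j 0) _)))

  LMul-≈ : h ⊢ c ∷ rows t (suc h) ≈ rows u (suc h)
  LMul-≈ = ≈-trans (≈-++ (≈-pointwise a-end) (≈-refl {W = rows t (suc h)}))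
    (≈-trans (multiply-≈ t u a Q (suc h))
    (≈-trans (≈-++ (≈-refl {W = rows (λ k → u (suc k)) (suc h)}) (≈-pointwise a-0))
    (subst (λ W → h ⊢ W ≈ rows u (suc h)) (rows-suc u (suc h)) (≈-zero _ (tableau-row (tabU L) (n≤1+n h))))))

-- Moving a column across a rectangle

-- The column A 0 is multiplied into the tableau of the other columns from the left in A, from the right in A′.
record Rotation (m h : ℕ) (A A′ : Array) : Set where
  field
    G G′ : Growth
    P U  : ℕ → Shape
    rsk  : RSK m h (λ i → A (suc i)) G
    rsk′ : RSK (suc m) h A′ G′
    mul  : LMul h (A 0) P U
    P≗   : ∀ j → j ≤ h → P j ≗ G m j
    U≗   : ∀ j → j ≤ h → U j ≗ G′ (suc m) j
    Q≗   : ∀ i → i ≤ m → G i h ≗ G′ i h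

open Rotation

module _ (m h : ℕ) (A : Array) where
  private
    R = growth-RSK (λ i → A (suc i)) m h
    Gr = growth (λ i → A (suc i))
    U′ = lmul h (A 0) (Gr m) (RSK-tableau R m ≤-refl)
    L = lmul-LMul h (A 0) (Gr m) (RSK-tableau R m ≤-refl)

    -- The recording tableau of the other columns, completed by one more step that leads to the
    -- shape of the product; `grow` makes this step a horizontal strip.
    Q : ℕ → Shape
    Q i with i ≤? m
    ... | yes _ = Gr i h
    ... | no  _ = U′ h
    Q-in : ∀ i → i ≤ m → Gr i h ≡ Q i
    Q-in i i≤ with i ≤? m
    ... | yes _ = refl
    ... | no i≰ = ⊥-elim (i≰ i≤)
    Q-last : U′ h ≡ Q (suc m)
    Q-last with suc m ≤? m
    ... | yes l = ⊥-elim (<-irrefl refl l)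
    ... | no  _ = refl
    Q≺ : ∀ i → i < suc m → Q i ≺ Q (suc i)
    Q≺ i (s≤s i≤) with m≤n⇒m<n∨m≡n i≤
    ... | inj₁ i< = subst₂ _≺_ (Q-in i i≤) (Q-in (suc i) i<) (colStrip R i h i< ≤-refl)
    ... | inj₂ refl = subst₂ _≺_ (Q-in i i≤) Q-last (grow L h ≤-refl)

    module S = Shrink (suc m) h U′ Q (strip (tabU L)) Q≺ (start (tabU L))
      (λ k → trans (cong (λ s → s k) (sym (Q-in 0 z≤n))) (left R h ≤-refl k)) (λ k → cong (λ s → s k) Q-last)

  rotate : Array
  rotate = S.A

  rotate-Rotation : Rotation m h A rotate
  rotate-Rotation = record
    { G = Gr ; G′ = S.G ; P = Gr m ; U = U′ ; rsk = R ; rsk′ = S.isRSK ; mul = L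
    ; P≗ = λ _ _ _ → refl
    ; U≗ = λ j j≤ k → sym (S.right j j≤ k)
    ; Q≗ = λ i i≤ k → trans (cong (λ s → s k) (Q-in i i≤)) (sym (S.ceil i (m≤n⇒m≤1+n i≤) k)) }

module _ (m h : ℕ) (A′ : Array) where
  private
    R = growth-RSK A′ (suc m) h
    Gr = growth A′
    -- The shape of the first `m` columns is prescribed for the quotient, so that the quotient and
    -- their recording tableau form a pair to which inverse RSK applies.
    module D = LDiv h (Gr (suc m)) (RSK-tableau R (suc m) ≤-refl) (Gr m h) (colStrip R m h ≤-refl ≤-refl)
    module S = Shrink m h D.P (λ i → Gr i h) (strip (tabP D.isLMul)) (λ i i< → colStrip R i h (m≤n⇒m≤1+n i<) ≤-refl)
      (start (tabP D.isLMul)) (left R h ≤-refl) D.P-end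

  unrotate : Array
  unrotate zero    = D.c
  unrotate (suc i) = S.A i

  unrotate-Rotation : Rotation m h unrotate A′
  unrotate-Rotation = record
    { G = S.G ; G′ = Gr ; P = D.P ; U = Gr (suc m) ; rsk = S.isRSK ; rsk′ = R ; mul = D.isLMul
    ; P≗ = λ j j≤ k → sym (S.right j j≤ k)
    ; U≗ = λ _ _ _ → refl
    ; Q≗ = S.ceil }

module _ {m h A A′ B B′} (R : Rotation m h A A′) (S : Rotation m h B B′) where

  -- Together with its converse below, this makes `rotate` and `unrotate` inverse to each other
  -- inside the block.
  Rotation-unique : (∀ i j → i < suc m → j < h → A i j ≡ B i j) → ∀ i j → i < suc m → j < h → A′ i j ≡ B′ i j
  Rotation-unique A≗ = RSK-unique⁻ (rsk′ R) (rsk′ S) U≗′ top≗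
    where
    G≗ = RSK-unique (rsk R) (rsk S) (λ i j i< → A≗ (suc i) j (s≤s i<))
    P≗′ : ∀ j → j ≤ h → P R j ≗ P S j
    P≗′ j j≤ k = trans (P≗ R j j≤ k) (trans (G≗ m j ≤-refl j≤ k) (sym (P≗ S j j≤ k)))
    U≗′ : ∀ j → j ≤ h → G′ R (suc m) j ≗ G′ S (suc m) j
    U≗′ j j≤ k = trans (sym (U≗ R j j≤ k)) (trans (LMul-unique (mul R) (mul S) (λ j → A≗ 0 j (s≤s z≤n)) P≗′ j j≤ k) (U≗ S j j≤ k))
    top≗ : ∀ i → i ≤ suc m → G′ R i h ≗ G′ S i h
    top≗ i i≤ k with m≤n⇒m<n∨m≡n i≤
    ... | inj₁ (s≤s i≤m) = trans (sym (Q≗ R i i≤m k)) (trans (G≗ i h i≤m ≤-refl k) (Q≗ S i i≤m k))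
    ... | inj₂ refl = U≗′ h ≤-refl k

  Rotation-unique⁻ : (∀ i j → i < suc m → j < h → A′ i j ≡ B′ i j) → ∀ i j → i < suc m → j < h → A i j ≡ B i j
  Rotation-unique⁻ A≗ = go
    where
    G≗ = RSK-unique (rsk′ R) (rsk′ S) A≗
    U≗′ : ∀ j → j ≤ h → U R j ≗ U S j
    U≗′ j j≤ k = trans (U≗ R j j≤ k) (trans (G≗ (suc m) j ≤-refl j≤ k) (sym (U≗ S j j≤ k)))
    Q≗′ : ∀ i → i ≤ m → G R i h ≗ G S i h
    Q≗′ i i≤ k = trans (Q≗ R i i≤ k) (trans (G≗ i h (m≤n⇒m≤1+n i≤) ≤-refl k) (sym (Q≗ S i i≤ k)))
    σ≗ : P R h ≗ P S h
    σ≗ k = trans (P≗ R h ≤-refl k) (trans (Q≗′ m ≤-refl k) (sym (P≗ S h ≤-refl k)))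
    P≗′ : ∀ j → j ≤ h → G R m j ≗ G S m j
    P≗′ j j≤ k = trans (sym (P≗ R j j≤ k)) (trans (LMul-unique⁻-P (mul R) (mul S) U≗′ σ≗ j j≤ k) (P≗ S j j≤ k))
    go : ∀ i j → i < suc m → j < h → A i j ≡ B i j
    go zero j _ = LMul-unique⁻-c (mul R) (mul S) U≗′ σ≗ j
    go (suc i) j (s≤s i<) = RSK-unique⁻ (rsk R) (rsk S) P≗′ Q≗′ i j i<

cols-suc : ∀ A m → cols A (suc m) ≡ A 0 ∷ cols (λ i → A (suc i)) m
cols-suc A zero    = refl
cols-suc A (suc m) = cong (_++ [ A (suc m) ]) (cols-suc A m)

rows-pointwise : ∀ {h} t t′ K → (∀ k j → j < h → t k j ≡ t′ k j) → h ⊢ rows t K ≈ rows t′ K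
rows-pointwise t t′ zero    t≗ = ≈-refl
rows-pointwise t t′ (suc K) t≗ = ≈-++ (≈-pointwise (t≗ K)) (rows-pointwise t t′ K t≗)

module _ {m h A A′} (R : Rotation m h A A′) where

  -- Both words are equivalent to the reading word of the same tableau `U`.
  rotation-≈ : h ⊢ cols A (suc m) ≈ cols A′ (suc m)
  rotation-≈ = subst (λ W → h ⊢ W ≈ cols A′ (suc m)) (sym (cols-suc A m))
    (≈-trans (≈-++ (≈-refl {W = [ A 0 ]}) (≈-trans (RSK-≈ (rsk R) m ≤-refl) (rows-pointwise _ _ (suc h)
      (λ k j l → sym (cong₂ _∸_ (P≗ R (suc j) l k) (P≗ R j (<⇒≤ l) k))))))
    (≈-trans (LMul-≈ (mul R))
    (≈-trans (rows-pointwise _ _ (suc h) (λ k j l → cong₂ _∸_ (U≗ R (suc j) l k) (U≗ R j (<⇒≤ l) k)))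
    (≈-sym (RSK-≈ (rsk′ R) (suc m) ≤-refl)))))

  -- Both sides have the same recording tableau, which is the insertion tableau of the transposed array.
  rotation-≈ᵗ : m ⊢ cols (λ j i → A (suc i) j) h ≈ cols (λ j i → A′ i j) h
  rotation-≈ᵗ = ≈-trans (RSK-≈ (RSK-transpose (rsk R)) h ≤-refl)
    (≈-trans (rows-pointwise _ _ (suc m) (λ k i l → cong₂ _∸_ (Q≗ R (suc i) l k) (Q≗ R i (<⇒≤ l) k)))
    (≈-sym (RSK-≈ (RSK-transpose (RSK-restrict (n≤1+n m) (rsk′ R))) h ≤-refl)))

-- Chains in arrays and decreasing subsequences of words

Region : Set₁
Region = ℕ → ℕ → Set

data Chain (X : Region) : (k i₀ i₁ j₀ j₁ : ℕ) → Set where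
  []   : ∀ {i₀ i₁ j₀ j₁} → Chain X 0 i₀ i₁ j₀ j₁
  cons : ∀ {k i₀ i₁ j₀ j₁} i j → i₀ ≤ i → i < i₁ → j₀ ≤ j → j < j₁ → X i j →
         Chain X k (suc i) i₁ (suc j) j₁ → Chain X (suc k) i₀ i₁ j₀ j₁

module _ {X : Region} where

  chain-mono : ∀ {k i₀ i₁ j₀ j₁ i₀′ i₁′ j₀′ j₁′} → i₀′ ≤ i₀ → i₁ ≤ i₁′ → j₀′ ≤ j₀ → j₁ ≤ j₁′ →
    Chain X k i₀ i₁ j₀ j₁ → Chain X k i₀′ i₁′ j₀′ j₁′
  chain-mono a b c d [] = []
  chain-mono a b c d (cons i j p q r s x C) =
    cons i j (≤-trans a p) (≤-trans q b) (≤-trans c r) (≤-trans s d) x (chain-mono ≤-refl b ≤-refl d C)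

  chain-transpose : ∀ {k i₀ i₁ j₀ j₁} → Chain X k i₀ i₁ j₀ j₁ → Chain (λ j i → X i j) k j₀ j₁ i₀ i₁
  chain-transpose [] = []
  chain-transpose (cons i j p q r s x C) = cons j i r s p q x (chain-transpose C)

  chain-join : ∀ {k₁ k₂ i₀ s i₁ j₀ t j₁} → i₀ ≤ s → s ≤ i₁ → j₀ ≤ t → t ≤ j₁ →
    Chain X k₁ i₀ s j₀ t → Chain X k₂ s i₁ t j₁ → Chain X (k₁ + k₂) i₀ i₁ j₀ j₁
  chain-join a b c d [] D = chain-mono a ≤-refl c ≤-refl D
  chain-join a b c d (cons i j p q r s x C) D =
    cons i j p (≤-trans q b) r (≤-trans s d) x (chain-join q b s d C D)

  chain-split : ∀ {k i₀ i₁ j₀ j₁} s → i₀ ≤ s → s ≤ i₁ → j₀ ≤ j₁ → Chain X k i₀ i₁ j₀ j₁ →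
    ∃[ k₁ ] ∃[ k₂ ] ∃[ t ] (k ≡ k₁ + k₂ × j₀ ≤ t × t ≤ j₁ × Chain X k₁ i₀ s j₀ t × Chain X k₂ s i₁ t j₁)
  chain-split s a b c [] = 0 , 0 , _ , refl , ≤-refl , c , [] , []
  chain-split s a b c (cons i j p q r u x C) with ≤-<-connex s i
  ... | inj₁ s≤i = 0 , _ , _ , refl , ≤-refl , c , [] , cons i j s≤i q r u x C
  ... | inj₂ i<s with chain-split s i<s b u C
  ...   | k₁ , k₂ , t , refl , j<t , t≤ , C₁ , C₂ =
    suc k₁ , k₂ , t , refl , ≤-trans r (<⇒≤ j<t) , t≤ , cons i j p i<s r j<t x C₁ , C₂

chain-splitᵗ : ∀ {X k i₀ i₁ j₀ j₁} t → j₀ ≤ t → t ≤ j₁ → i₀ ≤ i₁ → Chain X k i₀ i₁ j₀ j₁ →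
  ∃[ k₁ ] ∃[ k₂ ] ∃[ s ] (k ≡ k₁ + k₂ × i₀ ≤ s × s ≤ i₁ × Chain X k₁ i₀ s j₀ t × Chain X k₂ s i₁ t j₁)
chain-splitᵗ t a b c C with chain-split t a b c (chain-transpose C)
... | k₁ , k₂ , s , e , i₀≤s , s≤ , C₁ , C₂ = k₁ , k₂ , s , e , i₀≤s , s≤ , chain-transpose C₁ , chain-transpose C₂

chain-map : ∀ {X Y : Region} {k i₀ i₁ j₀ j₁} → (∀ i j → i₀ ≤ i → i < i₁ → j₀ ≤ j → j < j₁ → X i j → Y i j) →
  Chain X k i₀ i₁ j₀ j₁ → Chain Y k i₀ i₁ j₀ j₁
chain-map f [] = []
chain-map f (cons i j p q r s x C) = cons i j p q r s (f i j p q r s x)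
  (chain-map (λ i′ j′ p′ q′ r′ s′ → f i′ j′ (≤-trans p (<⇒≤ p′)) q′ (≤-trans r (<⇒≤ r′)) s′) C)

chain-reindex : ∀ {X Y : Region} {k s u j₀ j₁} δ ε →
  (∀ i j → s ≤ i → i < u → j₀ ≤ j → j < j₁ → X (δ + i) j → Y (ε + i) j) →
  Chain X k (δ + s) (δ + u) j₀ j₁ → Chain Y k (ε + s) (ε + u) j₀ j₁
chain-reindex δ ε f [] = []
chain-reindex {X} {Y} {suc k} {s} {u} {j₀} {j₁} δ ε f (cons i j p q r t x C) =
  go (i ∸ δ) (m+[n∸m]≡n (≤-trans (m≤m+n δ s) p))
  where
  go : ∀ i° → δ + i° ≡ i → Chain Y (suc k) (ε + s) (ε + u) j₀ j₁
  go i° refl = cons (ε + i°) j (+-monoʳ-≤ ε s≤) (+-monoʳ-< ε <u) r t (f i° j s≤ <u r t x)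
    (subst (λ v → Chain Y k v (ε + u) (suc j) j₁) (+-suc ε i°)
      (chain-reindex δ ε (λ i′ j′ p′ q′ r′ t′ → f i′ j′ (≤-trans s≤ (<⇒≤ p′)) q′ (≤-trans r (<⇒≤ r′)) t′)
        (subst (λ v → Chain X k v (δ + u) (suc j) j₁) (sym (+-suc δ i°)) C)))
    where
    s≤ : s ≤ i°
    s≤ = +-cancelˡ-≤ δ _ _ p
    <u : i° < u
    <u = +-cancelˡ-< δ _ _ q

Positive : Array → Region
Positive F i j = 0 < F i j

-- Reflecting the rows turns ne-chains into strictly decreasing subsequences of the column word; the
-- rows in `[a , b)` become the letters below `b ∸ a`.
upsideDown : ℕ → Array → Array
upsideDown b F i j = F i (b ∸ suc j)

private
  upsideDown-pos : ∀ {b j q} → q ≤ b → b ∸ q ≤ j → j < b → b ∸ suc j < q × b ∸ suc (b ∸ suc j) ≡ j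
  upsideDown-pos {b} {j} {q} q≤b l j<b =
      +-cancelʳ-≤ j _ _ (≤-trans (≤-reflexive (trans (sym (+-suc (b ∸ suc j) j)) (m∸n+n≡m j<b)))
        (≤-trans (≤-reflexive (sym (m+[n∸m]≡n q≤b))) (+-monoʳ-≤ q l)))
    , trans (cong (b ∸_) (sym (∸-suc j<b))) (m∸[m∸n]≡n (<⇒≤ j<b))

module _ (F : Array) (b : ℕ) where
  private
    A = upsideDown b F

  cols→chain : ∀ n {k p q} → p ≤ q → q ≤ b → Desc (cols A n) k p q → Chain (Positive F) k 0 n (b ∸ q) (b ∸ p)
  cols→chain zero p≤q q≤b done = []
  cols→chain (suc n) {p = p} {q} p≤q q≤b D with desc-split (cols A n) p≤q D
  ... | k₁ , k₂ , t , refl , p≤t , t≤q , D₁ , D₂ = chain-join z≤n (n≤1+n n) (∸-monoʳ-≤ b t≤q) (∸-monoʳ-≤ b p≤t)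
      (cols→chain n t≤q q≤b D₁) (single D₂)
    where
    single : ∀ {k} → Desc [ A n ] k p t → Chain (Positive F) k n (suc n) (b ∸ t) (b ∸ p)
    single done = []
    single (skip done) = []
    single (take {j = j} p≤j j<t pos done) = cons n (b ∸ suc j) ≤-refl ≤-refl (∸-monoʳ-≤ b j<t)
      (∸-monoʳ-< {b} (s≤s p≤j) (≤-trans j<t (≤-trans t≤q q≤b))) pos []

  chain→cols : ∀ n {k p q} → p ≤ q → q ≤ b → Chain (Positive F) k 0 n (b ∸ q) (b ∸ p) → Desc (cols A n) k p q
  chain→cols zero p≤q q≤b [] = done
  chain→cols (suc n) {p = p} {q} p≤q q≤b C with chain-split n z≤n (n≤1+n n) (∸-monoʳ-≤ b p≤q) C
  ... | k₁ , k₂ , t , refl , l , u , C₁ , C₂ = desc-join p≤t t≤q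
      (chain→cols n t≤q q≤b (subst (Chain (Positive F) k₁ 0 n (b ∸ q)) (sym t≡) C₁))
      (single (subst (λ v → Chain (Positive F) k₂ n (suc n) v (b ∸ p)) (sym t≡) C₂))
    where
    t≤b = ≤-trans u (m∸n≤m b p)
    t≡ : b ∸ (b ∸ t) ≡ t
    t≡ = m∸[m∸n]≡n t≤b
    p≤t : p ≤ b ∸ t
    p≤t = subst (_≤ b ∸ t) (m∸[m∸n]≡n (≤-trans p≤q q≤b)) (∸-monoʳ-≤ b u)
    t≤q : b ∸ t ≤ q
    t≤q = subst (b ∸ t ≤_) (m∸[m∸n]≡n q≤b) (∸-monoʳ-≤ b l)
    single : ∀ {k} → Chain (Positive F) k n (suc n) (b ∸ (b ∸ t)) (b ∸ p) → Desc [ A n ] k p (b ∸ t)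
    single [] = done
    single (cons i j n≤i (s≤s i≤n) t≤j j<p pos C) with ≤-antisym i≤n n≤i
    single (cons i j n≤i (s≤s i≤n) t≤j j<p pos (cons i′ _ n<i′ i′≤n _ _ _ _)) | refl = ⊥-elim (<⇒≱ n<i′ (≤-pred i′≤n))
    single (cons i j n≤i (s≤s i≤n) t≤j j<p pos []) | refl
      with upsideDown-pos (m∸n≤m b t) t≤j (≤-trans j<p (m∸n≤m b p))
    ... | j′< , j≡ = take p≤j′ j′< (subst (λ v → 0 < F n v) (sym j≡) pos) done
      where
      p≤j′ : p ≤ b ∸ suc j
      p≤j′ = subst (_≤ b ∸ suc j) (m∸[m∸n]≡n (≤-trans p≤q q≤b)) (∸-monoʳ-≤ b j<p)

  -- Here the letters are column indices and the rows are listed from the top, so the word meets a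
  -- chain in reverse order; this is why the two lengths are exchanged.
  rows→chain : ∀ h {k s u} → h ≤ b → s ≤ u → Desc (cols (λ j i → A i j) h) k s u → Chain (Positive F) k s u (b ∸ h) b
  rows→chain zero h≤b s≤u done = []
  rows→chain (suc h) {s = s} {u} h<b s≤u D with desc-split (cols (λ j i → A i j) h) s≤u D
  ... | k₁ , k₂ , t , refl , s≤t , t≤u , D₁ , D₂ = subst (λ k → Chain (Positive F) k s u (b ∸ suc h) b) (+-comm k₂ k₁)
      (chain-join s≤t t≤u (∸-monoʳ-≤ b (n≤1+n h)) (m∸n≤m b h) (single D₂) (rows→chain h (<⇒≤ h<b) t≤u D₁))
    where
    single : ∀ {k} → Desc [ (λ i → A i h) ] k s t → Chain (Positive F) k s t (b ∸ suc h) (b ∸ h)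
    single done = []
    single (skip done) = []
    single (take {j = i} s≤i i<t pos done) = cons i (b ∸ suc h) s≤i i<t ≤-refl (∸-monoʳ-< {b} ≤-refl h<b) pos []

  chain→rows : ∀ h {k s u} → h ≤ b → s ≤ u → Chain (Positive F) k s u (b ∸ h) b → Desc (cols (λ j i → A i j) h) k s u
  chain→rows zero h≤b s≤u [] = done
  chain→rows zero h≤b s≤u (cons _ _ _ _ b≤j j<b _ _) = ⊥-elim (<⇒≱ j<b b≤j)
  chain→rows (suc h) {s = s} {u} h<b s≤u C with chain-splitᵗ (b ∸ h) (∸-monoʳ-≤ b (n≤1+n h)) (m∸n≤m b h) s≤u C
  ... | k₁ , k₂ , t , refl , s≤t , t≤u , C₁ , C₂ = subst (λ k → Desc (cols (λ j i → A i j) (suc h)) k s u) (+-comm k₂ k₁)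
      (desc-join s≤t t≤u (chain→rows h (<⇒≤ h<b) t≤u C₂) (single C₁))
    where
    single : ∀ {k} → Chain (Positive F) k s t (b ∸ suc h) (b ∸ h) → Desc [ (λ i → A i h) ] k s t
    single [] = done
    single (cons i j s≤i i<t l j< pos C) with ≤-antisym (≤-pred (subst (j <_) (∸-suc h<b) j<)) l
    single (cons i j s≤i i<t l j< pos []) | refl = take s≤i i<t pos done
    single (cons i j s≤i i<t l j< pos (cons _ j′ _ _ j<j′ j′< _ _)) | refl =
      ⊥-elim (<⇒≱ j<j′ (≤-pred (subst (j′ <_) (∸-suc h<b) j′<)))

-- Chains in polyominoes

Cells : Set
Cells = ℕ → ℕ → Bool

Rect : Cells → ℕ → ℕ → ℕ → ℕ → Set
Rect M i₀ i₁ j₀ j₁ = ∀ i j → i₀ ≤ i → i < i₁ → j₀ ≤ j → j < j₁ → M i j ≡ true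

record HasChain (M : Cells) (X : Region) (k : ℕ) : Set where
  constructor chainIn
  field
    {i₀ i₁ j₀ j₁} : ℕ
    i≤    : i₀ ≤ i₁
    j≤    : j₀ ≤ j₁
    rect  : Rect M i₀ i₁ j₀ j₁
    chain : Chain X k i₀ i₁ j₀ j₁

-- A block of n columns containing the rows [a , b) everywhere, m of which (starting at column δ, respectively ε)
-- may contain further rows, is followed by ever smaller columns inside [a , b).
record Transfer (n m a b δ ε : ℕ) (M M′ : Cells) (X X′ : Region) : Set where
  field
    a≤b    : a ≤ b
    block≤ : δ + m ≤ n
    full   : ∀ i j → i < n → a ≤ j → j < b → M i j ≡ true
    full′  : ∀ i j → i < n → a ≤ j → j < b → M′ i j ≡ true
    same   : ∀ i j → i < m → M (δ + i) j ≡ M′ (ε + i) j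
    convex : ∀ i j₁ j j₂ → i < m → M (δ + i) j₁ ≡ true → M (δ + i) j₂ ≡ true → j₁ ≤ j → j ≤ j₂ → M (δ + i) j ≡ true
    small  : ∀ i j → i < δ ⊎ δ + m ≤ i → M i j ≡ true → a ≤ j × j < b
    tail   : ∀ i j → n ≤ i → M i j ≡ M′ i j
    antit  : ∀ i i′ j → n ≤ i → i ≤ i′ → M i′ j ≡ true → M i j ≡ true
    wide   : ∀ {k r₀ r₁} → a ≤ r₀ → r₀ ≤ r₁ → r₁ ≤ b → Chain X k 0 n r₀ r₁ → Chain X′ k 0 n r₀ r₁
    tall   : ∀ {k s u} → s ≤ u → u ≤ m → Chain X k (δ + s) (δ + u) a b → Chain X′ k (ε + s) (ε + u) a b
    off    : ∀ i j → i < m → ¬ (a ≤ j × j < b) → X (δ + i) j → X′ (ε + i) j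
    offT   : ∀ i j → n ≤ i → X i j → X′ i j

module _ {n m a b δ ε M M′ X X′} (T : Transfer n m a b δ ε M M′ X X′) where
  open Transfer T

  private
    -- A rectangle within the rows `[a , b)` can be widened to the left end and across the whole
    -- block, since the block contains these rows and the later columns decrease. Only for the whole
    -- block is the longest chain known to be preserved.
    wideCase : ∀ {k i₀ i₁ j₀ j₁} → i₀ < i₁ → j₀ ≤ j₁ → a ≤ j₀ → j₁ ≤ b → Rect M i₀ i₁ j₀ j₁ →
      Chain X k i₀ i₁ j₀ j₁ → HasChain M′ X′ k
    wideCase {k} {i₀} {i₁} {j₀} {j₁} i< j≤ a≤ ≤b R C
      with chain-split n z≤n (m≤n⊔m i₁ n) j≤ (chain-mono z≤n (m≤m⊔n i₁ n) ≤-refl ≤-refl C)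
    ... | k₁ , k₂ , t , refl , j₀≤t , t≤j₁ , C₁ , C₂ = chainIn z≤n j≤ R′
        (chain-join z≤n (m≤n⊔m i₁ n) j₀≤t t≤j₁ (wide a≤ j₀≤t (≤-trans t≤j₁ ≤b) C₁)
          (chain-map (λ i j n≤i _ _ _ → offT i j n≤i) C₂))
      where
      R′ : Rect M′ 0 (i₁ ⊔ n) j₀ j₁
      R′ i j _ i<⊔ p q with ≤-<-connex n i
      ... | inj₂ i<n = full′ i j i<n (≤-trans a≤ p) (<-≤-trans q ≤b)
      ... | inj₁ n≤i with ≤-<-connex i₀ i
      ...   | inj₁ i₀≤i = trans (sym (tail i j n≤i)) (R i j i₀≤i i<i₁ p q)
        where
        i<i₁ : i < i₁
        i<i₁ with ≤-total i₁ n
        ... | inj₁ i₁≤n = ⊥-elim (<⇒≱ (subst (i <_) (m≤n⇒m⊔n≡n i₁≤n) i<⊔) n≤i)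
        ... | inj₂ n≤i₁ = subst (i <_) (m≥n⇒m⊔n≡m n≤i₁) i<⊔
      ...   | inj₂ i<i₀ = trans (sym (tail i j n≤i)) (antit i i₀ j n≤i (<⇒≤ i<i₀) (R i₀ j ≤-refl i< p q))

    -- By convexity of the columns the rectangle can be extended to all rows of `[a , b)`. The chain
    -- is then cut at `a` and `b`: its middle piece is replaced, while the outer pieces lie where
    -- the entries just follow their columns.
    tallCase : ∀ {k s u j₀ j₁} → s ≤ u → u ≤ m → j₀ < j₁ → Rect M (δ + s) (δ + u) j₀ j₁ →
      Chain X k (δ + s) (δ + u) j₀ j₁ → HasChain M′ X′ k
    tallCase {k} {s} {u} {j₀} {j₁} s≤u u≤m j< R C with ≤-<-connex b a
    -- If `[a , b)` is empty, the columns need not contain a cell at its height, so convexity would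
    -- not justify an extension.
    ... | inj₁ b≤a = chainIn (+-monoʳ-≤ ε s≤u) (<⇒≤ j<) R′ (chain-reindex δ ε
            (λ i j _ i<u _ _ → off i j (<-≤-trans i<u u≤m) (λ { (p , q) → <⇒≱ (<-≤-trans q b≤a) p })) C)
      where
      R′ : Rect M′ (ε + s) (ε + u) j₀ j₁
      R′ i j p q r t with i ∸ ε | m+[n∸m]≡n (≤-trans (m≤m+n ε s) p)
      ... | i° | refl = trans (sym (same i° j (<-≤-trans (+-cancelˡ-< ε _ _ q) u≤m)))
              (R (δ + i°) j (+-monoʳ-≤ δ (+-cancelˡ-≤ ε _ _ p)) (+-monoʳ-< δ (+-cancelˡ-< ε _ _ q)) r t)
    ... | inj₂ a<b with chain-splitᵗ a (m⊓n≤n j₀ a) (≤-trans a≤b (m≤n⊔m j₁ b)) (+-monoʳ-≤ δ s≤u)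
                          (chain-mono ≤-refl ≤-refl (m⊓n≤m j₀ a) (m≤m⊔n j₁ b) C)
    ...   | k₁ , k₂ , t₁ , refl , l₁ , r₁ , C₁ , D with chain-splitᵗ b a≤b (m≤n⊔m j₁ b) r₁ D
    ...     | k₃ , k₄ , t₂ , refl , l₂ , r₂ , C₂ , C₃ =
      go (t₁ ∸ δ) (t₂ ∸ δ) (m+[n∸m]≡n (≤-trans (m≤m+n δ s) l₁)) (m+[n∸m]≡n (≤-trans (≤-trans (m≤m+n δ s) l₁) l₂)) C₁ C₂ C₃ l₁ l₂ r₂
      where
      J₀ = j₀ ⊓ a
      J₁ = j₁ ⊔ b
      hull : ∀ i → s ≤ i → i < u → ∀ j → J₀ ≤ j → j < J₁ → M (δ + i) j ≡ true
      hull i s≤i i<u j p q = convex i (proj₁ lo) j (proj₁ hi) im (proj₁ (proj₂ lo)) (proj₁ (proj₂ hi)) (proj₂ (proj₂ lo)) (proj₂ (proj₂ hi))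
        where
        im = <-≤-trans i<u u≤m
        inR : ∀ j → j₀ ≤ j → j < j₁ → M (δ + i) j ≡ true
        inR j = R (δ + i) j (+-monoʳ-≤ δ s≤i) (+-monoʳ-< δ i<u)
        inF : ∀ j → a ≤ j → j < b → M (δ + i) j ≡ true
        inF j = full (δ + i) j (<-≤-trans (+-monoʳ-< δ im) block≤)
        lo : ∃[ j′ ] (M (δ + i) j′ ≡ true × j′ ≤ j)
        lo with ≤-total j₀ a
        ... | inj₁ e = j₀ , inR j₀ ≤-refl j< , subst (_≤ j) (m≤n⇒m⊓n≡m e) p
        ... | inj₂ e = a , inF a ≤-refl a<b , subst (_≤ j) (m≥n⇒m⊓n≡n e) p
        last : ∀ {x y} → x < y → ∃[ z ] (x ≤ z × y ≡ suc z)
        last (s≤s x≤z) = _ , x≤z , refl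
        hi : ∃[ j′ ] (M (δ + i) j′ ≡ true × j ≤ j′)
        hi with ≤-total j₁ b
        ... | inj₁ e with last a<b
        ...   | z , a≤z , refl = z , inF z a≤z ≤-refl , ≤-pred (subst (j <_) (m≤n⇒m⊔n≡n e) q)
        hi | inj₂ e with last j<
        ...   | z , j₀≤z , refl = z , inR z j₀≤z ≤-refl , ≤-pred (subst (j <_) (m≥n⇒m⊔n≡m e) q)
      R′ : Rect M′ (ε + s) (ε + u) J₀ J₁
      R′ i j p q r t with i ∸ ε | m+[n∸m]≡n (≤-trans (m≤m+n ε s) p)
      ... | i° | refl = trans (sym (same i° j (<-≤-trans (+-cancelˡ-< ε _ _ q) u≤m)))
              (hull i° (+-cancelˡ-≤ ε _ _ p) (+-cancelˡ-< ε _ _ q) j r t)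
      go : ∀ t₁° t₂° → δ + t₁° ≡ t₁ → δ + t₂° ≡ t₂ → Chain X k₁ (δ + s) t₁ J₀ a → Chain X k₃ t₁ t₂ a b →
        Chain X k₄ t₂ (δ + u) b J₁ → δ + s ≤ t₁ → t₁ ≤ t₂ → t₂ ≤ δ + u → HasChain M′ X′ (k₁ + (k₃ + k₄))
      go t₁° t₂° refl refl C₁ C₂ C₃ l₁ l₂ l₃ = chainIn (+-monoʳ-≤ ε s≤u) (≤-trans (m⊓n≤n j₀ a) (≤-trans a≤b (m≤n⊔m j₁ b))) R′
        (chain-join (+-monoʳ-≤ ε e₁) (+-monoʳ-≤ ε (≤-trans e₂ e₃)) (m⊓n≤n j₀ a) (≤-trans a≤b (m≤n⊔m j₁ b))
          (chain-reindex δ ε (λ i j _ i< _ j<a → off i j (<-≤-trans i< (≤-trans e₂ (≤-trans e₃ u≤m))) (λ { (p , _) → <⇒≱ j<a p })) C₁)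
        (chain-join (+-monoʳ-≤ ε e₂) (+-monoʳ-≤ ε e₃) a≤b (m≤n⊔m j₁ b)
          (tall e₂ (≤-trans e₃ u≤m) C₂)
          (chain-reindex δ ε (λ i j _ i< b≤j _ → off i j (<-≤-trans i< u≤m) (λ { (_ , q) → <⇒≱ q b≤j })) C₃)))
        where
        e₁ : s ≤ t₁°
        e₁ = +-cancelˡ-≤ δ _ _ l₁
        e₂ : t₁° ≤ t₂°
        e₂ = +-cancelˡ-≤ δ _ _ l₂
        e₃ : t₂° ≤ u
        e₃ = +-cancelˡ-≤ δ _ _ l₃

  -- By `small`, a rectangle that leaves the rows `[a , b)` meets only the `m` columns allowed to be
  -- taller. The empty chain is treated apart, since its rectangle may be empty and then tells
  -- nothing.
  transfer : ∀ {k} → HasChain M X k → HasChain M′ X′ k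
  transfer {zero} _ = chainIn {i₀ = 0} {0} {0} {0} z≤n z≤n (λ _ _ _ ()) []
  transfer {suc k} (chainIn {i₀} {i₁} {j₀} {j₁} i≤ j≤ R C@(cons i j p q r t x _)) with (a ≤? j₀) ×-dec (j₁ ≤? b)
  ... | yes (a≤ , ≤b) = wideCase (≤-<-trans p q) j≤ a≤ ≤b R C
  ... | no ¬wide = go (i₀ ∸ δ) (i₁ ∸ δ) (m+[n∸m]≡n δ≤i₀) (m+[n∸m]≡n (≤-trans δ≤i₀ i≤)) R C i≤ i₁≤
    where
    j< = ≤-<-trans r t
    i< = ≤-<-trans p q
    contra : ∀ i → i₀ ≤ i → i < i₁ → ¬ (i < δ ⊎ δ + m ≤ i)
    contra i p q out = ¬wide (proj₁ (small i j₀ out (R i j₀ p q ≤-refl j<)) , sucPred j< λ z j₀≤z j₁≡ →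
      subst (_≤ b) (sym j₁≡) (proj₂ (small i z out (R i z p q j₀≤z (subst (z <_) (sym j₁≡) ≤-refl)))))
      where
      sucPred : ∀ {x y} {A : Set} → x < y → (∀ z → x ≤ z → y ≡ suc z → A) → A
      sucPred (s≤s l) f = f _ l refl
    δ≤i₀ : δ ≤ i₀
    δ≤i₀ with ≤-<-connex δ i₀
    ... | inj₁ l = l
    ... | inj₂ l = ⊥-elim (contra i₀ ≤-refl i< (inj₁ l))
    i₁≤ : i₁ ≤ δ + m
    i₁≤ with ≤-<-connex i₁ (δ + m)
    ... | inj₁ l = l
    ... | inj₂ (s≤s {n = z} l) = ⊥-elim (contra z (≤-pred i<) ≤-refl (inj₂ l))
    go : ∀ s u → δ + s ≡ i₀ → δ + u ≡ i₁ → Rect M i₀ i₁ j₀ j₁ → Chain X (suc k) i₀ i₁ j₀ j₁ → i₀ ≤ i₁ → i₁ ≤ δ + m →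
      HasChain M′ X′ (suc k)
    go s u refl refl R C l₁ l₂ = tallCase (+-cancelˡ-≤ δ _ _ l₁) (+-cancelˡ-≤ δ _ _ l₂) j< R C

-- Moving a column in a whole filling

RSK-resp : ∀ {m h A B G} → (∀ i j → i < m → j < h → A i j ≡ B i j) → RSK m h A G → RSK m h B G
RSK-resp A≗ R .left = left R
RSK-resp A≗ R .bot = bot R
RSK-resp {G = G} A≗ R .cell i j i< j< =
  subst (λ c → RCell (G i j) (G i (suc j)) (G (suc i) j) c (G (suc i) (suc j))) (A≗ i j i< j<) (cell R i j i< j<)

LMul-resp : ∀ {h c c′ P U} → (∀ j → j < h → c j ≡ c′ j) → LMul h c P U → LMul h c′ P U
LMul-resp c≗ L .tabP = tabP L
LMul-resp c≗ L .tabU = tabU L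
LMul-resp c≗ L .grow = grow L
LMul-resp {h} {P = P} {U} c≗ L .lcel j j< =
  subst (λ c → LCell (suc h) (P j) (P (suc j)) (U j) c (U (suc j))) (c≗ j j<) (lcel L j j<)

Rotation-resp : ∀ {m h A A′ B B′} → (∀ i j → i < suc m → j < h → A i j ≡ B i j) →
  (∀ i j → i < suc m → j < h → A′ i j ≡ B′ i j) → Rotation m h A A′ → Rotation m h B B′
Rotation-resp A≗ A′≗ R = record
  { G = G R ; G′ = G′ R ; P = P R ; U = U R
  ; rsk = RSK-resp (λ i j i< → A≗ (suc i) j (s≤s i<)) (rsk R)
  ; rsk′ = RSK-resp A′≗ (rsk′ R)
  ; mul = LMul-resp (λ j → A≗ 0 j (s≤s z≤n)) (mul R)
  ; P≗ = P≗ R ; U≗ = U≗ R ; Q≗ = Q≗ R }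

sumTo : ℕ → (ℕ → ℕ) → ℕ
sumTo zero    f = 0
sumTo (suc n) f = sumTo n f + f n

sumTo-cong : ∀ n {f g : ℕ → ℕ} → (∀ i → i < n → f i ≡ g i) → sumTo n f ≡ sumTo n g
sumTo-cong zero    f≗ = refl
sumTo-cong (suc n) f≗ = cong₂ _+_ (sumTo-cong n (λ i i< → f≗ i (m≤n⇒m≤1+n i<))) (f≗ n ≤-refl)

sumTo-extend : ∀ {n} w {f g : ℕ → ℕ} → n ≤ w → sumTo n f ≡ sumTo n g → (∀ i → n ≤ i → f i ≡ g i) →
  sumTo w f ≡ sumTo w g
sumTo-extend w n≤w e f≗ with m≤n⇒m<n∨m≡n n≤w
sumTo-extend w n≤w e f≗ | inj₂ refl = e
sumTo-extend (suc w) n≤w e f≗ | inj₁ (s≤s n≤) = cong₂ _+_ (sumTo-extend w n≤ e f≗) (f≗ w n≤)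

sumTo-suc : ∀ n f → sumTo (suc n) f ≡ f 0 + sumTo n (λ i → f (suc i))
sumTo-suc zero    f = +-comm 0 (f 0)
sumTo-suc (suc n) f = trans (cong (_+ f (suc n)) (sumTo-suc n f)) (+-assoc (f 0) _ _)

letters-cols : ∀ A n j → letters (cols A n) j ≡ sumTo n (λ i → A i j)
letters-cols A zero    j = refl
letters-cols A (suc n) j = trans (letters-++ (cols A n) [ A n ] j) (cong₂ _+_ (letters-cols A n j) (+-identityʳ (A n j)))

-- The cyclic permutation of 0 , … , m, by which column rot m i becomes column i.
rot : ℕ → ℕ → ℕ
rot m i with <-cmp i m
... | tri< _ _ _ = suc i
... | tri≈ _ _ _ = 0
... | tri> _ _ _ = i

unrot : ℕ → ℕ → ℕ
unrot m zero = m
unrot m (suc i) with i <? m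
... | yes _ = i
... | no  _ = suc i

module _ {m : ℕ} where

  rot-< : ∀ {i} → i < m → rot m i ≡ suc i
  rot-< {i} l with <-cmp i m
  ... | tri< _ _ _ = refl
  ... | tri≈ ¬l _ _ = ⊥-elim (¬l l)
  ... | tri> ¬l _ _ = ⊥-elim (¬l l)

  rot-≡ : rot m m ≡ 0
  rot-≡ with <-cmp m m
  ... | tri< _ ¬e _ = ⊥-elim (¬e refl)
  ... | tri≈ _ _ _ = refl
  ... | tri> _ ¬e _ = ⊥-elim (¬e refl)

  rot-> : ∀ {i} → m < i → rot m i ≡ i
  rot-> {i} l with <-cmp i m
  ... | tri< _ _ ¬l = ⊥-elim (¬l l)
  ... | tri≈ _ _ ¬l = ⊥-elim (¬l l)
  ... | tri> _ _ _ = refl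

  rot-unrot : ∀ i → rot m (unrot m i) ≡ i
  rot-unrot zero = rot-≡
  rot-unrot (suc i) with i <? m
  ... | yes l = rot-< l
  ... | no ¬l = rot-> (s≤s (≮⇒≥ ¬l))

  unrot-rot : ∀ i → unrot m (rot m i) ≡ i
  unrot-rot i with <-cmp i m
  ... | tri≈ _ refl _ = refl
  ... | tri< l _ _ with i <? m
  ...   | yes _ = refl
  ...   | no ¬l = ⊥-elim (¬l l)
  unrot-rot (suc i) | tri> _ _ (s≤s l) with i <? m
  ...   | yes l′ = ⊥-elim (<⇒≱ l′ l)
  ...   | no _ = refl

  rot-mono : ∀ {n i} → m < n → i < n → rot m i < n
  rot-mono {i = i} m<n i<n with <-cmp i m
  ... | tri< l _ _ = ≤-<-trans l m<n
  ... | tri≈ _ _ _ = ≤-<-trans z≤n m<n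
  ... | tri> _ _ _ = i<n

  unrot-mono : ∀ {n i} → m < n → i < n → unrot m i < n
  unrot-mono {i = zero} m<n i<n = m<n
  unrot-mono {i = suc i} m<n i<n with i <? m
  ... | yes _ = <⇒≤ i<n
  ... | no _ = i<n

sumTo-rot : ∀ m f → sumTo (suc m) (λ i → f (rot m i)) ≡ sumTo (suc m) f
sumTo-rot m f = trans (cong₂ _+_ (sumTo-cong m (λ i l → cong f (rot-< l))) (cong f (rot-≡ {m})))
  (trans (+-comm _ (f 0)) (sym (sumTo-suc m f)))

module Move (m a b : ℕ) (a≤b : a ≤ b) where

  InBlock : ℕ → ℕ → Set
  InBlock i j = i < suc m × a ≤ j × j < b

  inBlock? : ∀ i j → Dec (InBlock i j)
  inBlock? i j = (i <? suc m) ×-dec ((a ≤? j) ×-dec (j <? b))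

  record Moved (F F′ : Array) : Set where
    field
      rotation : Rotation m (b ∸ a) (upsideDown b F) (upsideDown b F′)
      outside  : ∀ i j → ¬ InBlock i j → F′ i j ≡ F (rot m i) j

  open Moved

  private
    sub : ∀ {j} → a ≤ j → j < b → b ∸ suc j < b ∸ a
    sub a≤j j<b = ∸-monoʳ-< {b} (s≤s a≤j) j<b
    twice : ∀ {j} → j < b → b ∸ suc (b ∸ suc j) ≡ j
    twice j<b = trans (cong (b ∸_) (sym (∸-suc j<b))) (m∸[m∸n]≡n (<⇒≤ j<b))
    back : ∀ {j} → j < b ∸ a → a ≤ b ∸ suc j × b ∸ suc j < b
    back {j} l = subst (_≤ b ∸ suc j) (m∸[m∸n]≡n a≤b) (∸-monoʳ-≤ b l) , ∸-monoʳ-< {b} (s≤s z≤n) (≤-trans l (m∸n≤m b a))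

  move unmove : Array → Array
  move F i j with inBlock? i j
  ... | yes _ = rotate m (b ∸ a) (upsideDown b F) i (b ∸ suc j)
  ... | no  _ = F (rot m i) j
  unmove F′ i j with inBlock? i j
  ... | yes _ = unrotate m (b ∸ a) (upsideDown b F′) i (b ∸ suc j)
  ... | no  _ = F′ (unrot m i) j

  private
    unrot-out : ∀ {i j} → ¬ InBlock i j → ¬ InBlock (unrot m i) j
    unrot-out {i} ¬in (u< , r) = ¬in (subst (_< suc m) (rot-unrot i) (rot-mono (n<1+n m) u<) , r)
    rot-out : ∀ {i j} → ¬ InBlock i j → ¬ InBlock (rot m i) j
    rot-out {i} ¬in (u< , r) = ¬in (subst (_< suc m) (unrot-rot i) (unrot-mono (n<1+n m) u<) , r)

  module _ {F F⁺ : Array} (F⁺≗ : ∀ i j → move F i j ≡ F⁺ i j) where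
    move-Moved : Moved F F⁺
    move-Moved .rotation = Rotation-resp (λ _ _ _ _ → refl) eq (rotate-Rotation m (b ∸ a) (upsideDown b F))
      where
      eq : ∀ i j → i < suc m → j < b ∸ a → rotate m (b ∸ a) (upsideDown b F) i j ≡ upsideDown b F⁺ i j
      eq i j i< j< rewrite sym (F⁺≗ i (b ∸ suc j)) with inBlock? i (b ∸ suc j)
      ... | yes _ = cong (rotate m (b ∸ a) (upsideDown b F) i) (sym (twice (≤-trans j< (m∸n≤m b a))))
      ... | no ¬in = ⊥-elim (¬in (i< , back j<))
    move-Moved .outside i j ¬in rewrite sym (F⁺≗ i j) with inBlock? i j
    ... | yes y = ⊥-elim (¬in y)
    ... | no _ = refl

  module _ {F′ F⁻ : Array} (F⁻≗ : ∀ i j → unmove F′ i j ≡ F⁻ i j) where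
    unmove-Moved : Moved F⁻ F′
    unmove-Moved .rotation = Rotation-resp eq (λ _ _ _ _ → refl) (unrotate-Rotation m (b ∸ a) (upsideDown b F′))
      where
      eq : ∀ i j → i < suc m → j < b ∸ a → unrotate m (b ∸ a) (upsideDown b F′) i j ≡ upsideDown b F⁻ i j
      eq i j i< j< rewrite sym (F⁻≗ i (b ∸ suc j)) with inBlock? i (b ∸ suc j)
      ... | yes _ = cong (unrotate m (b ∸ a) (upsideDown b F′) i) (sym (twice (≤-trans j< (m∸n≤m b a))))
      ... | no ¬in = ⊥-elim (¬in (i< , back j<))
    unmove-Moved .outside i j ¬in rewrite sym (F⁻≗ (rot m i) j) with inBlock? (rot m i) j
    ... | yes y = ⊥-elim (rot-out ¬in y)
    ... | no _ = cong (λ i → F′ i j) (sym (unrot-rot i))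

  module _ {F F′ E E′} (R : Moved F F′) (S : Moved E E′) where
    Moved-unique : (∀ i j → F i j ≡ E i j) → ∀ i j → F′ i j ≡ E′ i j
    Moved-unique F≗ i j with inBlock? i j
    ... | no ¬in = trans (outside R i j ¬in) (trans (F≗ (rot m i) j) (sym (outside S i j ¬in)))
    ... | yes (i< , a≤j , j<b) = subst (λ j → F′ i j ≡ E′ i j) (twice j<b)
      (Rotation-unique (rotation R) (rotation S) (λ i j _ _ → F≗ i (b ∸ suc j)) i (b ∸ suc j) i< (sub a≤j j<b))

    Moved-unique⁻ : (∀ i j → F′ i j ≡ E′ i j) → ∀ i j → F i j ≡ E i j
    Moved-unique⁻ F≗ i j with inBlock? i j
    ... | no ¬in = subst (λ i → F i j ≡ E i j) (rot-unrot i)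
        (trans (sym (outside R (unrot m i) j (unrot-out ¬in))) (trans (F≗ (unrot m i) j) (outside S (unrot m i) j (unrot-out ¬in))))
    ... | yes (i< , a≤j , j<b) = subst (λ j → F i j ≡ E i j) (twice j<b)
      (Rotation-unique⁻ (rotation R) (rotation S) (λ i j _ _ → F≗ i (b ∸ suc j)) i (b ∸ suc j) i< (sub a≤j j<b))

  module _ {F F′} (R : Moved F F′) where
    -- In the rows `[a , b)` the sum over the block is a letter count of the column word; in the
    -- other rows the entries are merely permuted.
    moved-sum : ∀ {w} → suc m ≤ w → ∀ j → sumTo w (λ i → F i j) ≡ sumTo w (λ i → F′ i j)
    moved-sum {w} m<w j = sumTo-extend w m<w block tail
      where
      tail : ∀ i → suc m ≤ i → F i j ≡ F′ i j
      tail i m<i = sym (trans (outside R i j (λ { (i≤m , _) → <⇒≱ m<i (≤-pred i≤m) })) (cong (λ i → F i j) (rot-> m<i)))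
      block : sumTo (suc m) (λ i → F i j) ≡ sumTo (suc m) (λ i → F′ i j)
      block with (a ≤? j) ×-dec (j <? b)
      ... | no ¬in = trans (sym (sumTo-rot m (λ i → F i j)))
              (sumTo-cong (suc m) (λ i _ → sym (outside R i j (λ { (_ , r) → ¬in r }))))
      ... | yes (a≤j , j<b) = subst (λ j → sumTo (suc m) (λ i → F i j) ≡ sumTo (suc m) (λ i → F′ i j)) (twice j<b)
              (trans (sym (letters-cols (upsideDown b F) (suc m) (b ∸ suc j)))
              (trans (sameLetters (rotation-≈ (rotation R)) (b ∸ suc j) (sub a≤j j<b)) (letters-cols (upsideDown b F′) (suc m) (b ∸ suc j))))

    private
      conv : ∀ E E′ → (b ∸ a) ⊢ cols (upsideDown b E) (suc m) ⊑ cols (upsideDown b E′) (suc m) →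
        ∀ {k r₀ r₁} → a ≤ r₀ → r₀ ≤ r₁ → r₁ ≤ b → Chain (Positive E) k 0 (suc m) r₀ r₁ → Chain (Positive E′) k 0 (suc m) r₀ r₁
      conv E E′ f {k} {r₀} {r₁} a≤ r≤ ≤b C = subst₂ (Chain (Positive E′) k 0 (suc m)) (m∸[m∸n]≡n (≤-trans r≤ ≤b)) (m∸[m∸n]≡n ≤b)
        (cols→chain E′ b (suc m) (∸-monoʳ-≤ b r≤) (m∸n≤m b r₀) (f (∸-monoʳ-≤ b r≤) (∸-monoʳ-≤ b a≤)
          (chain→cols E b (suc m) (∸-monoʳ-≤ b r≤) (m∸n≤m b r₀)
            (subst₂ (Chain (Positive E) k 0 (suc m)) (sym (m∸[m∸n]≡n (≤-trans r≤ ≤b))) (sym (m∸[m∸n]≡n ≤b)) C))))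

      convᵗ : ∀ E E′ δ ε → m ⊢ cols (λ j i → upsideDown b E (δ + i) j) (b ∸ a) ⊑ cols (λ j i → upsideDown b E′ (ε + i) j) (b ∸ a) →
        ∀ {k s u} → s ≤ u → u ≤ m → Chain (Positive E) k (δ + s) (δ + u) a b → Chain (Positive E′) k (ε + s) (ε + u) a b
      convᵗ E E′ δ ε f {k} {s} {u} s≤u u≤m C = chain-reindex 0 ε (λ _ _ _ _ _ _ x → x)
        (subst (λ r → Chain (Positive (λ i → E′ (ε + i))) k s u r b) (m∸[m∸n]≡n a≤b)
          (rows→chain (λ i → E′ (ε + i)) b (b ∸ a) (m∸n≤m b a) s≤u (f s≤u u≤m
            (chain→rows (λ i → E (δ + i)) b (b ∸ a) (m∸n≤m b a) s≤u
              (subst (λ r → Chain (Positive (λ i → E (δ + i))) k s u r b) (sym (m∸[m∸n]≡n a≤b))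
                (chain-reindex δ 0 (λ _ _ _ _ _ _ x → x) C))))))

    moved-wide : ∀ {k r₀ r₁} → a ≤ r₀ → r₀ ≤ r₁ → r₁ ≤ b →
      Chain (Positive F) k 0 (suc m) r₀ r₁ → Chain (Positive F′) k 0 (suc m) r₀ r₁
    moved-wide = conv F F′ (to (rotation-≈ (rotation R)))

    moved-wide⁻ : ∀ {k r₀ r₁} → a ≤ r₀ → r₀ ≤ r₁ → r₁ ≤ b →
      Chain (Positive F′) k 0 (suc m) r₀ r₁ → Chain (Positive F) k 0 (suc m) r₀ r₁
    moved-wide⁻ = conv F′ F (from (rotation-≈ (rotation R)))

    moved-tall : ∀ {k s u} → s ≤ u → u ≤ m → Chain (Positive F) k (1 + s) (1 + u) a b → Chain (Positive F′) k s u a b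
    moved-tall = convᵗ F F′ 1 0 (to (rotation-≈ᵗ (rotation R)))

    moved-tall⁻ : ∀ {k s u} → s ≤ u → u ≤ m → Chain (Positive F′) k s u a b → Chain (Positive F) k (1 + s) (1 + u) a b
    moved-tall⁻ = convᵗ F′ F 0 1 (from (rotation-≈ᵗ (rotation R)))

record Movable (M : Cells) (m a b : ℕ) : Set where
  field
    a≤b    : a ≤ b
    col₀   : ∀ j → M 0 j ≡ true → a ≤ j × j < b
    col₀⁻  : ∀ j → a ≤ j → j < b → M 0 j ≡ true
    incl   : ∀ i j → i < suc m → M 0 j ≡ true → M i j ≡ true
    convex : ∀ i j₁ j j₂ → i < suc m → M i j₁ ≡ true → M i j₂ ≡ true → j₁ ≤ j → j ≤ j₂ → M i j ≡ true
    after  : ∀ i j → m < i → M i j ≡ true → M 0 j ≡ true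
    antit  : ∀ i i′ j → m < i → i ≤ i′ → M i′ j ≡ true → M i j ≡ true

module _ {M m a b} (V : Movable M m a b) where
  open Movable V
  open Move m a b a≤b
  open Moved

  M⁺ : Cells
  M⁺ i = M (rot m i)

  module _ {F F′ : Array} (R : Moved F F′) where
    private
      full : ∀ i j → i < suc m → a ≤ j → j < b → M i j ≡ true
      full i j i< a≤ <b = incl i j i< (col₀⁻ j a≤ <b)
      full⁺ : ∀ i j → i < suc m → a ≤ j → j < b → M⁺ i j ≡ true
      full⁺ i j i< = full (rot m i) j (rot-mono (n<1+n m) i<)
      at : ∀ {i i′} → i ≡ i′ → ∀ j → M i j ≡ M i′ j
      at refl j = refl
      outEq : ∀ i j → i < m → ¬ (a ≤ j × j < b) → F′ i j ≡ F (suc i) j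
      outEq i j i< ¬r = trans (outside R i j (λ { (_ , r) → ¬r r })) (cong (λ i → F i j) (rot-< i<))
      tailEq : ∀ i j → suc m ≤ i → F′ i j ≡ F i j
      tailEq i j m<i = trans (outside R i j (λ { (i≤ , _) → <⇒≱ m<i (≤-pred i≤) })) (cong (λ i → F i j) (rot-> m<i))

    forward : Transfer (suc m) m a b 1 0 M M⁺ (Positive F) (Positive F′)
    forward = record
      { a≤b = a≤b ; block≤ = ≤-refl ; full = full ; full′ = full⁺
      ; same = λ i j i< → at (sym (rot-< i<)) j
      ; convex = λ i j₁ j j₂ i< → convex (suc i) j₁ j j₂ (s≤s i<)
      ; small = λ { .0 j (inj₁ (s≤s z≤n)) c → col₀ j c ; i j (inj₂ m<i) c → col₀ j (after i j m<i c) }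
      ; tail = λ i j m<i → at (sym (rot-> m<i)) j
      ; antit = antit
      ; wide = moved-wide R ; tall = moved-tall R
      ; off = λ i j i< ¬r → subst (0 <_) (sym (outEq i j i< ¬r))
      ; offT = λ i j m<i → subst (0 <_) (sym (tailEq i j m<i)) }

    backward : Transfer (suc m) m a b 0 1 M⁺ M (Positive F′) (Positive F)
    backward = record
      { a≤b = a≤b ; block≤ = n≤1+n m ; full = full⁺ ; full′ = full
      ; same = λ i j i< → at (rot-< i<) j
      ; convex = λ i j₁ j j₂ i< c₁ c₂ l₁ l₂ → trans (at (rot-< i<) j) (convex (suc i) j₁ j j₂ (s≤s i<)
          (trans (at (sym (rot-< i<)) j₁) c₁) (trans (at (sym (rot-< i<)) j₂) c₂) l₁ l₂)
      ; small = λ { i j (inj₂ m≤i) c → small i j m≤i c }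
      ; tail = λ i j m<i → at (rot-> m<i) j
      ; antit = λ i i′ j m<i i≤ c → trans (at (rot-> m<i) j) (antit i i′ j m<i i≤ (trans (at (sym (rot-> (≤-trans m<i i≤))) j) c))
      ; wide = moved-wide⁻ R ; tall = moved-tall⁻ R
      ; off = λ i j i< ¬r → subst (0 <_) (outEq i j i< ¬r)
      ; offT = λ i j m<i → subst (0 <_) (tailEq i j m<i) }
      where
      small : ∀ i j → m ≤ i → M⁺ i j ≡ true → a ≤ j × j < b
      small i j m≤i c with m≤n⇒m<n∨m≡n m≤i
      ... | inj₁ m<i = col₀ j (after i j m<i (trans (at (sym (rot-> m<i)) j) c))
      ... | inj₂ refl = col₀ j (trans (at (sym (rot-≡ {m})) j) c)

    support⁺ : (∀ i j → 0 < F i j → M i j ≡ true) → ∀ i j → 0 < F′ i j → M⁺ i j ≡ true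
    support⁺ s i j p with inBlock? i j
    ... | yes (i< , a≤ , <b) = full⁺ i j i< a≤ <b
    ... | no ¬in = s (rot m i) j (subst (0 <_) (outside R i j ¬in) p)

    support⁻ : (∀ i j → 0 < F′ i j → M⁺ i j ≡ true) → ∀ i j → 0 < F i j → M i j ≡ true
    support⁻ s i j p with inBlock? (unrot m i) j
    ... | yes (i< , a≤ , <b) = full i j (subst (_< suc m) (rot-unrot i) (rot-mono (n<1+n m) i<)) a≤ <b
    ... | no ¬in = trans (at (sym (rot-unrot i)) j) (s (unrot m i) j (subst (0 <_)
            (sym (trans (outside R (unrot m i) j ¬in) (cong (λ i → F i j) (rot-unrot i)))) p))

get : ∀ {a} {A : Set a} {n} → A → Vec A n → ℕ → A
get d []       i       = d
get d (x ∷ xs) zero    = x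
get d (x ∷ xs) (suc i) = get d xs i

tab : ∀ {a} {A : Set a} n → (ℕ → A) → Vec A n
tab zero    f = []
tab (suc n) f = f 0 ∷ tab n (λ i → f (suc i))

get-tab : ∀ {a} {A : Set a} {d : A} {n} f {i} → i < n → get d (tab n f) i ≡ f i
get-tab {n = suc n} f {zero}  _       = refl
get-tab {n = suc n} f {suc i} (s≤s l) = get-tab (λ i → f (suc i)) l

get-out : ∀ {a} {A : Set a} {d : A} {n} (v : Vec A n) {i} → n ≤ i → get d v i ≡ d
get-out []       l       = refl
get-out (x ∷ xs) (s≤s l) = get-out xs l

get-ext : ∀ {a} {A : Set a} {d : A} {n} (v u : Vec A n) → (∀ i → i < n → get d v i ≡ get d u i) → v ≡ u
get-ext []      []      e = refl
get-ext (x ∷ v) (y ∷ u) e = cong₂ _∷_ (e 0 (s≤s z≤n)) (get-ext v u (λ i l → e (suc i) (s≤s l)))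

-- Sorting the columns

-- Stored by rows, unlike Matrix.
NMatrix : ℕ → ℕ → Set
NMatrix w h = Vec (Vec ℕ w) h

module _ {w h : ℕ} where

  at : NMatrix w h → Array
  at F i j = get 0 (get (V.replicate w 0) F j) i

  fromArray : Array → NMatrix w h
  fromArray A = tab h (λ j → tab w (λ i → A i j))

  at-fromArray : ∀ A i j → i < w → j < h → at (fromArray A) i j ≡ A i j
  at-fromArray A i j i< j< = trans (cong (λ row → get 0 row i) (get-tab _ j<)) (get-tab _ i<)

  at-out : ∀ F i j → w ≤ i ⊎ h ≤ j → at F i j ≡ 0
  at-out F i j (inj₁ w≤i) = get-out (get (V.replicate w 0) F j) w≤i
  at-out F i j (inj₂ h≤j) = trans (cong (λ row → get 0 row i) (get-out F h≤j)) (zeros w i)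
    where
    zeros : ∀ n i → get 0 (V.replicate n 0) i ≡ 0
    zeros zero    i       = refl
    zeros (suc n) zero    = refl
    zeros (suc n) (suc i) = zeros n i

  at-ext : ∀ F E → (∀ i j → i < w → j < h → at F i j ≡ at E i j) → F ≡ E
  at-ext F E e = get-ext F E (λ j j< → get-ext _ _ (λ i i< → e i j i< j<))

  at-fromArray′ : ∀ A → (∀ i j → w ≤ i ⊎ h ≤ j → A i j ≡ 0) → ∀ i j → A i j ≡ at (fromArray A) i j
  at-fromArray′ A z i j with ≤-<-connex w i | ≤-<-connex h j
  ... | inj₁ w≤i | _ = trans (z i j (inj₁ w≤i)) (sym (at-out (fromArray A) i j (inj₁ w≤i)))
  ... | inj₂ _ | inj₁ h≤j = trans (z i j (inj₂ h≤j)) (sym (at-out (fromArray A) i j (inj₂ h≤j)))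
  ... | inj₂ i< | inj₂ j< = sym (at-fromArray A i j i< j<)

Longest : Cells → Region → ℕ → Set
Longest M X l = HasChain M X l × (∀ k → HasChain M X k → k ≤ l)

record NFilling (w h : ℕ) (M : Cells) (l : ℕ) (r : ℕ → ℕ) (F : NMatrix w h) : Set where
  constructor nfilling
  field
    support : ∀ i j → 0 < at F i j → M i j ≡ true
    longest : Longest M (Positive (at F)) l
    sums    : ∀ j → j < h → sumTo w (λ i → at F i j) ≡ r j

open NFilling

SameSize-refl : ∀ {A : Set} {P : A → Set} → SameSize P P
SameSize-refl = (λ x → x) , (λ x → x) , (λ _ p → p) , (λ _ p → p) , (λ _ _ → refl) , (λ _ _ → refl)

SameSize-sym : ∀ {A B : Set} {P : A → Set} {Q : B → Set} → SameSize P Q → SameSize Q P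
SameSize-sym (f , g , pf , pg , gf , fg) = g , f , pg , pf , fg , gf

SameSize-trans : ∀ {A B C : Set} {P : A → Set} {Q : B → Set} {R : C → Set} →
  SameSize P Q → SameSize Q R → SameSize P R
SameSize-trans (f , g , pf , pg , gf , fg) (f′ , g′ , pf′ , pg′ , gf′ , fg′) =
    (λ x → f′ (f x)) , (λ z → g (g′ z))
  , (λ x p → pf′ (f x) (pf x p)) , (λ z r → pg (g′ z) (pg′ z r))
  , (λ x p → trans (cong g (gf′ (f x) (pf x p))) (gf x p))
  , (λ z r → trans (cong f′ (fg (g′ z) (pg′ z r))) (fg′ z r))

SameSize-⇔ : ∀ {A : Set} {P Q : A → Set} → (∀ x → P x → Q x) → (∀ x → Q x → P x) → SameSize P Q
SameSize-⇔ f g = (λ x → x) , (λ x → x) , f , g , (λ _ _ → refl) , (λ _ _ → refl)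

module _ {w h M m a b} (V : Movable M m a b) (m<w : m < w) (b≤h : b ≤ h) where
  open Movable V using (a≤b)
  open Move m a b a≤b
  open Moved

  private
    outBlock : ∀ {i j} → w ≤ i ⊎ h ≤ j → ¬ InBlock i j
    outBlock (inj₁ w≤i) (i< , _) = <⇒≱ (<-≤-trans i< m<w) w≤i
    outBlock (inj₂ h≤j) (_ , _ , j<b) = <⇒≱ (<-≤-trans j<b b≤h) h≤j
    rotOut : ∀ {i j} → w ≤ i ⊎ h ≤ j → w ≤ rot m i ⊎ h ≤ j
    rotOut {i} (inj₁ w≤i) = inj₁ (≮⇒≥ (λ l → <⇒≱ (subst (_< w) (unrot-rot i) (unrot-mono m<w l)) w≤i))
    rotOut (inj₂ h≤j) = inj₂ h≤j
    unrotOut : ∀ {i j} → w ≤ i ⊎ h ≤ j → w ≤ unrot m i ⊎ h ≤ j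
    unrotOut {i} (inj₁ w≤i) = inj₁ (≮⇒≥ (λ l → <⇒≱ (subst (_< w) (rot-unrot i) (rot-mono m<w l)) w≤i))
    unrotOut (inj₂ h≤j) = inj₂ h≤j

    f g : NMatrix w h → NMatrix w h
    f F = fromArray (move (at F))
    g F = fromArray (unmove (at F))

    fM : ∀ F → Moved (at F) (at (f F))
    fM F = move-Moved (at-fromArray′ (move (at F)) zero′)
      where
      zero′ : ∀ i j → w ≤ i ⊎ h ≤ j → move (at F) i j ≡ 0
      zero′ i j o with inBlock? i j
      ... | yes y = ⊥-elim (outBlock o y)
      ... | no _ = at-out F (rot m i) j (rotOut o)

    gM : ∀ F → Moved (at (g F)) (at F)
    gM F = unmove-Moved (at-fromArray′ (unmove (at F)) zero′)
      where
      zero′ : ∀ i j → w ≤ i ⊎ h ≤ j → unmove (at F) i j ≡ 0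
      zero′ i j o with inBlock? i j
      ... | yes y = ⊥-elim (outBlock o y)
      ... | no _ = at-out F (unrot m i) j (unrotOut o)

    pf : ∀ l r F E → Moved (at F) (at E) → NFilling w h M l r F → NFilling w h (M⁺ V) l r E
    pf l r F E R (nfilling s (c , bd) e) = nfilling (support⁺ V R s)
      (transfer (forward V R) c , λ k c → bd k (transfer (backward V R) c))
      (λ j j< → trans (sym (moved-sum R m<w j)) (e j j<))
    pg : ∀ l r F E → Moved (at F) (at E) → NFilling w h (M⁺ V) l r E → NFilling w h M l r F
    pg l r F E R (nfilling s (c , bd) e) = nfilling (support⁻ V R s)
      (transfer (backward V R) c , λ k c → bd k (transfer (forward V R) c))
      (λ j j< → trans (moved-sum R m<w j) (e j j<))

  -- The round trips are closed by uniqueness: `F` and its image under both maps are related by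
  -- `Moved` to the same filling.
  move-SameSize : ∀ l r → SameSize (NFilling w h M l r) (NFilling w h (M⁺ V) l r)
  move-SameSize l r = f , g , (λ F → pf l r F (f F) (fM F)) , (λ F → pg l r (g F) F (gM F))
    , (λ F _ → at-ext (g (f F)) F (λ i j _ _ → Moved-unique⁻ (gM (f F)) (fM F) (λ _ _ → refl) i j))
    , (λ F _ → at-ext (f (g F)) F (λ i j _ _ → Moved-unique (fM (g F)) (gM F) (λ _ _ → refl) i j))

-- The first n columns are those of a moon polyomino, the others are smaller and decreasing.
record Sorted (w h : ℕ) (M : Cells) (n : ℕ) : Set where
  field
    box    : ∀ i j → M i j ≡ true → i < w × j < h
    convex : ∀ i j₁ j j₂ → M i j₁ ≡ true → M i j₂ ≡ true → j₁ ≤ j → j ≤ j₂ → M i j ≡ true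
    rowConvex : ∀ i₁ i i₂ j → i₂ < n → M i₁ j ≡ true → M i₂ j ≡ true → i₁ ≤ i → i ≤ i₂ → M i j ≡ true
    nested : ∀ i i′ → i < n → i′ < n → (∀ j → M i j ≡ true → M i′ j ≡ true) ⊎ (∀ j → M i′ j ≡ true → M i j ≡ true)
    after  : ∀ i i′ j → i < n → n ≤ i′ → M i′ j ≡ true → M i j ≡ true
    antit  : ∀ i i′ j → n ≤ i → i ≤ i′ → M i′ j ≡ true → M i j ≡ true

interval : ∀ h (c : ℕ → Bool) → (∀ j₁ j j₂ → c j₁ ≡ true → c j₂ ≡ true → j₁ ≤ j → j ≤ j₂ → c j ≡ true) →
  ∃[ a ] ∃[ b ] (a ≤ b × b ≤ h × (∀ j → j < h → c j ≡ true → a ≤ j × j < b) × (∀ j → a ≤ j → j < b → c j ≡ true))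
interval zero c conv = 0 , 0 , z≤n , z≤n , (λ _ ()) , (λ _ _ ())
interval (suc h) c conv with interval h c conv | c h in eq
... | a , b , a≤b , b≤h , p , q | false = a , b , a≤b , m≤n⇒m≤1+n b≤h , p′ , q
  where
  p′ : ∀ j → j < suc h → c j ≡ true → a ≤ j × j < b
  p′ j (s≤s j≤) cj with m≤n⇒m<n∨m≡n j≤
  ... | inj₁ j< = p j j< cj
  ... | inj₂ refl with () ← trans (sym eq) cj
... | a , b , a≤b , b≤h , p , q | true with m≤n⇒m<n∨m≡n a≤b
...   | inj₁ a<b = a , suc h , m≤n⇒m≤1+n (≤-trans a≤b b≤h) , ≤-refl , p′ , λ j a≤j j≤h → conv a j h (q a ≤-refl a<b) eq a≤j (≤-pred j≤h)
  where
  p′ : ∀ j → j < suc h → c j ≡ true → a ≤ j × j < suc h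
  p′ j (s≤s j≤) cj with m≤n⇒m<n∨m≡n j≤
  ... | inj₁ j< = proj₁ (p j j< cj) , s≤s j≤
  ... | inj₂ refl = ≤-trans a≤b b≤h , ≤-refl
...   | inj₂ refl = h , suc h , n≤1+n h , ≤-refl , p′ , λ j h≤j j≤h → subst (λ j → c j ≡ true) (≤-antisym h≤j (≤-pred j≤h)) eq
  where
  p′ : ∀ j → j < suc h → c j ≡ true → h ≤ j × j < suc h
  p′ j (s≤s j≤) cj with m≤n⇒m<n∨m≡n j≤
  ... | inj₁ j< = ⊥-elim (<⇒≱ (proj₂ (p j j< cj)) (proj₁ (p j j< cj)))
  ... | inj₂ refl = ≤-refl , ≤-refl

record Sorting (w h : ℕ) (M : Cells) : Set where
  field
    N        : Cells
    sorted   : Sorted w h N 0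
    sameSize : ∀ l r → SameSize (NFilling w h M l r) (NFilling w h N l r)
    -- A way to say that whole columns have been permuted: `φ` will be membership in a row as well
    -- as a test on the height of a column.
    sameSum  : ∀ (φ : (ℕ → Bool) → ℕ) → sumTo w (λ i → φ (N i)) ≡ sumTo w (λ i → φ (M i))

open Sorting
open Sorted

module _ {w h M m} (m<w : m < w) (S : Sorted w h M (suc m)) where

  first-Movable : (∀ j → M 0 j ≡ true → M m j ≡ true) → ∃[ a ] ∃[ b ] (b ≤ h × Movable M m a b)
  first-Movable ⊆ with interval h (M 0) (convex S 0)
  ... | a , b , a≤b , b≤h , p , q = a , b , b≤h , record
    { a≤b = a≤b
    ; col₀ = λ j c → p j (proj₂ (box S 0 j c)) c
    ; col₀⁻ = q
    ; incl = λ i j i< c → rowConvex S 0 i m j ≤-refl c (⊆ j c) z≤n (≤-pred i<)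
    ; convex = λ i j₁ j j₂ _ → convex S i j₁ j j₂
    ; after = λ i j → after S 0 i j (s≤s z≤n)
    ; antit = antit S }

  module _ {a b} (V : Movable M m a b) where
    private
      at0 : ∀ {i i′} → i ≡ i′ → ∀ {j} → M i j ≡ true → M i′ j ≡ true
      at0 refl c = c

      after⁺ : ∀ i i′ j → i < m → m ≤ i′ → M⁺ V i′ j ≡ true → M⁺ V i j ≡ true
      after⁺ i i′ j i< m≤ c with m≤n⇒m<n∨m≡n m≤
      ... | inj₁ m<i′ = at0 (sym (rot-< i<)) (after S (suc i) i′ j (s≤s i<) m<i′ (at0 (rot-> m<i′) c))
      ... | inj₂ refl = at0 (sym (rot-< i<)) (Movable.incl V (suc i) j (s≤s i<) (at0 (rot-≡ {m}) c))

      antit⁺ : ∀ i i′ j → m ≤ i → i ≤ i′ → M⁺ V i′ j ≡ true → M⁺ V i j ≡ true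
      antit⁺ i i′ j m≤i i≤ c with m≤n⇒m<n∨m≡n m≤i | m≤n⇒m<n∨m≡n i≤
      ... | _ | inj₂ refl = c
      ... | inj₁ m<i | inj₁ _ = at0 (sym (rot-> m<i)) (antit S i i′ j m<i i≤ (at0 (rot-> (≤-trans m<i i≤)) c))
      ... | inj₂ refl | inj₁ m<i′ = at0 (sym (rot-≡ {m})) (after S 0 i′ j (s≤s z≤n) m<i′ (at0 (rot-> m<i′) c))

    Sorted-M⁺ : Sorted w h (M⁺ V) m
    Sorted-M⁺ = record
      { box = λ i j c → subst (_< w) (unrot-rot i) (unrot-mono m<w (proj₁ (box S (rot m i) j c))) , proj₂ (box S (rot m i) j c)
      ; convex = λ i → convex S (rot m i)
      ; rowConvex = λ i₁ i i₂ j i₂< c₁ c₂ l₁ l₂ → at0 (sym (rot-< (≤-<-trans l₂ i₂<)))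
          (rowConvex S (suc i₁) (suc i) (suc i₂) j (s≤s i₂<) (at0 (rot-< (≤-<-trans (≤-trans l₁ l₂) i₂<)) c₁)
            (at0 (rot-< i₂<) c₂) (s≤s l₁) (s≤s l₂))
      ; nested = nested⁺
      ; after = after⁺
      ; antit = antit⁺ }
      where
      nested⁺ : ∀ i i′ → i < m → i′ < m → (∀ j → M⁺ V i j ≡ true → M⁺ V i′ j ≡ true) ⊎ (∀ j → M⁺ V i′ j ≡ true → M⁺ V i j ≡ true)
      nested⁺ i i′ i< i′< with nested S (suc i) (suc i′) (s≤s i<) (s≤s i′<)
      ... | inj₁ f = inj₁ (λ j c → at0 (sym (rot-< i′<)) (f j (at0 (rot-< i<) c)))
      ... | inj₂ f = inj₂ (λ j c → at0 (sym (rot-< i<)) (f j (at0 (rot-< i′<) c)))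

  last-Sorted : (∀ j → M m j ≡ true → M 0 j ≡ true) → Sorted w h M m
  last-Sorted ⊆ = record
    { box = box S ; convex = convex S
    ; rowConvex = λ i₁ i i₂ j l → rowConvex S i₁ i i₂ j (m≤n⇒m≤1+n l)
    ; nested = λ i i′ l l′ → nested S i i′ (m≤n⇒m≤1+n l) (m≤n⇒m≤1+n l′)
    ; after = after′
    ; antit = antit′ }
    where
    after′ : ∀ i i′ j → i < m → m ≤ i′ → M i′ j ≡ true → M i j ≡ true
    after′ i i′ j i< m≤ c with m≤n⇒m<n∨m≡n m≤
    ... | inj₁ m<i′ = after S i i′ j (m≤n⇒m≤1+n i<) m<i′ c
    ... | inj₂ refl = rowConvex S 0 i m j ≤-refl (⊆ j c) c z≤n (<⇒≤ i<)
    antit′ : ∀ i i′ j → m ≤ i → i ≤ i′ → M i′ j ≡ true → M i j ≡ true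
    antit′ i i′ j m≤i i≤ c with m≤n⇒m<n∨m≡n m≤i | m≤n⇒m<n∨m≡n i≤
    ... | _ | inj₂ refl = c
    ... | inj₁ m<i | inj₁ _ = antit S i i′ j m<i i≤ c
    ... | inj₂ refl | inj₁ m<i′ = after S m i′ j ≤-refl m<i′ c

-- The smaller of the columns 0 and `m` is contained in all columns between them, by row convexity.
-- So it can be settled at position `m`, where it stands already or to which it is moved, and `m`
-- columns remain.
sort : ∀ {w h} n {M} → n ≤ w → Sorted w h M n → Sorting w h M
sort zero {M} n≤ S = record { N = M ; sorted = S ; sameSize = λ _ _ → SameSize-refl ; sameSum = λ _ → refl }
sort {w} (suc m) {M} m<w S with nested S 0 m (s≤s z≤n) ≤-refl
... | inj₂ ⊇ = sort m (<⇒≤ m<w) (last-Sorted m<w S ⊇)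
... | inj₁ ⊆ with first-Movable m<w S ⊆
...   | a , b , b≤h , V with sort m (<⇒≤ m<w) (Sorted-M⁺ m<w S V)
...     | T = record
  { N = N T ; sorted = sorted T
  ; sameSize = λ l r → SameSize-trans (move-SameSize V m<w b≤h l r) (sameSize T l r)
  ; sameSum = λ φ → trans (sameSum T φ) (sumTo-extend w m<w (sumTo-rot m (λ i → φ (M i))) (λ i m<i → cong (λ i → φ (M i)) (rot-> m<i))) }

antitone-count : ∀ w (c : ℕ → Bool) → (∀ i i′ → i ≤ i′ → c i′ ≡ true → c i ≡ true) → (∀ i → c i ≡ true → i < w) →
  ∀ i → (c i ≡ true → i < sumTo w (λ i → b2n (c i))) × (i < sumTo w (λ i → b2n (c i)) → c i ≡ true)
antitone-count zero c anti bd i = (λ ci → ⊥-elim (n≮0 (bd i ci))) , λ ()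
antitone-count (suc w) c anti bd with c w in eq
... | true = λ i → (λ ci → subst (i <_) (sym total) (bd i ci)) , (λ l → all i (subst (i <_) total l))
  where
  all : ∀ i → i < suc w → c i ≡ true
  all i l = anti i w (≤-pred l) eq
  ones : ∀ n → n ≤ w → sumTo n (λ i → b2n (c i)) ≡ n
  ones zero _ = refl
  ones (suc n) n< = trans (cong₂ _+_ (ones n (<⇒≤ n<)) (cong b2n (all n (m≤n⇒m≤1+n n<)))) (+-comm n 1)
  total : sumTo w (λ i → b2n (c i)) + 1 ≡ suc w
  total = trans (cong (_+ 1) (ones w ≤-refl)) (+-comm w 1)
... | false rewrite +-identityʳ (sumTo w (λ i → b2n (c i))) = antitone-count w c anti bd′
  where
  bd′ : ∀ i → c i ≡ true → i < w
  bd′ i ci with m≤n⇒m<n∨m≡n (≤-pred (bd i ci))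
  ... | inj₁ l = l
  ... | inj₂ refl with () ← trans (sym eq) ci

rowLength : ℕ → Cells → ℕ → ℕ
rowLength w M j = sumTo w (λ i → b2n (M i j))

-- All columns sorted by size, the largest first.
canonical : ℕ → Cells → Cells
canonical w M i j = i <ᵇ rowLength w M j

≡true⇔ : ∀ {x y : Bool} → (x ≡ true → y ≡ true) → (y ≡ true → x ≡ true) → x ≡ y
≡true⇔ {true}  f g = sym (f refl)
≡true⇔ {false} {true}  f g = g refl
≡true⇔ {false} {false} f g = refl

<ᵇ-true : ∀ {m n} → m < n → (m <ᵇ n) ≡ true
<ᵇ-true {zero}  (s≤s _) = refl
<ᵇ-true {suc m} (s≤s l) = <ᵇ-true l

true-<ᵇ : ∀ {m n} → (m <ᵇ n) ≡ true → m < n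
true-<ᵇ {zero}  {suc n} _ = s≤s z≤n
true-<ᵇ {suc m} {suc n} e = s≤s (true-<ᵇ e)

module _ {w h M} (S : Sorting w h M) where

  N-canonical : ∀ i j → N S i j ≡ canonical w M i j
  N-canonical i j = ≡true⇔
    (λ c → <ᵇ-true (subst (i <_) (sameSum S (λ c → b2n (c j))) (proj₁ count c)))
    (λ e → proj₂ count (subst (i <_) (sym (sameSum S (λ c → b2n (c j)))) (true-<ᵇ e)))
    where
    count = antitone-count w (λ i → N S i j) (λ i i′ l → antit (sorted S) i i′ j z≤n l) (λ i c → proj₁ (box (sorted S) i j c)) i

HasChain-resp : ∀ {M M′ X k} → (∀ i j → M i j ≡ M′ i j) → HasChain M X k → HasChain M′ X k
HasChain-resp e (chainIn p q R C) = chainIn p q (λ i j a b c d → trans (sym (e i j)) (R i j a b c d)) C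

NFilling-resp : ∀ {w h M M′ l r F} → (∀ i j → M i j ≡ M′ i j) → NFilling w h M l r F → NFilling w h M′ l r F
NFilling-resp e (nfilling s (c , bd) u) = nfilling (λ i j p → trans (sym (e i j)) (s i j p))
  (HasChain-resp e c , λ k c → bd k (HasChain-resp (λ i j → sym (e i j)) c)) u

canonical-SameSize : ∀ {w h M} → Sorting w h M → ∀ l r → SameSize (NFilling w h M l r) (NFilling w h (canonical w M) l r)
canonical-SameSize S l r = SameSize-trans (sameSize S l r) (SameSize-⇔
  (λ F → NFilling-resp (N-canonical S)) (λ F → NFilling-resp (λ i j → sym (N-canonical S i j))))

-- From finite boxes to cells with natural coordinates

hat : ∀ {w h} → Poly w h → Cells
hat {w} {h} M i j with i <? w | j <? h
... | yes p | yes q = M (fromℕ< p) (fromℕ< q)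
... | yes _ | no  _ = false
... | no  _ | _     = false

module _ {w h : ℕ} (M : Poly w h) where

  hat-fromℕ< : ∀ {i j} (p : i < w) (q : j < h) → hat M i j ≡ M (fromℕ< p) (fromℕ< q)
  hat-fromℕ< {i} {j} p q with i <? w | j <? h
  ... | yes p′ | yes q′ = cong₂ (λ p q → M (fromℕ< p) (fromℕ< q)) (≤-irrelevant p′ p) (≤-irrelevant q′ q)
  ... | yes _  | no ¬q = ⊥-elim (¬q q)
  ... | no ¬p  | _     = ⊥-elim (¬p p)

  hat-toℕ : ∀ i j → hat M (toℕ i) (toℕ j) ≡ M i j
  hat-toℕ i j = trans (hat-fromℕ< (toℕ<n i) (toℕ<n j)) (cong₂ M (fromℕ<-toℕ i (toℕ<n i)) (fromℕ<-toℕ j (toℕ<n j)))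

  hat-box : ∀ i j → hat M i j ≡ true → i < w × j < h
  hat-box i j c with i <? w | j <? h
  ... | yes p | yes q = p , q

  hat-cell : ∀ i j → hat M i j ≡ true → Σ (i < w) λ p → Σ (j < h) λ q → M (fromℕ< p) (fromℕ< q) ≡ true
  hat-cell i j c = let p , q = hat-box i j c in p , q , trans (sym (hat-fromℕ< p q)) c

  moon-Sorted : IsMoon M → Sorted w h (hat M) w
  moon-Sorted ((col , row) , nest) = record
    { box = hat-box
    ; convex = colConvexHat
    ; rowConvex = λ i₁ i i₂ j _ → rowConvexHat i₁ i i₂ j
    ; nested = nestedHat
    ; after = λ i i′ j _ w≤ c → ⊥-elim (<⇒≱ (proj₁ (hat-box i′ j c)) w≤)
    ; antit = λ i i′ j w≤ i≤ c → ⊥-elim (<⇒≱ (proj₁ (hat-box i′ j c)) (≤-trans w≤ i≤)) }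
    where
    leF : ∀ {m n k} (p : m < k) (q : n < k) → m ≤ n → toℕ (fromℕ< p) ≤ toℕ (fromℕ< q)
    leF p q = subst₂ _≤_ (sym (toℕ-fromℕ< p)) (sym (toℕ-fromℕ< q))
    colConvexHat : ∀ i j₁ j j₂ → hat M i j₁ ≡ true → hat M i j₂ ≡ true → j₁ ≤ j → j ≤ j₂ → hat M i j ≡ true
    colConvexHat i j₁ j j₂ c₁ c₂ l₁ l₂ with hat-box i j₁ c₁ | hat-box i j₂ c₂
    ... | p , q₁ | _ , q₂ = let q = ≤-<-trans l₂ q₂ in trans (hat-fromℕ< p q)
      (col (fromℕ< p) (fromℕ< q₁) (fromℕ< q) (fromℕ< q₂) (trans (sym (hat-fromℕ< p q₁)) c₁) (trans (sym (hat-fromℕ< p q₂)) c₂)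
        (leF q₁ q l₁) (leF q q₂ l₂))
    rowConvexHat : ∀ i₁ i i₂ j → hat M i₁ j ≡ true → hat M i₂ j ≡ true → i₁ ≤ i → i ≤ i₂ → hat M i j ≡ true
    rowConvexHat i₁ i i₂ j c₁ c₂ l₁ l₂ with hat-box i₁ j c₁ | hat-box i₂ j c₂
    ... | p₁ , q | p₂ , _ = let p = ≤-<-trans l₂ p₂ in trans (hat-fromℕ< p q)
      (row (fromℕ< q) (fromℕ< p₁) (fromℕ< p) (fromℕ< p₂) (trans (sym (hat-fromℕ< p₁ q)) c₁) (trans (sym (hat-fromℕ< p₂ q)) c₂)
        (leF p₁ p l₁) (leF p p₂ l₂))
    sub : ∀ {i i′} (p : i < w) (p′ : i′ < w) → (∀ j → Cell M (fromℕ< p) j → Cell M (fromℕ< p′) j) →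
      ∀ j → hat M i j ≡ true → hat M i′ j ≡ true
    sub {i} p p′ f j c = let q = proj₂ (hat-box i j c) in
      trans (hat-fromℕ< p′ q) (f (fromℕ< q) (trans (sym (hat-fromℕ< p q)) c))
    nestedHat : ∀ i i′ → i < w → i′ < w → (∀ j → hat M i j ≡ true → hat M i′ j ≡ true) ⊎ (∀ j → hat M i′ j ≡ true → hat M i j ≡ true)
    nestedHat i i′ p p′ with nest (fromℕ< p) (fromℕ< p′)
    ... | inj₁ f = inj₁ (sub p p′ f)
    ... | inj₂ f = inj₂ (sub p′ p f)

-- The region is kept abstract so that it can be the set of ones of `F` or the positive entries of
-- an ℕ-filling with support `F`.
module _ {w h : ℕ} {M : Poly w h} {F : Matrix w h} {X : Region}
  (X⇒ : ∀ i j → X (toℕ i) (toℕ j) → entry F i j ≡ true)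
  (⇒X : ∀ i j → entry F i j ≡ true → X (toℕ i) (toℕ j)) where

  private
    build : ∀ {k i₀ i₁ j₀ j₁} (cs : Vec (Fin w × Fin h) k) → IsNE cs →
      (∀ p → entry F (proj₁ (lookup cs p)) (proj₂ (lookup cs p)) ≡ true) →
      (∀ p → i₀ ≤ toℕ (proj₁ (lookup cs p)) × toℕ (proj₁ (lookup cs p)) < i₁) →
      (∀ p → j₀ ≤ toℕ (proj₂ (lookup cs p)) × toℕ (proj₂ (lookup cs p)) < j₁) → Chain X k i₀ i₁ j₀ j₁
    build []             ne e bi bj = []
    build ((a , b) ∷ cs) ne e bi bj = cons (toℕ a) (toℕ b) (proj₁ (bi zero)) (proj₂ (bi zero)) (proj₁ (bj zero)) (proj₂ (bj zero))
      (⇒X a b (e zero)) (build cs (λ p q l → ne (suc p) (suc q) (s≤s l)) (λ p → e (suc p))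
        (λ p → proj₁ (ne zero (suc p) (s≤s z≤n)) , proj₂ (bi (suc p)))
        (λ p → proj₂ (ne zero (suc p) (s≤s z≤n)) , proj₂ (bj (suc p))))

    mono : ∀ {k} (cs : Vec (Fin w × Fin h) k) → IsNE cs → ∀ p q → toℕ p ≤ toℕ q →
      toℕ (proj₁ (lookup cs p)) ≤ toℕ (proj₁ (lookup cs q)) × toℕ (proj₂ (lookup cs p)) ≤ toℕ (proj₂ (lookup cs q))
    mono cs ne p q l with m≤n⇒m<n∨m≡n l
    ... | inj₁ l′ = <⇒≤ (proj₁ (ne p q l′)) , <⇒≤ (proj₂ (ne p q l′))
    ... | inj₂ e rewrite toℕ-injective e = ≤-refl , ≤-refl

  -- A ne-chain is monotone in both coordinates, so its smallest rectangle is spanned by its first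
  -- and its last cell.
  NEChain⇒ : ∀ k → NEChain M F k → HasChain (hat M) X k
  NEChain⇒ zero _ = chainIn {i₀ = 0} {0} {0} {0} z≤n z≤n (λ _ _ _ ()) []
  NEChain⇒ (suc k) (cs , (e , rect) , ne) = chainIn (≤-trans (proj₁ (first last)) (n≤1+n _)) (≤-trans (proj₂ (first last)) (n≤1+n _)) R
    (build cs ne e (λ p → proj₁ (first p) , s≤s (proj₁ (final p))) (λ p → proj₂ (first p) , s≤s (proj₂ (final p))))
    where
    last = fromℕ k
    first : ∀ p → toℕ (proj₁ (lookup cs zero)) ≤ toℕ (proj₁ (lookup cs p)) × toℕ (proj₂ (lookup cs zero)) ≤ toℕ (proj₂ (lookup cs p))
    first p = mono cs ne zero p z≤n
    final : ∀ p → toℕ (proj₁ (lookup cs p)) ≤ toℕ (proj₁ (lookup cs last)) × toℕ (proj₂ (lookup cs p)) ≤ toℕ (proj₂ (lookup cs last))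
    final p = mono cs ne p last (subst (toℕ p ≤_) (sym (toℕ-fromℕ k)) (≤-pred (toℕ<n p)))
    R : Rect (hat M) (toℕ (proj₁ (lookup cs zero))) (suc (toℕ (proj₁ (lookup cs last))))
                     (toℕ (proj₂ (lookup cs zero))) (suc (toℕ (proj₂ (lookup cs last))))
    R i j i₀≤ i< j₀≤ j< = trans (hat-fromℕ< M pi pj) (rect (fromℕ< pi) (fromℕ< pj)
        (zero , last , subst (_ ≤_) (sym (toℕ-fromℕ< pi)) i₀≤ , subst (_≤ toℕ (proj₁ (lookup cs last))) (sym (toℕ-fromℕ< pi)) (≤-pred i<))
        (zero , last , subst (_ ≤_) (sym (toℕ-fromℕ< pj)) j₀≤ , subst (_≤ toℕ (proj₂ (lookup cs last))) (sym (toℕ-fromℕ< pj)) (≤-pred j<)))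
      where
      pi = <-≤-trans i< (toℕ<n (proj₁ (lookup cs last)))
      pj = <-≤-trans j< (toℕ<n (proj₂ (lookup cs last)))

  private
    cells : ∀ {k i₀ i₁ j₀ j₁} → (∀ i j → i₀ ≤ i → i < i₁ → j₀ ≤ j → j < j₁ → i < w × j < h) → Chain X k i₀ i₁ j₀ j₁ →
      Σ (Vec (Fin w × Fin h) k) λ cs → IsNE cs ×
      (∀ p → entry F (proj₁ (lookup cs p)) (proj₂ (lookup cs p)) ≡ true) ×
      (∀ p → (i₀ ≤ toℕ (proj₁ (lookup cs p)) × toℕ (proj₁ (lookup cs p)) < i₁) ×
             (j₀ ≤ toℕ (proj₂ (lookup cs p)) × toℕ (proj₂ (lookup cs p)) < j₁))
    cells bd [] = [] , (λ ()) , (λ ()) , (λ ())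
    cells {i₀ = i₀} {i₁} {j₀} {j₁} bd (cons i j p q r s x C)
      with bd i j p q r s | cells (λ i′ j′ p′ q′ r′ s′ → bd i′ j′ (≤-trans p (<⇒≤ p′)) q′ (≤-trans r (<⇒≤ r′)) s′) C
    ... | i<w , j<h | cs , ne , e , b = (fi , fj) ∷ cs , ne′ , e′ , b′
      where
      fi = fromℕ< i<w
      fj = fromℕ< j<h
      ti = toℕ-fromℕ< i<w
      tj = toℕ-fromℕ< j<h
      ne′ : IsNE ((fi , fj) ∷ cs)
      ne′ zero    (suc v) _ = subst (_< _) (sym ti) (proj₁ (proj₁ (b v))) , subst (_< _) (sym tj) (proj₁ (proj₂ (b v)))
      ne′ (suc u) (suc v) (s≤s l) = ne u v l
      e′ : ∀ v → entry F (proj₁ (lookup ((fi , fj) ∷ cs) v)) (proj₂ (lookup ((fi , fj) ∷ cs) v)) ≡ true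
      e′ zero    = X⇒ fi fj (subst₂ X (sym ti) (sym tj) x)
      e′ (suc v) = e v
      b′ : ∀ v → (i₀ ≤ toℕ (proj₁ (lookup ((fi , fj) ∷ cs) v)) × toℕ (proj₁ (lookup ((fi , fj) ∷ cs) v)) < i₁) ×
                 (j₀ ≤ toℕ (proj₂ (lookup ((fi , fj) ∷ cs) v)) × toℕ (proj₂ (lookup ((fi , fj) ∷ cs) v)) < j₁)
      b′ zero    = (subst (i₀ ≤_) (sym ti) p , subst (_< i₁) (sym ti) q) , (subst (j₀ ≤_) (sym tj) r , subst (_< j₁) (sym tj) s)
      b′ (suc v) = (≤-trans p (<⇒≤ (proj₁ (proj₁ (b v)))) , proj₂ (proj₁ (b v))) , (≤-trans r (<⇒≤ (proj₁ (proj₂ (b v)))) , proj₂ (proj₂ (b v)))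

  ⇒NEChain : ∀ k → HasChain (hat M) X k → NEChain M F k
  ⇒NEChain k (chainIn _ _ R C) with cells (λ i j a b c d → hat-box M i j (R i j a b c d)) C
  ... | cs , ne , e , b = cs , (e , rect) , ne
    where
    rect : ∀ x y → (∃[ p ] ∃[ q ] (proj₁ (lookup cs p) ≤ᶠ x × x ≤ᶠ proj₁ (lookup cs q))) →
      (∃[ p ] ∃[ q ] (proj₂ (lookup cs p) ≤ᶠ y × y ≤ᶠ proj₂ (lookup cs q))) → M x y ≡ true
    rect x y (p , q , l , u) (p′ , q′ , l′ , u′) = trans (sym (hat-toℕ M x y)) (R (toℕ x) (toℕ y)
      (≤-trans (proj₁ (proj₁ (b p))) l) (≤-<-trans u (proj₂ (proj₁ (b q))))
      (≤-trans (proj₁ (proj₂ (b p′))) l′) (≤-<-trans u′ (proj₂ (proj₂ (b q′)))))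

  LongestNE⇒ : ∀ l → LongestNE M F l → Longest (hat M) X l
  LongestNE⇒ l (c , bd) = NEChain⇒ l c , λ k c → bd k (⇒NEChain k c)

  ⇒LongestNE : ∀ l → Longest (hat M) X l → LongestNE M F l
  ⇒LongestNE l (c , bd) = ⇒NEChain l c , λ k c → bd k (NEChain⇒ k c)

-- Deciding the length of the longest chain

chain-shorten : ∀ {X k k′ i₀ i₁ j₀ j₁} → k′ ≤ k → Chain X k i₀ i₁ j₀ j₁ → Chain X k′ i₀ i₁ j₀ j₁
chain-shorten {k′ = zero}   l C = []
chain-shorten {k′ = suc k′} (s≤s l) (cons i j p q r s x C) = cons i j p q r s x (chain-shorten l C)

Ones : ∀ {w h} → Matrix w h → Region
Ones F i j = hat (entry F) i j ≡ true

ones⇒ : ∀ {w h} (F : Matrix w h) i j → Ones F (toℕ i) (toℕ j) → entry F i j ≡ true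
ones⇒ F i j = trans (sym (hat-toℕ (entry F) i j))

⇒ones : ∀ {w h} (F : Matrix w h) i j → entry F i j ≡ true → Ones F (toℕ i) (toℕ j)
⇒ones F i j = trans (hat-toℕ (entry F) i j)

module _ {w h : ℕ} (M : Poly w h) where

  isFilling? : Decidable (IsFilling M)
  isFilling? F = all? λ i → all? λ j → (entry F i j B.≟ true) →-dec (M i j B.≟ true)

  private
    anyVec : ∀ {k} {P : Vec (Fin w × Fin h) k → Set} → (∀ v → Dec (P v)) → Dec (∃ P)
    anyVec {zero} P? = map′ (λ p → [] , p) (λ { ([] , p) → p }) (P? [])
    anyVec {suc k} P? = map′ (λ { (i , j , v , p) → (i , j) ∷ v , p }) (λ { ((i , j) ∷ v , p) → i , j , v , p })
      (any? λ i → any? λ j → anyVec λ v → P? ((i , j) ∷ v))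

  neChain? : ∀ F k → Dec (NEChain M F k)
  neChain? F k = anyVec λ cs →
    ((all? λ p → entry F _ _ B.≟ true) ×-dec
     (all? λ a → all? λ b →
       (any? λ p → any? λ q → (_ F.≤? a) ×-dec (a F.≤? _)) →-dec
       ((any? λ p → any? λ q → (_ F.≤? b) ×-dec (b F.≤? _)) →-dec (M a b B.≟ true)))) ×-dec
    (all? λ p → all? λ q → (toℕ p <? toℕ q) →-dec ((_ F.<? _) ×-dec (_ F.<? _)))

  -- Chains can be shortened within their rectangle, so maximality of `l` need only be tested at
  -- length `suc l`.
  longestNE? : ∀ l → Decidable (λ F → LongestNE M F l)
  longestNE? l F = map′ (λ { (c , ¬c) → c , λ k c′ → ≮⇒≥ (λ l<k → ¬c (shorten l<k c′)) })
    (λ { (c , bd) → c , λ c′ → <-irrefl refl (bd (suc l) c′) }) (neChain? F l ×-dec ¬? (neChain? F (suc l)))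
    where
    open import Relation.Nullary.Decidable using (¬?)
    shorten : ∀ {k k′} → k′ ≤ k → NEChain M F k → NEChain M F k′
    shorten {k} {k′} le c with NEChain⇒ {F = F} {X = Ones F} (ones⇒ F) (⇒ones F) k c
    ... | chainIn a b R C = ⇒NEChain {F = F} {X = Ones F} (ones⇒ F) (⇒ones F) k′ (chainIn a b R (chain-shorten le C))

-- From fillings with natural numbers to 0-1-fillings

record Enumeration {A : Set} (P : A → Set) : Set where
  field
    list     : List A
    unique   : Unique list
    complete : ∀ x → P x → x ∈ list
    sound    : ∀ x → x ∈ list → P x

open Enumeration

lookup-injective : ∀ {A : Set} {xs : List A} → Unique xs → ∀ i j → L.lookup xs i ≡ L.lookup xs j → i ≡ j
lookup-injective (px ∷ u) zero    zero    e = refl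
lookup-injective {xs = _ ∷ xs} (px ∷ u) zero    (suc j) e = ⊥-elim (All.lookup px (∈-lookup {xs = xs} j) e)
lookup-injective {xs = _ ∷ xs} (px ∷ u) (suc i) zero    e = ⊥-elim (All.lookup px (∈-lookup {xs = xs} i) (sym e))
lookup-injective (px ∷ u) (suc i) (suc j) e = cong suc (lookup-injective u i j e)

module _ {A B : Set} {P : A → Set} {Q : B → Set} (p : Enumeration P) (q : Enumeration Q) where

  length-≤ : SameSize P Q → length (list p) ≤ length (list q)
  length-≤ (f , g , pf , pg , gf , fg) = injective⇒≤ {f = h} h-inj
    where
    x : Fin (length (list p)) → A
    x = L.lookup (list p)
    Px : ∀ i → P (x i)
    Px i = sound p (x i) (∈-lookup {xs = list p} i)
    m : ∀ i → f (x i) ∈ list q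
    m i = complete q (f (x i)) (pf (x i) (Px i))
    h : Fin (length (list p)) → Fin (length (list q))
    h i = index (m i)
    h-inj : ∀ {i j} → h i ≡ h j → i ≡ j
    h-inj {i} {j} e = lookup-injective (unique p) i j (trans (sym (gf (x i) (Px i)))
      (trans (cong g (MS.index-injective (setoid B) (m i) (m j) e)) (gf (x j) (Px j))))

length-≡ : ∀ {A B : Set} {P : A → Set} {Q : B → Set} (p : Enumeration P) (q : Enumeration Q) →
  SameSize P Q → length (list p) ≡ length (list q)
length-≡ p q s = ≤-antisym (length-≤ p q s) (length-≤ q p (SameSize-sym s))

module _ {A B : Set} (_≟ᴬ_ : DecidableEquality A) (b : B) where
  -- Matches two lists by position. `SameSize` asks for total functions, hence the default value `b`
  -- for elements outside the list.
  send : List A → List B → A → B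
  send (x ∷ xs) (y ∷ ys) a with a ≟ᴬ x
  ... | yes _ = y
  ... | no  _ = send xs ys a
  send _        _        a = b

  send-∈ : ∀ xs ys → length xs ≡ length ys → ∀ {a} → a ∈ xs → send xs ys a ∈ ys
  send-∈ (x ∷ xs) (y ∷ ys) e {a} m with a ≟ᴬ x
  send-∈ (x ∷ xs) (y ∷ ys) e m           | yes _   = here refl
  send-∈ (x ∷ xs) (y ∷ ys) e (here a≡x)  | no a≢x  = ⊥-elim (a≢x a≡x)
  send-∈ (x ∷ xs) (y ∷ ys) e (there m)   | no _    = there (send-∈ xs ys (cong pred e) m)

module _ {A B : Set} (_≟ᴬ_ : DecidableEquality A) (_≟ᴮ_ : DecidableEquality B) (a₀ : A) (b₀ : B) where
  send-send : ∀ xs ys → Unique ys → length xs ≡ length ys → ∀ {a} → a ∈ xs →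
    send _≟ᴮ_ a₀ ys xs (send _≟ᴬ_ b₀ xs ys a) ≡ a
  send-send (x ∷ xs) (y ∷ ys) (py ∷ u) e {a} m with a ≟ᴬ x
  send-send (x ∷ xs) (y ∷ ys) (py ∷ u) e m | yes a≡x with y ≟ᴮ y
  ... | yes _ = sym a≡x
  ... | no y≢y = ⊥-elim (y≢y refl)
  send-send (x ∷ xs) (y ∷ ys) (py ∷ u) e (here a≡x) | no a≢x = ⊥-elim (a≢x a≡x)
  send-send (x ∷ xs) (y ∷ ys) (py ∷ u) e {a} (there m) | no a≢x with send _≟ᴬ_ b₀ xs ys a ≟ᴮ y
  ... | yes e′ = ⊥-elim (All.lookup py (send-∈ _≟ᴬ_ b₀ xs ys (cong pred e) m) (sym e′))
  ... | no _ = send-send xs ys u (cong pred e) m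

module _ {A B : Set} (_≟ᴬ_ : DecidableEquality A) (_≟ᴮ_ : DecidableEquality B) (a₀ : A) (b₀ : B)
  {P : A → Set} {Q : B → Set} (p : Enumeration P) (q : Enumeration Q) where

  length-SameSize : length (list p) ≡ length (list q) → SameSize P Q
  length-SameSize e = send _≟ᴬ_ b₀ (list p) (list q) , send _≟ᴮ_ a₀ (list q) (list p)
    , (λ x Px → sound q _ (send-∈ _≟ᴬ_ b₀ (list p) (list q) e (complete p x Px)))
    , (λ y Qy → sound p _ (send-∈ _≟ᴮ_ a₀ (list q) (list p) (sym e) (complete q y Qy)))
    , (λ x Px → send-send _≟ᴬ_ _≟ᴮ_ a₀ b₀ (list p) (list q) (unique q) e (complete p x Px))
    , (λ y Qy → send-send _≟ᴮ_ _≟ᴬ_ b₀ a₀ (list q) (list p) (unique p) (sym e) (complete q y Qy))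

module _ {A : Set} {P E : A → Set} (E? : Decidable E) (p : Enumeration P) where
  restrict : Enumeration (λ x → P x × E x)
  restrict .list = filter E? (list p)
  restrict .unique = U.filter⁺ E? (unique p)
  restrict .complete x (Px , Ex) = ∈-filter⁺ E? (complete p x Px) Ex
  restrict .sound x m = let m′ , Ex = ∈-filter⁻ E? {xs = list p} m in sound p x m′ , Ex

length-filter : ∀ {A : Set} {E : A → Set} (E? : Decidable E) xs →
  length xs ≡ length (filter E? xs) + length (filter (λ x → ¬? (E? x)) xs)
length-filter E? [] = refl
length-filter E? (x ∷ xs) with E? x
... | yes _ = cong suc (length-filter E? xs)
... | no _  = trans (cong suc (length-filter E? xs)) (sym (+-suc _ _))

-- A bijection of complements cannot simply be subtracted from a bijection of the whole sets, so the
-- difference is taken between numbers and turned back into a bijection through enumerations.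
SameSize-cancel : ∀ {A : Set} → DecidableEquality A → A → ∀ {P Q E F : A → Set} →
  Enumeration P → Enumeration Q → Decidable E → Decidable F → SameSize P Q →
  SameSize (λ x → P x × ¬ E x) (λ x → Q x × ¬ F x) → SameSize (λ x → P x × E x) (λ x → Q x × F x)
SameSize-cancel _≟ᴬ_ a p q E? F? s s′ = length-SameSize _≟ᴬ_ _≟ᴬ_ a a (restrict E? p) (restrict F? q)
  (+-cancelʳ-≡ (length (filter (λ x → ¬? (E? x)) (list p))) _ _ (begin
    _                ≡⟨ length-filter E? (list p) ⟨
    length (list p)  ≡⟨ length-≡ p q s ⟩
    length (list q)  ≡⟨ length-filter F? (list q) ⟩
    _                ≡⟨ cong (length (filter F? (list q)) +_) (length-≡ (restrict (λ x → ¬? (E? x)) p) (restrict (λ x → ¬? (F? x)) q) s′) ⟨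
    _                ∎))
  where open ≡-Reasoning

-- Enumerating matrices with bounded entries

allVec : ∀ {A : Set} → List A → ∀ n → List (Vec A n)
allVec xs zero    = [] ∷ []
allVec xs (suc n) = cartesianProductWith _∷_ xs (allVec xs n)

∈-allVec : ∀ {A : Set} (xs : List A) {n} (v : Vec A n) → (∀ i → lookup v i ∈ xs) → v ∈ allVec xs n
∈-allVec xs []      m = here refl
∈-allVec xs (x ∷ v) m = ∈-cartesianProductWith⁺ _∷_ (m zero) (∈-allVec xs v (λ i → m (suc i)))

lookup-≤-sum : ∀ {n} (v : Vec ℕ n) i → lookup v i ≤ V.sum v
lookup-≤-sum (x ∷ v) zero    = m≤m+n x _
lookup-≤-sum (x ∷ v) (suc i) = ≤-trans (lookup-≤-sum v i) (m≤n+m _ x)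

module _ {w h : ℕ} where

  _≟ᴹ_ : DecidableEquality (NMatrix w h)
  _≟ᴹ_ = VP.≡-dec (VP.≡-dec _≟_)

  enumerate : ∀ {P : NMatrix w h → Set} → Decidable P → ∀ b → (∀ A → P A → ∀ i j → lookup (lookup A j) i ≤ b) → Enumeration P
  enumerate P? b bd = restrict′
    where
    every : List (NMatrix w h)
    every = deduplicate _≟ᴹ_ (allVec (allVec (upTo (suc b)) w) h)
    restrict′ : Enumeration _
    restrict′ .list = filter P? every
    restrict′ .unique = U.filter⁺ P? (UD.deduplicate-! _≟ᴹ_ (allVec (allVec (upTo (suc b)) w) h))
    restrict′ .complete A PA = ∈-filter⁺ P? (∈-deduplicate⁺ _≟ᴹ_
      (∈-allVec _ A (λ j → ∈-allVec _ (lookup A j) (λ i → ∈-upTo⁺ (s≤s (bd A PA i j)))))) PA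
    restrict′ .sound A m = proj₂ (∈-filter⁻ P? {xs = every} m)

vec-ext : ∀ {A : Set} {n} (u v : Vec A n) → (∀ i → lookup u i ≡ lookup v i) → u ≡ v
vec-ext u v e = trans (sym (VP.tabulate∘lookup u)) (trans (VP.tabulate-cong e) (VP.tabulate∘lookup v))

-- Splitting a filling into its support and its excess

positive : ℕ → Bool
positive zero    = false
positive (suc _) = true

ones : ∀ {n} → Vec Bool n → ℕ
ones []       = 0
ones (b ∷ bs) = b2n b + ones bs

-- A row is determined by its support and the list of its positive entries, each lowered by one.
encode : ∀ {n} → Vec ℕ n → List ℕ
encode []           = []
encode (zero  ∷ v)  = encode v
encode (suc e ∷ v)  = e ∷ encode v

decode : ∀ {n} → Vec Bool n → List ℕ → Vec ℕ n
decode []           es       = []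
decode (false ∷ bs) es       = 0 ∷ decode bs es
-- A list that is too short is continued by ones, so the support is right whatever the length of the
-- list.
decode (true  ∷ bs) []       = 1 ∷ decode bs []
decode (true  ∷ bs) (e ∷ es) = suc e ∷ decode bs es

decode-encode : ∀ {n} (v : Vec ℕ n) → decode (V.map positive v) (encode v) ≡ v
decode-encode []          = refl
decode-encode (zero  ∷ v) = cong (0 ∷_) (decode-encode v)
decode-encode (suc e ∷ v) = cong (suc e ∷_) (decode-encode v)

length-encode : ∀ {n} (v : Vec ℕ n) → length (encode v) ≡ ones (V.map positive v)
length-encode []          = refl
length-encode (zero  ∷ v) = length-encode v
length-encode (suc e ∷ v) = cong suc (length-encode v)

sum-encode : ∀ {n} (v : Vec ℕ n) → V.sum v ≡ ones (V.map positive v) + listSum (encode v)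
sum-encode []          = refl
sum-encode (zero  ∷ v) = sum-encode v
sum-encode (suc e ∷ v) = cong suc (trans (cong (e +_) (sum-encode v)) (trans (sym (+-assoc e _ _))
  (trans (cong (_+ listSum (encode v)) (+-comm e _)) (+-assoc (ones (V.map positive v)) e _))))

positive-decode : ∀ {n} (bs : Vec Bool n) es → V.map positive (decode bs es) ≡ bs
positive-decode []           es       = refl
positive-decode (false ∷ bs) es       = cong (false ∷_) (positive-decode bs es)
positive-decode (true  ∷ bs) []       = cong (true ∷_) (positive-decode bs [])
positive-decode (true  ∷ bs) (e ∷ es) = cong (true ∷_) (positive-decode bs es)

encode-decode : ∀ {n} (bs : Vec Bool n) es → length es ≡ ones bs → encode (decode bs es) ≡ es
encode-decode []           []       e = refl
encode-decode (false ∷ bs) es       e = encode-decode bs es e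
encode-decode (true  ∷ bs) (x ∷ es) e = cong (x ∷_) (encode-decode bs es (cong pred e))

sum-decode : ∀ {n} (bs : Vec Bool n) es → length es ≡ ones bs → V.sum (decode bs es) ≡ ones bs + listSum es
sum-decode bs es e = trans (sum-encode (decode bs es))
  (cong₂ _+_ (cong ones (positive-decode bs es)) (cong listSum (encode-decode bs es e)))

sum-replicate-0 : ∀ n → listSum (replicate n 0) ≡ 0
sum-replicate-0 zero    = refl
sum-replicate-0 (suc n) = sum-replicate-0 n

zero-sum : ∀ es → listSum es ≡ 0 → es ≡ replicate (length es) 0
zero-sum []       e = refl
zero-sum (x ∷ es) e = cong₂ _∷_ (m+n≡0⇒m≡0 x e) (zero-sum es (m+n≡0⇒n≡0 x e))

sum-< : ∀ {n} (s r : Vec ℕ n) → (∀ j → lookup s j ≤ lookup r j) → ¬ (∀ j → lookup s j ≡ lookup r j) → V.sum s < V.sum r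
sum-< []      []      le ne = ⊥-elim (ne (λ ()))
sum-< (x ∷ s) (y ∷ r) le ne with m≤n⇒m<n∨m≡n (le zero)
... | inj₁ x<y = +-mono-<-≤ x<y (sum-≤ s r (λ j → le (suc j)))
  where
  sum-≤ : ∀ {n} (s r : Vec ℕ n) → (∀ j → lookup s j ≤ lookup r j) → V.sum s ≤ V.sum r
  sum-≤ []      []      le = z≤n
  sum-≤ (x ∷ s) (y ∷ r) le = +-mono-≤ (le zero) (sum-≤ s r (λ j → le (suc j)))
... | inj₂ refl = +-monoʳ-< x (sum-< s r (λ j → le (suc j)) (λ e → ne λ { zero → refl ; (suc j) → e j }))

get-lookup : ∀ {A : Set} {d : A} {n} (v : Vec A n) i → get d v (toℕ i) ≡ lookup v i
get-lookup (x ∷ v) zero    = refl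
get-lookup (x ∷ v) (suc i) = get-lookup v i

sum-get : ∀ {n} (v : Vec ℕ n) → sumTo n (get 0 v) ≡ V.sum v
sum-get [] = refl
sum-get {suc n} (x ∷ v) = trans (sumTo-suc n (get 0 (x ∷ v))) (cong (x +_) (sum-get v))

module _ {w h : ℕ} where

  at-lookup : ∀ (A : NMatrix w h) i j → at A (toℕ i) (toℕ j) ≡ lookup (lookup A j) i
  at-lookup A i j = trans (cong (λ v → get 0 v (toℕ i)) (get-lookup A j)) (get-lookup (lookup A j) i)

  supp : NMatrix w h → Matrix w h
  supp A = tabulate λ i → tabulate λ j → positive (lookup (lookup A j) i)

  entry-supp : ∀ A i j → entry (supp A) i j ≡ positive (lookup (lookup A j) i)
  entry-supp A i j = trans (cong (λ v → lookup v j) (VP.lookup∘tabulate _ i)) (VP.lookup∘tabulate _ j)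

  Positive⇒entry : ∀ A i j → Positive (at A) (toℕ i) (toℕ j) → entry (supp A) i j ≡ true
  Positive⇒entry A i j p = trans (entry-supp A i j) (go _ (subst (0 <_) (at-lookup A i j) p))
    where
    go : ∀ n → 0 < n → positive n ≡ true
    go (suc n) _ = refl

  entry⇒Positive : ∀ A i j → entry (supp A) i j ≡ true → Positive (at A) (toℕ i) (toℕ j)
  entry⇒Positive A i j p = subst (0 <_) (sym (at-lookup A i j)) (go _ (trans (sym (entry-supp A i j)) p))
    where
    go : ∀ n → positive n ≡ true → 0 < n
    go (suc n) _ = s≤s z≤n

  rowVec : Matrix w h → Fin h → Vec Bool w
  rowVec F j = tabulate λ i → entry F i j

  rowVec-supp : ∀ A j → rowVec (supp A) j ≡ V.map positive (lookup A j)
  rowVec-supp A j = vec-ext _ _ λ i → trans (VP.lookup∘tabulate _ i) (trans (entry-supp A i j)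
    (sym (VP.lookup-map i positive (lookup A j))))

  rowCount-ones : ∀ (F : Matrix w h) j → rowCount F j ≡ ones (rowVec F j)
  rowCount-ones F j = go F
    where
    go : ∀ {n} (F : Vec (Vec Bool h) n) → V.sum (V.map (λ col → b2n (lookup col j)) F) ≡ ones (tabulate λ i → lookup (lookup F i) j)
    go []        = refl
    go (col ∷ F) = cong (b2n (lookup col j) +_) (go F)

  excess : NMatrix w h → Vec (List ℕ) h
  excess = V.map encode

  assemble : Matrix w h → Vec (List ℕ) h → NMatrix w h
  assemble F K = tabulate λ j → decode (rowVec F j) (lookup K j)

  matrix-ext : ∀ (F E : Matrix w h) → (∀ i j → entry F i j ≡ entry E i j) → F ≡ E
  matrix-ext F E e = vec-ext F E λ i → vec-ext _ _ (e i)

  assemble-supp : ∀ A → assemble (supp A) (excess A) ≡ A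
  assemble-supp A = vec-ext _ _ λ j → trans (VP.lookup∘tabulate _ j)
    (trans (cong₂ decode (rowVec-supp A j) (VP.lookup-map j encode A)) (decode-encode (lookup A j)))

  supp-assemble : ∀ F K → supp (assemble F K) ≡ F
  supp-assemble F K = matrix-ext _ _ λ i j → begin
    entry (supp (assemble F K)) i j                                   ≡⟨ entry-supp (assemble F K) i j ⟩
    positive (lookup (lookup (assemble F K) j) i)                     ≡⟨ cong (λ v → positive (lookup v i)) (VP.lookup∘tabulate _ j) ⟩
    positive (lookup (decode (rowVec F j) (lookup K j)) i)            ≡⟨ VP.lookup-map i positive (decode (rowVec F j) (lookup K j)) ⟨
    lookup (V.map positive (decode (rowVec F j) (lookup K j))) i      ≡⟨ cong (λ v → lookup v i) (positive-decode (rowVec F j) (lookup K j)) ⟩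
    lookup (rowVec F j) i                                             ≡⟨ VP.lookup∘tabulate _ i ⟩
    entry F i j                                                       ∎
    where open ≡-Reasoning

  Fits : Matrix w h → Vec (List ℕ) h → Set
  Fits F K = ∀ j → length (lookup K j) ≡ rowCount F j

  excess-assemble : ∀ F K → Fits F K → excess (assemble F K) ≡ K
  excess-assemble F K fits = vec-ext _ _ λ j → trans (VP.lookup-map j encode (assemble F K))
    (trans (cong encode (VP.lookup∘tabulate _ j)) (encode-decode (rowVec F j) (lookup K j) (trans (fits j) (rowCount-ones F j))))

  sum-assemble : ∀ F K → Fits F K → ∀ j → V.sum (lookup (assemble F K) j) ≡ rowCount F j + listSum (lookup K j)
  sum-assemble F K fits j = trans (cong V.sum (VP.lookup∘tabulate _ j))
    (trans (sum-decode (rowVec F j) (lookup K j) (trans (fits j) (rowCount-ones F j)))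
      (cong (_+ listSum (lookup K j)) (sym (rowCount-ones F j))))

  excess-Fits : ∀ A → Fits (supp A) (excess A)
  excess-Fits A j = trans (cong length (VP.lookup-map j encode A)) (trans (length-encode (lookup A j))
    (trans (cong ones (sym (rowVec-supp A j))) (sym (rowCount-ones (supp A) j))))

  sum-supp : ∀ A j → V.sum (lookup A j) ≡ rowCount (supp A) j + listSum (lookup (excess A) j)
  sum-supp A j = trans (cong (λ A → V.sum (lookup A j)) (sym (assemble-supp A))) (sum-assemble (supp A) (excess A) (excess-Fits A) j)

  noExcess : Matrix w h → Vec (List ℕ) h
  noExcess F = tabulate λ j → replicate (rowCount F j) 0

  noExcess-Fits : ∀ F → Fits F (noExcess F)
  noExcess-Fits F j = trans (cong length (VP.lookup∘tabulate _ j)) (length-replicate (rowCount F j))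

-- Induction on the total of the row sums

module _ {w h : ℕ} (l : ℕ) where

  Good : Poly w h → Matrix w h → Set
  Good M F = IsFilling M F × LongestNE M F l

  good? : ∀ M → Decidable (Good M)
  good? M F = isFilling? M F ×-dec longestNE? M l F

  -- The row counts form a vector because two vectors with equal entries are equal; this lets a
  -- bijection chosen by the counts be chosen again when going back.
  N01 : Poly w h → Vec ℕ h → Matrix w h → Set
  N01 M r F = Good M F × (∀ j → rowCount F j ≡ lookup r j)

  Nℕ : Poly w h → Vec ℕ h → NMatrix w h → Set
  Nℕ M r A = Good M (supp A) × (∀ j → V.sum (lookup A j) ≡ lookup r j)

  -- For a filling with row sums `r` this means that the excess vanishes, that is, that all entries
  -- are 0 or 1.
  Tight : Vec ℕ h → NMatrix w h → Set
  Tight r A = ∀ j → rowCount (supp A) j ≡ lookup r j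

  tight? : ∀ r → Decidable (Tight r)
  tight? r A = all? λ j → rowCount (supp A) j ≟ lookup r j

  Nℕ-enumeration : ∀ M r → Enumeration (Nℕ M r)
  Nℕ-enumeration M r = enumerate (λ A → good? M (supp A) ×-dec all? λ j → V.sum (lookup A j) ≟ lookup r j) (V.sum r)
    (λ { A (_ , e) i j → ≤-trans (lookup-≤-sum (lookup A j) i) (≤-trans (≤-reflexive (e j)) (lookup-≤-sum r j)) })

  tight-N01 : ∀ M r → SameSize (λ A → Nℕ M r A × Tight r A) (N01 M r)
  tight-N01 M r = supp , (λ F → assemble F (noExcess F))
    , (λ { A ((G , _) , t) → G , t })
    , (λ { F (G , t) → (subst (Good M) (sym (supp-assemble F (noExcess F))) G
                       , λ j → trans (sum-assemble F (noExcess F) (noExcess-Fits F) j)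
                                 (trans (cong (rowCount F j +_) (trans (cong listSum (VP.lookup∘tabulate _ j)) (sum-replicate-0 (rowCount F j))))
                                 (trans (+-identityʳ _) (t j))))
                     , λ j → trans (cong (λ F → rowCount F j) (supp-assemble F (noExcess F))) (t j) })
    , (λ { A ((G , e) , t) → trans (cong (assemble (supp A)) (vec-ext (noExcess (supp A)) (excess A) λ j → trans (VP.lookup∘tabulate _ j)
                                (trans (cong (λ n → replicate n 0) (sym (excess-Fits A j))) (sym (zero-sum _ (noEx A e t j))))))
                              (assemble-supp A) })
    , (λ F _ → supp-assemble F (noExcess F))
    where
    noEx : ∀ A → (∀ j → V.sum (lookup A j) ≡ lookup r j) → Tight r A → ∀ j → listSum (lookup (excess A) j) ≡ 0
    noEx A e t j = +-cancelˡ-≡ (rowCount (supp A) j) _ _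
      (trans (sym (sum-supp A j)) (trans (e j) (trans (sym (t j)) (sym (+-identityʳ _)))))

  counts : Matrix w h → Vec ℕ h
  counts F = tabulate (rowCount F)

  -- The supports are exchanged, the excess lists are kept.
  exchange : (Vec ℕ h → Matrix w h → Matrix w h) → NMatrix w h → NMatrix w h
  exchange φ A = assemble (φ (counts (supp A)) (supp A)) (excess A)

  module _ {M M′ : Poly w h} (r : Vec ℕ h) (φ γ : Vec ℕ h → Matrix w h → Matrix w h)
    (ok : ∀ s → V.sum s < V.sum r → ∀ F → N01 M s F → N01 M′ s (φ s F) × γ s (φ s F) ≡ F) where

    -- If the filling is not tight, its row counts have a smaller total than `r`, which is the range
    -- of `ok`. The excess lists still fit afterwards because the exchanged supports have equal row
    -- counts.
    exchange-ok : ∀ A → Nℕ M r A × ¬ Tight r A →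
      (Nℕ M′ r (exchange φ A) × ¬ Tight r (exchange φ A)) × exchange γ (exchange φ A) ≡ A
    exchange-ok A ((G , e) , ¬t) = ((subst (Good M′) (sym S≡) (proj₁ N′) , rowSums) , ¬t′) , back
      where
      F = supp A
      s = counts F
      s≤ : ∀ j → lookup s j ≤ lookup r j
      s≤ j = subst (_≤ lookup r j) (sym (VP.lookup∘tabulate _ j))
        (≤-trans (m≤m+n (rowCount F j) _) (≤-reflexive (trans (sym (sum-supp A j)) (e j))))
      s< : V.sum s < V.sum r
      s< = sum-< s r s≤ (λ eq → ¬t (λ j → trans (sym (VP.lookup∘tabulate _ j)) (eq j)))
      F′ = φ s F
      res = ok s s< F (G , λ j → sym (VP.lookup∘tabulate _ j))
      N′ = proj₁ res
      rc′ : ∀ j → rowCount F′ j ≡ rowCount F j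
      rc′ j = trans (proj₂ N′ j) (VP.lookup∘tabulate _ j)
      fits : Fits F′ (excess A)
      fits j = trans (excess-Fits A j) (sym (rc′ j))
      A′ = exchange φ A
      S≡ : supp A′ ≡ F′
      S≡ = supp-assemble F′ (excess A)
      rowSums : ∀ j → V.sum (lookup A′ j) ≡ lookup r j
      rowSums j = trans (sum-assemble F′ (excess A) fits j) (trans (cong (_+ listSum (lookup (excess A) j)) (rc′ j)) (trans (sym (sum-supp A j)) (e j)))
      ¬t′ : ¬ Tight r A′
      ¬t′ t = ¬t (λ j → trans (sym (rc′ j)) (trans (cong (λ F → rowCount F j) (sym S≡)) (t j)))
      back : exchange γ A′ ≡ A
      back = trans (cong₂ assemble (trans (cong (λ F → γ (counts F) F) S≡)
          (trans (cong (λ s → γ s F′) (VP.tabulate-cong rc′)) (proj₂ res))) (excess-assemble F′ (excess A) fits))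
        (assemble-supp A)

  module _ {M M′ : Poly w h} (H : ∀ r → SameSize (Nℕ M r) (Nℕ M′ r)) where
    private
      go : ∀ n r → V.sum r < n → SameSize (N01 M r) (N01 M′ r)
      go (suc n) r r<n = SameSize-trans (SameSize-sym (tight-N01 M r)) (SameSize-trans
        -- All fillings are matched by `H` and those that are not tight by the induction hypothesis,
        -- which leaves equally many tight ones.
        (SameSize-cancel _≟ᴹ_ (V.replicate h (V.replicate w 0)) (Nℕ-enumeration M r) (Nℕ-enumeration M′ r) (tight? r) (tight? r) (H r)
          ( exchange φ , exchange γ
          , (λ A p → proj₁ (exchange-ok r φ γ φ-ok A p)) , (λ A p → proj₁ (exchange-ok r γ φ γ-ok A p))
          , (λ A p → proj₂ (exchange-ok r φ γ φ-ok A p)) , (λ A p → proj₂ (exchange-ok r γ φ γ-ok A p))))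
        (tight-N01 M′ r))
        where
        ih : ∀ s → V.sum s < V.sum r → SameSize (N01 M s) (N01 M′ s)
        ih s l = go n s (<-≤-trans l (≤-pred r<n))
        φ γ : Vec ℕ h → Matrix w h → Matrix w h
        -- Outside the range of the induction hypothesis the value is arbitrary, since `exchange-ok`
        -- asks only for smaller totals.
        φ s F with V.sum s <? V.sum r
        ... | yes l = proj₁ (ih s l) F
        ... | no  _ = F
        γ s F with V.sum s <? V.sum r
        ... | yes l = proj₁ (proj₂ (ih s l)) F
        ... | no  _ = F
        φ-ok : ∀ s → V.sum s < V.sum r → ∀ F → N01 M s F → N01 M′ s (φ s F) × γ s (φ s F) ≡ F
        φ-ok s l F p with V.sum s <? V.sum r
        ... | yes l′ = let _ , _ , pf , _ , gf , _ = ih s l′ in pf F p , gf F p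
        ... | no ¬l = ⊥-elim (¬l l)
        γ-ok : ∀ s → V.sum s < V.sum r → ∀ F → N01 M′ s F → N01 M s (γ s F) × φ s (γ s F) ≡ F
        γ-ok s l F p with V.sum s <? V.sum r
        ... | yes l′ = let _ , _ , _ , pg , _ , fg = ih s l′ in pg F p , fg F p
        ... | no ¬l = ⊥-elim (¬l l)

    N01-SameSize : ∀ r → SameSize (N01 M r) (N01 M′ r)
    N01-SameSize r = go (suc (V.sum r)) r ≤-refl

  Nℕ⇒NFilling : ∀ {M : Poly w h} r A → Nℕ M r A → NFilling w h (hat M) l (get 0 r) A
  Nℕ⇒NFilling {M} r A ((fil , lng) , e) = nfilling sup (LongestNE⇒ {F = supp A} {X = Positive (at A)} (Positive⇒entry A) (entry⇒Positive A) l lng)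
    (λ j j< → trans (sumsTo j j<) (rj j j<))
    where
    sup : ∀ i j → 0 < at A i j → hat M i j ≡ true
    sup i j p with ≤-<-connex w i | ≤-<-connex h j
    ... | inj₁ o | _ = ⊥-elim (<⇒≢ p (sym (at-out A i j (inj₁ o))))
    ... | inj₂ _ | inj₁ o = ⊥-elim (<⇒≢ p (sym (at-out A i j (inj₂ o))))
    ... | inj₂ i< | inj₂ j< = trans (hat-fromℕ< M i< j<) (fil (fromℕ< i<) (fromℕ< j<)
      (Positive⇒entry A _ _ (subst₂ (Positive (at A)) (sym (toℕ-fromℕ< i<)) (sym (toℕ-fromℕ< j<)) p)))
    sumsTo : ∀ j (j< : j < h) → sumTo w (λ i → at A i j) ≡ V.sum (lookup A (fromℕ< j<))
    sumsTo j j< = trans (sum-get (get (V.replicate w 0) A j))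
      (cong V.sum (trans (cong (get _ A) (sym (toℕ-fromℕ< j<))) (get-lookup A (fromℕ< j<))))
    rj : ∀ j (j< : j < h) → V.sum (lookup A (fromℕ< j<)) ≡ get 0 r j
    rj j j< = trans (e (fromℕ< j<)) (trans (sym (get-lookup r (fromℕ< j<))) (cong (get 0 r) (toℕ-fromℕ< j<)))

  NFilling⇒Nℕ : ∀ {M : Poly w h} r A → NFilling w h (hat M) l (get 0 r) A → Nℕ M r A
  NFilling⇒Nℕ {M} r A (nfilling sup lng sums) = (fil , ⇒LongestNE {F = supp A} {X = Positive (at A)} (Positive⇒entry A) (entry⇒Positive A) l lng) , rs
    where
    fil : IsFilling M (supp A)
    fil i j p = trans (sym (hat-toℕ M i j)) (sup (toℕ i) (toℕ j) (entry⇒Positive A i j p))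
    rs : ∀ j → V.sum (lookup A j) ≡ lookup r j
    rs j = trans (cong V.sum (sym (get-lookup A j))) (trans (sym (sum-get (get (V.replicate w 0) A (toℕ j))))
      (trans (sums (toℕ j) (toℕ<n j)) (get-lookup r j)))

  SameSize-01 : ∀ {M M′ : Poly w h} → (∀ r → SameSize (NFilling w h (hat M) l r) (NFilling w h (hat M′) l r)) →
    ∀ r → SameSize (FneRows M l r) (FneRows M′ l r)
  SameSize-01 {M} {M′} H r = SameSize-trans (SameSize-⇔ (toN M) (fromN M)) (SameSize-trans
    (N01-SameSize {M} {M′} (λ r → SameSize-trans (SameSize-⇔ (Nℕ⇒NFilling r) (NFilling⇒Nℕ r))
      (SameSize-trans (H (get 0 r)) (SameSize-⇔ (NFilling⇒Nℕ r) (Nℕ⇒NFilling r)))) (tabulate r))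
    (SameSize-⇔ (fromN M′) (toN M′)))
    where
    toN : ∀ M F → FneRows M l r F → N01 M (tabulate r) F
    toN M F (f , c , e) = (f , c) , λ j → trans (e j) (sym (VP.lookup∘tabulate r j))
    fromN : ∀ M F → N01 M (tabulate r) F → FneRows M l r F
    fromN M F ((f , c) , e) = f , c , λ j → trans (e j) (VP.lookup∘tabulate r j)

-- The number of fillings depends only on the content

sumTo-sum : ∀ n f → sumTo n f ≡ sum {n} (λ i → f (toℕ i))
sumTo-sum zero    f = refl
sumTo-sum (suc n) f = trans (sumTo-suc n f) (cong (f 0 +_) (sumTo-sum n (λ i → f (suc i))))

vecSum-sum : ∀ {A : Set} (φ : A → ℕ) {n} (v : Vec A n) → V.sum (V.map φ v) ≡ sum {n} (λ i → φ (lookup v i))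
vecSum-sum φ []      = refl
vecSum-sum φ (x ∷ v) = cong (φ x +_) (vecSum-sum φ v)

totalCount-sum : ∀ {w h} (F : Matrix w h) → totalCount F ≡ sum {w} (λ i → sum {h} (λ j → b2n (entry F i j)))
totalCount-sum F = trans (vecSum-sum _ F) (sum-cong-≗ λ i → vecSum-sum b2n (lookup F i))

totalCount-rows : ∀ {w h} (F : Matrix w h) → totalCount F ≡ sum {h} (rowCount F)
totalCount-rows F = trans (totalCount-sum F) (trans (∑-comm (λ i j → b2n (entry F i j)))
  (sum-cong-≗ λ j → sym (vecSum-sum (λ col → b2n (lookup col j)) F)))

module _ {w h : ℕ} {M M′ : Poly w h} {l : ℕ} (H : ∀ r → SameSize (FneRows M l r) (FneRows M′ l r)) where

  -- Each filling is sent by the bijection that belongs to its own row counts. The image has the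
  -- same row counts, so the way back selects the same bijection, and the total is unchanged.
  rows-total : ∀ n → SameSize (FneTotal M l n) (FneTotal M′ l n)
  rows-total n = f , g , (λ F p → proj₁ (fwd F p)) , (λ F p → proj₁ (bwd F p)) , (λ F p → proj₂ (fwd F p)) , (λ F p → proj₂ (bwd F p))
    where
    f g : Matrix w h → Matrix w h
    f F = proj₁ (H (lookup (counts l F))) F
    g F = proj₁ (proj₂ (H (lookup (counts l F)))) F
    module _ (F F′ : Matrix w h) (e : ∀ j → rowCount F′ j ≡ lookup (counts l F) j) where
      rc : ∀ j → rowCount F′ j ≡ rowCount F j
      rc j = trans (e j) (VP.lookup∘tabulate _ j)
      counts≡ : counts l F′ ≡ counts l F
      counts≡ = VP.tabulate-cong rc
      total≡ : totalCount F′ ≡ totalCount F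
      total≡ = trans (totalCount-rows F′) (trans (sum-cong-≗ rc) (sym (totalCount-rows F)))
    fwd : ∀ F → FneTotal M l n F → FneTotal M′ l n (f F) × g (f F) ≡ F
    fwd F (fil , c , e) with H (lookup (counts l F)) in eq
    ... | f′ , g′ , pf , _ , gf , _ with pf F (fil , c , λ j → sym (VP.lookup∘tabulate _ j))
    ...   | fil′ , c′ , e′ = (fil′ , c′ , trans (total≡ F (f′ F) e′) e)
          , trans (cong (λ s → proj₁ (proj₂ (H (lookup s))) (f′ F)) (counts≡ F (f′ F) e′))
              (trans (cong (λ b → proj₁ (proj₂ b) (f′ F)) eq) (gf F (fil , c , λ j → sym (VP.lookup∘tabulate _ j))))
    bwd : ∀ F → FneTotal M′ l n F → FneTotal M l n (g F) × f (g F) ≡ F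
    bwd F (fil , c , e) with H (lookup (counts l F)) in eq
    ... | f′ , g′ , _ , pg , _ , fg with pg F (fil , c , λ j → sym (VP.lookup∘tabulate _ j))
    ...   | fil′ , c′ , e′ = (fil′ , c′ , trans (total≡ F (g′ F) e′) e)
          , trans (cong (λ s → proj₁ (H (lookup s)) (g′ F)) (counts≡ F (g′ F) e′))
              (trans (cong (λ b → proj₁ b (g′ F)) eq) (fg F (fil , c , λ j → sym (VP.lookup∘tabulate _ j))))

-- Transposing fillings and changing the box

transposePoly : ∀ {w h} → Poly w h → Poly h w
transposePoly M j i = M i j

hat-transpose : ∀ {w h} (M : Poly w h) i j → hat (transposePoly M) j i ≡ hat M i j
hat-transpose {w} {h} M i j with i <? w | j <? h
... | yes _ | yes _ = refl
... | yes _ | no  _ = refl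
... | no  _ | yes _ = refl
... | no  _ | no  _ = refl

hasChain-map : ∀ {M M′ X Y k} → (∀ i j → M i j ≡ M′ i j) → (∀ i j → X i j → Y i j) → HasChain M X k → HasChain M′ Y k
hasChain-map e f (chainIn p q R C) = chainIn p q (λ i j a b c d → trans (sym (e i j)) (R i j a b c d)) (chain-map (λ i j _ _ _ _ → f i j) C)

hasChain-transpose : ∀ {M X k} → HasChain M X k → HasChain (λ j i → M i j) (λ j i → X i j) k
hasChain-transpose (chainIn p q R C) = chainIn q p (λ j i a b c d → R i j c d a b) (chain-transpose C)

longest-from : ∀ {w h w′ h′} {M : Poly w h} {M′ : Poly w′ h′} {F : Matrix w h} {F′ : Matrix w′ h′} {l} →
  (∀ {k} → HasChain (hat M) (Ones F) k → HasChain (hat M′) (Ones F′) k) →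
  (∀ {k} → HasChain (hat M′) (Ones F′) k → HasChain (hat M) (Ones F) k) → LongestNE M F l → LongestNE M′ F′ l
longest-from {F = F} {F′} {l} into back L with LongestNE⇒ {F = F} {X = Ones F} (ones⇒ F) (⇒ones F) l L
... | c , bd = ⇒LongestNE {F = F′} {X = Ones F′} (ones⇒ F′) (⇒ones F′) l (into c , λ k c → bd k (back c))

transposeMatrix : ∀ {w h} → Matrix w h → Matrix h w
transposeMatrix F = tabulate λ j → tabulate λ i → entry F i j

entry-tabulate : ∀ {w h} (f : Fin w → Fin h → Bool) i j → entry (tabulate λ i → tabulate λ j → f i j) i j ≡ f i j
entry-tabulate f i j = trans (cong (λ v → lookup v j) (VP.lookup∘tabulate _ i)) (VP.lookup∘tabulate _ j)

hat-cong : ∀ {w h} {M M′ : Poly w h} → (∀ i j → M i j ≡ M′ i j) → ∀ i j → hat M i j ≡ hat M′ i j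
hat-cong {w} {h} e i j with i <? w | j <? h
... | yes _ | yes _ = e _ _
... | yes _ | no  _ = refl
... | no  _ | _     = refl

transpose-FneTotal : ∀ {w h} (M : Poly w h) l n F → FneTotal M l n F → FneTotal (transposePoly M) l n (transposeMatrix F)
transpose-FneTotal {w} {h} M l n F (fil , c , e) =
    (λ j i x → fil i j (trans (sym (entry-tabulate (λ j i → entry F i j) j i)) x))
  , longest-from {M = M} {transposePoly M} {F} {Fᵗ} into back c
  , trans (totalCount-sum Fᵗ) (trans (sum-cong-≗ λ j → sum-cong-≗ λ i → cong b2n (entry-tabulate (λ j i → entry F i j) j i))
      (trans (sym (∑-comm (λ i j → b2n (entry F i j)))) (trans (sym (totalCount-sum F)) e)))
  where
  Fᵗ = transposeMatrix F
  ones≡ : ∀ i j → hat (entry Fᵗ) j i ≡ hat (entry F) i j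
  ones≡ i j = trans (hat-cong (entry-tabulate (λ j i → entry F i j)) j i) (hat-transpose (entry F) i j)
  into : ∀ {k} → HasChain (hat M) (Ones F) k → HasChain (hat (transposePoly M)) (Ones Fᵗ) k
  into c = hasChain-map (λ j i → sym (hat-transpose M i j)) (λ j i → trans (ones≡ i j)) (hasChain-transpose c)
  back : ∀ {k} → HasChain (hat (transposePoly M)) (Ones Fᵗ) k → HasChain (hat M) (Ones F) k
  back c = hasChain-map (λ i j → hat-transpose M i j) (λ i j → trans (sym (ones≡ i j))) (hasChain-transpose c)

transpose-SameSize : ∀ {w h} (M : Poly w h) l n → SameSize (FneTotal M l n) (FneTotal (transposePoly M) l n)
transpose-SameSize M l n = transposeMatrix , transposeMatrix , transpose-FneTotal M l n , transpose-FneTotal (transposePoly M) l n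
  , (λ F _ → invol F) , (λ F _ → invol F)
  where
  invol : ∀ {w h} (F : Matrix w h) → transposeMatrix (transposeMatrix F) ≡ F
  invol F = matrix-ext _ _ λ i j → trans (entry-tabulate _ i j) (entry-tabulate (λ j i → entry F i j) j i)

sumTo-pad : ∀ {n} N {f : ℕ → ℕ} → n ≤ N → (∀ i → n ≤ i → f i ≡ 0) → sumTo N f ≡ sumTo n f
sumTo-pad N n≤N z with m≤n⇒m<n∨m≡n n≤N
sumTo-pad N n≤N z | inj₂ refl = refl
sumTo-pad (suc N) n≤N z | inj₁ (s≤s n≤) = trans (cong₂ _+_ (sumTo-pad N n≤ z) (z N n≤)) (+-identityʳ _)

sumTo-zero : ∀ n {f : ℕ → ℕ} → (∀ i → f i ≡ 0) → sumTo n f ≡ 0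
sumTo-zero n z = sumTo-pad n z≤n (λ i _ → z i)

hat-out : ∀ {w h} (M : Poly w h) i j → w ≤ i ⊎ h ≤ j → hat M i j ≡ false
hat-out M i j o with hat M i j in eq
... | false = refl
... | true with o
...   | inj₁ w≤i = ⊥-elim (<⇒≱ (proj₁ (hat-box M i j eq)) w≤i)
...   | inj₂ h≤j = ⊥-elim (<⇒≱ (proj₂ (hat-box M i j eq)) h≤j)

totalCount-hat : ∀ {w h W H} (F : Matrix w h) → w ≤ W → h ≤ H →
  totalCount F ≡ sumTo W (λ i → sumTo H (λ j → b2n (hat (entry F) i j)))
totalCount-hat {w} {h} {W} {H} F w≤ h≤ = sym (begin
  sumTo W (λ i → sumTo H (λ j → b2n (hat (entry F) i j)))    ≡⟨ sumTo-pad W w≤ (λ i w≤i → sumTo-zero H (λ j → cong b2n (hat-out (entry F) i j (inj₁ w≤i)))) ⟩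
  sumTo w (λ i → sumTo H (λ j → b2n (hat (entry F) i j)))    ≡⟨ sumTo-cong w (λ i _ → sumTo-pad H h≤ (λ j h≤j → cong b2n (hat-out (entry F) i j (inj₂ h≤j)))) ⟩
  sumTo w (λ i → sumTo h (λ j → b2n (hat (entry F) i j)))    ≡⟨ sumTo-sum w _ ⟩
  _                                                          ≡⟨ sum-cong-≗ (λ i → trans (sumTo-sum h _) (sum-cong-≗ λ j → cong b2n (hat-toℕ (entry F) i j))) ⟩
  sum {w} (λ i → sum {h} (λ j → b2n (entry F i j)))          ≡⟨ totalCount-sum F ⟨
  totalCount F                                               ∎)
  where open ≡-Reasoning

-- Two polyominoes with the same content may be given in boxes of different sizes; their Ferrers
-- diagrams agree only as sets of cells.
resize : ∀ {w h} w′ h′ → Matrix w h → Matrix w′ h′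
resize w′ h′ F = tabulate λ i → tabulate λ j → hat (entry F) (toℕ i) (toℕ j)

module _ {w h w′ h′} (M : Poly w h) (M′ : Poly w′ h′) (M≗ : ∀ i j → hat M i j ≡ hat M′ i j) where

  module _ (F : Matrix w h) (fil : IsFilling M F) where
    hat-resize : ∀ i j → hat (entry (resize w′ h′ F)) i j ≡ hat (entry F) i j
    hat-resize i j = ≡true⇔
      (λ c → let p , q = hat-box (entry F′) i j c in trans (sym (value p q)) c)
      (λ c → let p , q = inBox c in trans (value p q) c)
      where
      F′ = resize w′ h′ F
      value : ∀ {i j} → i < w′ → j < h′ → hat (entry F′) i j ≡ hat (entry F) i j
      value p q = trans (hat-fromℕ< (entry F′) p q) (trans (entry-tabulate (λ i j → hat (entry F) (toℕ i) (toℕ j)) _ _)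
        (cong₂ (hat (entry F)) (toℕ-fromℕ< p) (toℕ-fromℕ< q)))
      inBox : ∀ {i j} → hat (entry F) i j ≡ true → i < w′ × j < h′
      inBox {i} {j} c = let p , q , x = hat-cell (entry F) i j c in
        hat-box M′ i j (trans (sym (M≗ i j)) (trans (hat-fromℕ< M p q) (fil (fromℕ< p) (fromℕ< q) x)))

  resize-FneTotal : ∀ l n F → FneTotal M l n F → FneTotal M′ l n (resize w′ h′ F)
  resize-FneTotal l n F (fil , c , e) =
      (λ i j x → let F⇒ = trans (sym (hat-resize F fil (toℕ i) (toℕ j))) (⇒ones F′ i j x) ; p , q , y = hat-cell (entry F) _ _ F⇒ in
        trans (sym (hat-toℕ M′ i j)) (trans (sym (M≗ _ _)) (trans (hat-fromℕ< M p q) (fil _ _ y))))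
    , longest-from {M = M} {M′} {F} {F′} (hasChain-map M≗ (λ i j → trans (hat-resize F fil i j)))
        (hasChain-map (λ i j → sym (M≗ i j)) (λ i j → trans (sym (hat-resize F fil i j)))) c
    -- Both totals are computed in a box that contains the old and the new one.
    , trans (totalCount-hat {W = w ⊔ w′} {h ⊔ h′} F′ (m≤n⊔m w w′) (m≤n⊔m h h′))
        (trans (sumTo-cong (w ⊔ w′) (λ i _ → sumTo-cong (h ⊔ h′) (λ j _ → cong b2n (hat-resize F fil i j))))
        (trans (sym (totalCount-hat {W = w ⊔ w′} {h ⊔ h′} F (m≤m⊔n w w′) (m≤m⊔n h h′))) e))
    where
    F′ = resize w′ h′ F

  resize-resize : ∀ F → IsFilling M F → resize w h (resize w′ h′ F) ≡ F
  resize-resize F fil = matrix-ext _ _ λ i j → trans (entry-tabulate (λ i j → hat (entry (resize w′ h′ F)) (toℕ i) (toℕ j)) i j)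
    (trans (hat-resize F fil (toℕ i) (toℕ j)) (hat-toℕ (entry F) i j))

resize-SameSize : ∀ {w h w′ h′} (M : Poly w h) (M′ : Poly w′ h′) → (∀ i j → hat M i j ≡ hat M′ i j) →
  ∀ l n → SameSize (FneTotal M l n) (FneTotal M′ l n)
resize-SameSize {w} {h} {w′} {h′} M M′ M≗ l n = resize w′ h′ , resize w h
  , resize-FneTotal M M′ M≗ l n , resize-FneTotal M′ M (λ i j → sym (M≗ i j)) l n
  , (λ F p → resize-resize M M′ M≗ F (proj₁ p)) , (λ F p → resize-resize M′ M (λ i j → sym (M≗ i j)) F (proj₁ p))

rowLength-permute : ∀ {w h} (σ : Permutation′ w) (M : Poly w h) j → rowLength w (hat (permuteCols σ M)) j ≡ rowLength w (hat M) j
rowLength-permute {w} {h} σ M j = trans (sumTo-sum w _) (trans (sum-cong-≗ λ i → cong b2n (col i))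
  (trans (sym (sum-permute (λ i → b2n (hat M (toℕ i) j)) (flip σ))) (sym (sumTo-sum w _))))
  where
  col : ∀ i → hat (permuteCols σ M) (toℕ i) j ≡ hat M (toℕ (σ ⟨$⟩ˡ i)) j
  col i with ≤-<-connex h j
  ... | inj₁ h≤j = trans (hat-out (permuteCols σ M) _ j (inj₂ h≤j)) (sym (hat-out M _ j (inj₂ h≤j)))
  ... | inj₂ j<h rewrite sym (toℕ-fromℕ< j<h) = trans (hat-toℕ (permuteCols σ M) i _) (sym (hat-toℕ M (σ ⟨$⟩ˡ i) _))

rows-theorem : ∀ (w h : ℕ) (M : Poly w h) → IsMoon M → ∀ (l : ℕ) (r : Fin h → ℕ) (σ : Permutation′ w) →
  IsMoon (permuteCols σ M) → SameSize (FneRows M l r) (FneRows (permuteCols σ M) l r)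
rows-theorem w h M m l r σ m′ = SameSize-01 l {M} {permuteCols σ M} (λ r → SameSize-trans (canonical-SameSize (S M m) l r)
  (SameSize-trans (SameSize-⇔ (λ F → NFilling-resp eq) (λ F → NFilling-resp (λ i j → sym (eq i j))))
    (SameSize-sym (canonical-SameSize (S (permuteCols σ M) m′) l r)))) r
  where
  S : ∀ M → IsMoon M → Sorting w h (hat M)
  S M m = sort w ≤-refl (moon-Sorted M m)
  eq : ∀ i j → canonical w (hat M) i j ≡ canonical w (hat (permuteCols σ M)) i j
  eq i j = cong (i <ᵇ_) (sym (rowLength-permute σ M j))

module Sort {w h} (M : Poly w h) (moon : IsMoon M) where

  S : Sorting w h (hat M)
  S = sort w ≤-refl (moon-Sorted M moon)

  sortedPoly : Poly w h
  sortedPoly i j = canonical w (hat M) (toℕ i) (toℕ j)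

  hat-sorted : ∀ i j → hat sortedPoly i j ≡ canonical w (hat M) i j
  hat-sorted i j = ≡true⇔
    (λ c → let p , q = hat-box sortedPoly i j c in trans (sym (value p q)) c)
    (λ c → let p , q = Sorted.box (Sorting.sorted S) i j (trans (N-canonical S i j) c) in trans (value p q) c)
    where
    value : ∀ {i j} → i < w → j < h → hat sortedPoly i j ≡ canonical w (hat M) i j
    value p q = trans (hat-fromℕ< sortedPoly p q) (cong₂ (canonical w (hat M)) (toℕ-fromℕ< p) (toℕ-fromℕ< q))

  sorted-total : ∀ l n → SameSize (FneTotal M l n) (FneTotal sortedPoly l n)
  sorted-total l n = rows-total {M = M} {sortedPoly} (SameSize-01 l {M} {sortedPoly} (λ r → SameSize-trans (canonical-SameSize S l r)
    (SameSize-⇔ (λ F → NFilling-resp (λ i j → sym (hat-sorted i j))) (λ F → NFilling-resp hat-sorted)))) n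

  sorted-antitone : ∀ i i′ j → i ≤ i′ → canonical w (hat M) i′ j ≡ true → canonical w (hat M) i j ≡ true
  sorted-antitone i i′ j i≤ c = <ᵇ-true (≤-<-trans i≤ (true-<ᵇ {i′} {rowLength w (hat M) j} c))

  -- After sorting, every row is an initial segment, so the rows are convex and nested; the columns
  -- have only changed places and remain intervals.
  transpose-moon : IsMoon (transposePoly sortedPoly)
  transpose-moon =
      ( (λ j i₁ i i₂ _ c₂ _ i≤ → sorted-antitone (toℕ i) (toℕ i₂) (toℕ j) i≤ c₂)
      , (λ i j₁ j j₂ c₁ c₂ l₁ l₂ → trans (sym (N-canonical S (toℕ i) (toℕ j))) (Sorted.convex (Sorting.sorted S) (toℕ i) (toℕ j₁) (toℕ j) (toℕ j₂)
          (trans (N-canonical S (toℕ i) (toℕ j₁)) c₁) (trans (N-canonical S (toℕ i) (toℕ j₂)) c₂) l₁ l₂)))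
    , nest
    where
    nest : IsIntersectionFree (transposePoly sortedPoly)
    nest j j′ with ≤-total (rowLength w (hat M) (toℕ j)) (rowLength w (hat M) (toℕ j′))
    ... | inj₁ l = inj₁ (λ i c → <ᵇ-true (<-≤-trans (true-<ᵇ c) l))
    ... | inj₂ l = inj₂ (λ i c → <ᵇ-true (<-≤-trans (true-<ᵇ c) l))

sumTo-mono : ∀ n {f g : ℕ → ℕ} → (∀ i → f i ≤ g i) → sumTo n f ≤ sumTo n g
sumTo-mono zero    l = z≤n
sumTo-mono (suc n) l = +-mono-≤ (sumTo-mono n l) (l n)

b2n-mono : ∀ {x y} → (x ≡ true → y ≡ true) → b2n x ≤ b2n y
b2n-mono {false} f = z≤n
b2n-mono {true}  f rewrite f refl = ≤-refl

-- The part with index `t` of the conjugate partition. Zeros do not contribute, so dropping empty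
-- columns from the content is harmless.
above : ℕ → List ℕ → ℕ
above t xs = listSum (L.map (λ n → b2n (t <ᵇ n)) xs)

above-filter : ∀ t xs → above t (filter (λ n → 1 ≤? n) xs) ≡ above t xs
above-filter t []           = refl
above-filter t (zero  ∷ xs) = above-filter t xs
above-filter t (suc x ∷ xs) = cong (b2n (t <ᵇ suc x) +_) (above-filter t xs)

above-toList : ∀ t {n} (v : Vec ℕ n) → above t (V.toList v) ≡ sum {n} (λ i → b2n (t <ᵇ lookup v i))
above-toList t []      = refl
above-toList t (x ∷ v) = cong (b2n (t <ᵇ x) +_) (above-toList t v)

module Ferrers {w h} (M : Poly w h) (moon : IsMoon M) where
  open Sort M moon
  open Sort (transposePoly sortedPoly) transpose-moon using ()
    renaming (sortedPoly to ferrers; hat-sorted to hat-ferrers; sorted-total to ferrers-total)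
  open Sort (transposePoly sortedPoly) transpose-moon using () renaming (sortedPoly to ferrersPoly) public

  total : ∀ l n → SameSize (FneTotal M l n) (FneTotal ferrers l n)
  total l n = SameSize-trans (sorted-total l n) (SameSize-trans (transpose-SameSize sortedPoly l n) (ferrers-total l n))

  private
    C = canonical w (hat M)

    height : (ℕ → Bool) → ℕ
    height c = sumTo h (λ j → b2n (c j))

    -- Sorting rearranges whole columns, so the sorted polyomino has the same heights as `M`, and a
    -- count over them ignores their order.
    heights : ∀ t → sumTo w (λ i → b2n (t <ᵇ height (C i))) ≡ above t (content M)
    heights t = begin
      sumTo w (λ i → b2n (t <ᵇ height (C i)))             ≡⟨ sumTo-cong w (λ i _ → cong (λ n → b2n (t <ᵇ n)) (sumTo-cong h (λ j _ → cong b2n (sym (N-canonical S i j))))) ⟩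
      sumTo w (λ i → b2n (t <ᵇ height (Sorting.N S i)))   ≡⟨ Sorting.sameSum S (λ c → b2n (t <ᵇ height c)) ⟩
      sumTo w (λ i → b2n (t <ᵇ height (hat M i)))         ≡⟨ sumTo-sum w _ ⟩
      sum {w} (λ i → b2n (t <ᵇ height (hat M (toℕ i))))   ≡⟨ sum-cong-≗ (λ i → cong (λ n → b2n (t <ᵇ n)) (col i)) ⟩
      sum {w} (λ i → b2n (t <ᵇ colHeight M i))            ≡⟨ sum-cong-≗ (λ i → cong (λ n → b2n (t <ᵇ n)) (sym (lookup-col i))) ⟩
      sum {w} (λ i → b2n (t <ᵇ lookup (V.map (colHeight M) (allFin w)) i))  ≡⟨ above-toList t (V.map (colHeight M) (allFin w)) ⟨
      above t (V.toList (V.map (colHeight M) (allFin w))) ≡⟨ above-filter t (V.toList (V.map (colHeight M) (allFin w))) ⟨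
      above t (content M)                                 ∎
      where
      open ≡-Reasoning
      lookup-col : ∀ i → lookup (V.map (colHeight M) (allFin w)) i ≡ colHeight M i
      lookup-col i = trans (VP.lookup-map i (colHeight M) (allFin w)) (cong (colHeight M) (VP.lookup-allFin i))
      col : ∀ i → height (hat M (toℕ i)) ≡ colHeight M i
      col i = trans (sumTo-sum h _) (sym (trans (vecSum-sum (λ j → b2n (M i j)) (allFin h))
        (sum-cong-≗ λ j → trans (cong (λ j → b2n (M i j)) (VP.lookup-allFin j)) (cong b2n (sym (hat-toℕ M i j))))))

  -- Conjugation of partitions: as the sorted heights decrease, column `i` is higher than `t`
  -- exactly if more than `i` columns are.
  ferrers-content : ∀ t i → hat ferrers t i ≡ (i <ᵇ above t (content M))
  ferrers-content t i = trans (hat-ferrers t i) (trans (cong (t <ᵇ_) (sumTo-cong h (λ j _ → cong b2n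
      (trans (hat-transpose sortedPoly i j) (hat-sorted i j))))) (≡true⇔
    (λ c → <ᵇ-true (subst (i <_) (heights t) (proj₁ count c)))
    (λ c → proj₂ count (subst (i <_) (sym (heights t)) (true-<ᵇ c)))))
    where
    bound : ∀ i → (t <ᵇ height (C i)) ≡ true → i < w
    bound i c with ≤-<-connex w i
    ... | inj₂ l = l
    ... | inj₁ w≤i = ⊥-elim (n≮0 (subst (t <_) (sumTo-zero h (λ j → cong b2n (trans (sym (hat-sorted i j)) (hat-out sortedPoly i j (inj₁ w≤i))))) (true-<ᵇ c)))
    count = antitone-count w (λ i → t <ᵇ height (C i))
      (λ i i′ i≤ c → <ᵇ-true (<-≤-trans (true-<ᵇ c) (sumTo-mono h (λ j → b2n-mono (sorted-antitone i i′ j i≤))))) bound i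

content-theorem : ∀ (w h w′ h′ : ℕ) (M : Poly w h) (M′ : Poly w′ h′) → IsMoon M → IsMoon M′ →
  content M ↭ content M′ → ∀ (l n : ℕ) → SameSize (FneTotal M l n) (FneTotal M′ l n)
content-theorem w h w′ h′ M M′ m m′ perm l n = SameSize-trans (F₁.total l n) (SameSize-trans
  (resize-SameSize F₁.ferrersPoly F₂.ferrersPoly eq l n) (SameSize-sym (F₂.total l n)))
  where
  module F₁ = Ferrers M m
  module F₂ = Ferrers M′ m′
  eq : ∀ t i → hat F₁.ferrersPoly t i ≡ hat F₂.ferrersPoly t i
  eq t i = trans (F₁.ferrers-content t i) (trans (cong (i <ᵇ_) (sum-↭ (map⁺ (λ n → b2n (t <ᵇ n)) perm))) (sym (F₂.ferrers-content t i)))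

theorem5p1 : (∀ (w h : ℕ) (M : Poly w h) → IsMoon M →
    ∀ (l : ℕ) (r : Fin h → ℕ) (σ : Permutation′ w) → IsMoon (permuteCols σ M) →
    SameSize (FneRows M l r) (FneRows (permuteCols σ M) l r))
    × (∀ (w h w′ h′ : ℕ) (M : Poly w h) (M′ : Poly w′ h′) → IsMoon M → IsMoon M′ →
    content M ↭ content M′ →
    ∀ (l n : ℕ) → SameSize (FneTotal M l n) (FneTotal M′ l n))
theorem5p1 = rows-theorem , content-theorem
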